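{- Let $p$ be a prime with $p\ne 3$. The group $\tilde H_d(\mathsf{M}_n;\mathbb{Z}_p)$ is zero unless $2n-8\le 5d$. Moreover, for each $q\ge 0$, with all homology and chains taken with coefficients in $\mathbb{Z}_p$: (i) $\tilde H_{2q-1}(\mathsf{M}_{5q})$ is generated by (homology classes of) cycles of type $[5,2]^q$ and cycles of type $[3,1]\wedge[5q-3,2q-1]$; (ii) $\tilde H_{2q-1}(\mathsf{M}_{5q+1})$ is generated by cycles of type $[1,0]\wedge[5,2]^q$; (iii) $\tilde H_{2q}(\mathsf{M}_{5q+3})$ is generated by cycles of type $[3,1]\wedge[5,2]^q$; (iv) $\tilde H_{2q}(\mathsf{M}_{5q+4})$ is generated by cycles of type $[1,0]\wedge[3,1]\wedge[5,2]^q$.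
   Context: For a finite set $S$, $\mathsf{M}[S]$ is the matching complex of the complete graph on $S$ (vertices: edges $ab=\{a,b\}$; faces: matchings), and $\mathsf{M}_n=\mathsf{M}[[n]]$, $[n]=\{1,\dots,n\}$. $\tilde C$, $\tilde H$ denote reduced simplicial chains and homology; an oriented simplex is written $e_0\wedge\cdots\wedge e_d$. For chains $c,c'$ supported on matchings of disjoint vertex sets, $c\wedge c'$ is the bilinear extension of $(e_0\wedge\cdots\wedge e_a)\wedge(f_0\wedge\cdots\wedge f_b)=e_0\wedge\cdots\wedge e_a\wedge f_0\wedge\cdots\wedge f_b$. A cycle $z\in\tilde C_{d-1}(\mathsf{M}_n)$ with $d=d_1+\cdots+d_s$ has type $[n_1,d_1]\wedge\cdots\wedge[n_s,d_s]$ if there is a partition $[n]=S_1\cup\cdots\cup S_s$ with $|S_i|=n_i$ and cycles $z_i\in\tilde C_{d_i-1}(\mathsf{M}[S_i])$ with $z=z_1\wedge\cdots\wedge z_s$ ($\tilde C_{ -1}$ is spanned by the empty simplex); $[n,d]^q$ denotes $q$ copies of $[n,d]$ joined by $\wedge$ (empty if $q=0$). -}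

module Defs where

open import Data.Nat as ℕ using (ℕ; zero; suc; _<_; _+_; _<ᵇ_; _≡ᵇ_; _≤ᵇ_)
open import Data.Integer as ℤ using (ℤ; +_; -_) renaming (_*_ to _*ℤ_; _-_ to _-ℤ_; _+_ to _+ℤ_)
open import Data.Integer.Divisibility using () renaming (_∣_ to _∣ℤ_)
open import Data.Product using (_×_; _,_; proj₁; proj₂; ∃)
open import Data.List using (List; []; _∷_; _++_; map; concatMap; concat; length; foldr; upTo)
open import Data.List.Membership.Propositional using (_∈_)
open import Data.List.Relation.Unary.All using (All)
open import Data.List.Relation.Unary.Unique.Propositional using (Unique)
open import Data.List.Relation.Binary.Permutation.Propositional using (_↭_)
open import Data.Bool using (Bool; true; false; _∨_; _∧_; if_then_else_)
open import Relation.Nullary.Decidable using (does)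
open import Relation.Binary.PropositionalEquality using (_≡_)
import Data.List.Properties as LP
import Data.Product.Properties as PP

-- Vertices are natural numbers; [n] is rendered as upTo n = 0 , 1 , … , n-1.
-- An edge ab is a pair (a , b) with a < b.
Edge : Set
Edge = ℕ × ℕ

-- An oriented simplex e₀ ∧ ⋯ ∧ e_d is the list of its edges in order.
Simplex : Set
Simplex = List Edge

-- A chain is a formal ℤ-linear combination of oriented simplices
-- (coefficients are read modulo p, see _≈[_]_ below).
Term : Set
Term = ℤ × Simplex

Chain : Set
Chain = List Term

vertices : Simplex → List ℕ
vertices = concatMap (λ e → proj₁ e ∷ proj₂ e ∷ [])

IsEdgeOn : List ℕ → Edge → Set
IsEdgeOn S (a , b) = a < b × a ∈ S × b ∈ S

IsMatchingOn : List ℕ → Simplex → Set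
IsMatchingOn S σ = All (IsEdgeOn S) σ × Unique (vertices σ)

-- c ∈ C̃_{d-1}(M[S]) : every term is an oriented face of M[S] with d edges.
ChainOn : List ℕ → ℕ → Chain → Set
ChainOn S d c = All (λ t → IsMatchingOn S (proj₂ t) × length (proj₂ t) ≡ d) c

_≤E_ : Edge → Edge → Bool
(a , b) ≤E (c , d) = (a <ᵇ c) ∨ ((a ≡ᵇ c) ∧ (b ≤ᵇ d))

insertS : Edge → List Edge → List Edge × ℕ
insertS e [] = (e ∷ [] , 0)
insertS e (f ∷ fs) with e ≤E f
... | true = (e ∷ f ∷ fs , 0)
... | false with insertS e fs
... | (r , k) = (f ∷ r , suc k)

sortS : List Edge → List Edge × ℕ
sortS [] = ([] , 0)
sortS (e ∷ es) with sortS es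
... | (r , k) with insertS e r
... | (r' , k') = (r' , k + k')

sgn : ℕ → ℤ
sgn zero = + 1
sgn (suc n) = - sgn n

_≟S_ = LP.≡-dec (PP.≡-dec ℕ._≟_ ℕ._≟_)

-- coefficient of the term (k , σ) on the oriented simplex τ:
-- ±k if σ is a permutation of τ (sign of the permutation), else 0.
coeffTerm : Simplex → Term → ℤ
coeffTerm τ (k , σ) =
  if does (proj₁ (sortS σ) ≟S proj₁ (sortS τ))
  then sgn (proj₂ (sortS σ) + proj₂ (sortS τ)) *ℤ k
  else + 0

coeff : Chain → Simplex → ℤ
coeff c τ = foldr _+ℤ_ (+ 0) (map (coeffTerm τ) c)

_≈[_]_ : Chain → ℕ → Chain → Set
c ≈[ p ] c' = ∀ (τ : Simplex) → (+ p) ∣ℤ (coeff c τ -ℤ coeff c' τ)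

-- signed facets: ∂(e₀ ∧ ⋯ ∧ e_d) = Σᵢ (-1)ⁱ e₀ ∧ ⋯ ê_i ⋯ ∧ e_d ; ∂(∅) = 0 (reduced)
bdS : Simplex → List Term
bdS [] = []
bdS (e ∷ σ) = (+ 1 , σ) ∷ map (λ t → (- proj₁ t , e ∷ proj₂ t)) (bdS σ)

∂ : Chain → Chain
∂ c = concatMap (λ t → map (λ f → (proj₁ t *ℤ proj₁ f , proj₂ f)) (bdS (proj₂ t))) c

wedge : Chain → Chain → Chain
wedge c c' = concatMap (λ t → map (λ t' → (proj₁ t *ℤ proj₁ t' , proj₂ t ++ proj₂ t')) c') c

unitChain : Chain
unitChain = (+ 1 , []) ∷ []

scale : ℤ → Chain → Chain
scale k c = map (λ t → (k *ℤ proj₁ t , proj₂ t)) c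

_⊖_ : Chain → Chain → Chain
c ⊖ c' = c ++ scale (- + 1) c'

lincomb : List (ℤ × Chain) → Chain
lincomb gens = concatMap (λ g → scale (proj₁ g) (proj₂ g)) gens

-- z is a cycle in C̃_{d-1}(M[S]; ℤ_p)
IsCycleOn : ℕ → List ℕ → ℕ → Chain → Set
IsCycleOn p S d z = ChainOn S d z × (∂ z ≈[ p ] [])

-- A type [n₁,d₁] ∧ ⋯ ∧ [n_s,d_s] is the list ((n₁ , d₁) ∷ ⋯ ∷ (n_s , d_s) ∷ []).
-- Realizes p T Ss w : Ss = S₁ ,…, S_s with |S_i| = n_i and w = z₁ ∧ ⋯ ∧ z_s
-- for cycles z_i ∈ C̃_{d_i - 1}(M[S_i]; ℤ_p).
data Realizes (p : ℕ) : List (ℕ × ℕ) → List (List ℕ) → Chain → Set where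
  done : Realizes p [] [] unitChain
  step : ∀ {m d T S Ss z w} → length S ≡ m → IsCycleOn p S d z →
         Realizes p T Ss w → Realizes p ((m , d) ∷ T) (S ∷ Ss) (wedge z w)

-- z has type T in M_n: there is a partition [n] = S₁ ∪ ⋯ ∪ S_s (the concatenation
-- of the S_i is a permutation of [n]) and cycles z_i with z = z₁ ∧ ⋯ ∧ z_s over ℤ_p.
HasType : ℕ → ℕ → List (ℕ × ℕ) → Chain → Set
HasType p n T z = ∃ λ Ss → ∃ λ w → Realizes p T Ss w × (concat Ss ↭ upTo n) × (z ≈[ p ] w)

Homologous : ℕ → ℕ → ℕ → Chain → Chain → Set
Homologous p n e z w = ∃ λ b → ChainOn (upTo n) (suc e) b × (∂ b ≈[ p ] (z ⊖ w))

-- H̃_{e-1}(M_n; ℤ_p) is generated by classes of cycles satisfying P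
GeneratedBy : ℕ → ℕ → ℕ → (Chain → Set) → Set
GeneratedBy p n e P =
  ∀ (z : Chain) → IsCycleOn p (upTo n) e z →
  ∃ λ (gens : List (ℤ × Chain)) →
    All (λ g → IsCycleOn p (upTo n) e (proj₂ g) × P (proj₂ g)) gens
    × Homologous p n e z (lincomb gens)

{-# OPTIONS --safe #-}
module Submission where

-- Let n be the number of vertices, e the number of edges in a simplex, and call 2n - 5e the slack. Fix two vertices
-- x and y. In a cycle z, the coefficient of xs ∧ yt is a cycle d on the other n - 4 vertices with e - 2 edges, of
-- slack two more. If d is generated by [1,0] ∧ T, multiply each generator, missing a vertex a, by the pentagon
-- xs, yt, sa, xy, ta; subtracting these products of type [5,2] ∧ T removes all terms of z in which x and y lie on
-- different edges. Then replacing every edge xs or yt by xy changes z by cycles of type [3,1] ∧ [n-3,e-1], and what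
-- remains is z₀ + xy ∧ c = ∂ (xy ∧ z₀). So the group is generated by [3,1] ∧ [n-3,e-1] (slack one less) and
-- [5,2] ∧ T. Induction on e then gives all parts, from two facts that need 3 to be invertible: on six vertices
-- [3,1] ∧ [3,1] is generated by [1,0] ∧ [5,2], and on seven vertices [3,1] ∧ [3,1] ∧ [1,0] is zero.
--
-- Chains are compared by pairing them with alternating cochains: the coefficients at sorted simplices determine
-- these pairings, and the coefficients themselves are such pairings.

open import Defs
open import Data.Bool using (true; false; T; if_then_else_)
open import Data.Bool.Properties using (T-∨; T-∧; T-≡)
open import Data.Empty using (⊥; ⊥-elim)
open import Data.Integer as ℤ using (ℤ; +_; -[1+_]; -_; 0ℤ; 1ℤ; -1ℤ) renaming (_+_ to _+ℤ_; _*_ to _*ℤ_; _-_ to _-ℤ_)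
import Data.Integer.Divisibility.Signed as ℤD
import Data.Integer.Properties as ℤP
open import Data.Integer.Tactic.RingSolver using (solve-∀)
open import Data.List using (List; []; _∷_; _++_; map; concatMap; concat; length; replicate; upTo; cartesianProduct)
open import Data.List.Membership.Propositional using (_∈_; _∉_)
open import Data.List.Membership.Propositional.Properties using (∈-++⁺ˡ; ∈-++⁺ʳ; ∈-map⁺; ∈-∃++; ∈-cartesianProduct⁺; ∈-cartesianProduct⁻)
open import Data.List.Properties using (++-assoc; ++-identityʳ; length-++; length-map; length-upTo; concatMap-++)
open import Data.List.Relation.Binary.Permutation.Propositional using (_↭_; refl; prep; swap; trans; ↭-sym; ↭-reflexive; ↭⇒↭ₛ)
import Data.List.Relation.Binary.Permutation.Propositional.Properties as ↭P
import Data.List.Relation.Binary.Permutation.Setoid.Properties as ↭ₛP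
open import Data.List.Relation.Unary.All as All using (All; []; _∷_)
import Data.List.Relation.Unary.All.Properties as AllP
open import Data.List.Relation.Unary.AllPairs as AllPairs using ([]; _∷_; allPairs?)
open import Data.List.Relation.Unary.Any using (here; there; any?)
open import Data.List.Relation.Unary.Unique.Propositional using (Unique)
import Data.List.Relation.Unary.Unique.Propositional.Properties as UniqueP
open import Data.Nat as ℕ using (ℕ; zero; suc; _+_; _*_; _∸_; _<_; _≤_; _⊓_; _⊔_)
open import Data.List.Membership.DecPropositional ℕ._≟_ using (_∈?_)
open import Data.Nat.Divisibility using (divides)
open import Data.Nat.Primality using (Prime; prime⇒irreducible)
import Data.Nat.Properties as ℕP
import Data.Nat.Tactic.RingSolver as ℕSolver
open import Data.Product using (_×_; _,_; proj₁; proj₂; ∃)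
import Data.Product.Properties as PP
open import Data.Sum using (_⊎_; inj₁; inj₂)
open import Data.Unit using (⊤; tt)
open import Function using (_∘_; Equivalence)
open import Relation.Binary.Definitions using (tri<; tri≈; tri>)
open import Relation.Binary.PropositionalEquality as ≡ using (_≡_; _≢_; cong; cong₂; sym; subst; subst₂; ≢-sym)
open import Relation.Nullary using (yes; no; Dec; does; contradiction)
open import Relation.Nullary.Decidable using (True; toWitness; map′; _×-dec_; ¬?; dec-false)

open Equivalence using (to; from)

-- Sorted by slack, the parts (i), (iii), (ii), (iv) are slack 0, 1, 2, 3, and vanishing is slack at
-- least 4. From slack 2 on, the coefficients d have slack at least 4 and vanish, so only [3,1]
-- splits off. For slack 0 and 1 they have slack 2 and 3, which is exactly where the generators
-- carry the factor [1,0] that closes the pentagon. Splitting off [3,1] at slack 3 gives the answer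
-- directly. At slack 2 it leaves two triangles, which are rewritten on six vertices; at slack 4 it
-- leaves two triangles and a free vertex, which bound on seven. At slack 1 the other factor has
-- slack 0, and there the generators [3,1] ∧ [5q-3,2q-1] contain a factor of slack -1 about which
-- nothing is known. The six-vertex fact then frees a vertex, and adding it to that factor gives
-- slack 1 with fewer edges. The prime 3 is special because over the integers the reduced homology
-- of M₇ in degree 1 is cyclic of order 3.

-- Alternating cochains and the sign of sorting

Cochain : Set
Cochain = Simplex → ℤ

-- Only distinct neighbours are exchanged. Insertion sort leaves equal edges in place, so
-- `coeffTerm` need not vanish on a list with a repeated edge, and the sign rule would fail there
-- for two equal edges.
data Swap : Simplex → Simplex → Set where
  here  : ∀ {e f σ} → e ≢ f → Swap (e ∷ f ∷ σ) (f ∷ e ∷ σ)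
  there : ∀ {e σ τ} → Swap σ τ → Swap (e ∷ σ) (e ∷ τ)

-- The restriction to edges in `G` is there for cochains pulled back along a labelling of vertices:
-- different labels are known to give different edges only if they are ordered and in range.
AlternatingOn : (Edge → Set) → Cochain → Set
AlternatingOn G φ = ∀ {σ τ} → Swap σ τ → All G σ → φ σ ≡ - φ τ

Alternating : Cochain → Set
Alternating φ = ∀ {σ τ} → Swap σ τ → φ σ ≡ - φ τ

⟦_⟧ : Chain → Cochain → ℤ
⟦ [] ⟧ φ = 0ℤ
⟦ (k , σ) ∷ c ⟧ φ = k *ℤ φ σ +ℤ ⟦ c ⟧ φ

≤E-prop : ∀ e f → T (e ≤E f) → proj₁ e ℕ.< proj₁ f ⊎ (proj₁ e ≡ proj₁ f × proj₂ e ℕ.≤ proj₂ f)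
≤E-prop (a , b) (c , d) h with to T-∨ h
... | inj₁ a<c = inj₁ (ℕP.<ᵇ⇒< a c a<c)
... | inj₂ h' with to T-∧ h'
... | a≡c , b≤d = inj₂ (ℕP.≡ᵇ⇒≡ a c a≡c , ℕP.≤ᵇ⇒≤ b d b≤d)

≤E-from : ∀ e f → proj₁ e ℕ.< proj₁ f ⊎ (proj₁ e ≡ proj₁ f × proj₂ e ℕ.≤ proj₂ f) → T (e ≤E f)
≤E-from (a , b) (c , d) (inj₁ a<c) = from (T-∨ {a ℕ.<ᵇ c}) (inj₁ (ℕP.<⇒<ᵇ a<c))
≤E-from (a , b) (c , d) (inj₂ (a≡c , b≤d)) =
  from (T-∨ {a ℕ.<ᵇ c}) (inj₂ (from T-∧ (ℕP.≡⇒≡ᵇ a c a≡c , ℕP.≤⇒≤ᵇ b≤d)))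

≤E-refl : ∀ e → (e ≤E e) ≡ true
≤E-refl e = to T-≡ (≤E-from e e (inj₂ (≡.refl , ℕP.≤-refl)))

≤E-trans : ∀ e f g → (e ≤E f) ≡ true → (f ≤E g) ≡ true → (e ≤E g) ≡ true
≤E-trans e f g p q
  with ≤E-prop e f (from T-≡ p) | ≤E-prop f g (from T-≡ q)
... | inj₁ u | inj₁ v = to T-≡ (≤E-from e g (inj₁ (ℕP.<-trans u v)))
... | inj₁ u | inj₂ (≡.refl , _) = to T-≡ (≤E-from e g (inj₁ u))
... | inj₂ (≡.refl , _) | inj₁ v = to T-≡ (≤E-from e g (inj₁ v))
... | inj₂ (≡.refl , u) | inj₂ (≡.refl , v) = to T-≡ (≤E-from e g (inj₂ (≡.refl , ℕP.≤-trans u v)))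

≤E-antisym : ∀ e f → (e ≤E f) ≡ true → (f ≤E e) ≡ true → e ≡ f
≤E-antisym e f p q
  with ≤E-prop e f (from T-≡ p) | ≤E-prop f e (from T-≡ q)
... | inj₁ u | inj₁ v = contradiction v (ℕP.<-asym u)
... | inj₁ u | inj₂ (≡.refl , _) = contradiction u (ℕP.<-irrefl ≡.refl)
... | inj₂ (≡.refl , _) | inj₁ v = contradiction v (ℕP.<-irrefl ≡.refl)
... | inj₂ (≡.refl , u) | inj₂ (_ , v) = cong (_ ,_) (ℕP.≤-antisym u v)

≤E-total : ∀ e f → (e ≤E f) ≡ false → (f ≤E e) ≡ true
≤E-total e@(a , b) f@(c , d) p with ℕP.<-cmp a c
... | tri< a<c _ _ = ⊥-elim (subst T p (≤E-from e f (inj₁ a<c)))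
... | tri> _ _ c<a = to T-≡ (≤E-from f e (inj₁ c<a))
... | tri≈ _ a≡c _ with ℕP.≤-total b d
... | inj₁ b≤d = ⊥-elim (subst T p (≤E-from e f (inj₂ (a≡c , b≤d))))
... | inj₂ d≤b = to T-≡ (≤E-from f e (inj₂ (sym a≡c , d≤b)))

sgn-+ : ∀ m n → sgn (m ℕ.+ n) ≡ sgn m *ℤ sgn n
sgn-+ zero n = sym (ℤP.*-identityˡ (sgn n))
sgn-+ (suc m) n = ≡.trans (cong -_ (sgn-+ m n)) (ℤP.neg-distribˡ-* (sgn m) (sgn n))

sgn² : ∀ n → sgn n *ℤ sgn n ≡ 1ℤ
sgn² zero = ≡.refl
sgn² (suc n) = ≡.trans (lem (sgn n)) (sgn² n)
  where
  lem : ∀ a → (- a) *ℤ (- a) ≡ a *ℤ a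
  lem = solve-∀

sorted : Simplex → Simplex
sorted σ = proj₁ (sortS σ)

inversions : Simplex → ℕ
inversions σ = proj₂ (sortS σ)

sgnσ : Simplex → ℤ
sgnσ σ = sgn (inversions σ)

module _ {G : Edge → Set} where

  AlternatingOn-∷ : ∀ {φ e} → AlternatingOn G φ → G e → AlternatingOn G (φ ∘ (e ∷_))
  AlternatingOn-∷ A g s gs = A (there s) (g ∷ gs)

  insertS-alternating : ∀ {φ} → AlternatingOn G φ → ∀ e r → All G (e ∷ r) →
    φ (e ∷ r) ≡ sgn (proj₂ (insertS e r)) *ℤ φ (proj₁ (insertS e r)) × All G (proj₁ (insertS e r))
  insertS-alternating {φ} A e [] g = sym (ℤP.*-identityˡ _) , g
  insertS-alternating {φ} A e (f ∷ r) (ge ∷ gf ∷ g) with e ≤E f in eq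
  ... | true = sym (ℤP.*-identityˡ _) , ge ∷ gf ∷ g
  ... | false
    with insertS e r | insertS-alternating {φ ∘ (f ∷_)} (λ {σ} → AlternatingOn-∷ {φ} {f} A gf {σ}) e r (ge ∷ g)
  ... | (r' , k) | ih , g' =
    ≡.trans (A (here e≢f) (ge ∷ gf ∷ g)) (≡.trans (cong -_ ih) (ℤP.neg-distribˡ-* (sgn k) _)) , gf ∷ g'
    where
    e≢f : e ≢ f
    e≢f ≡.refl with ≡.trans (sym eq) (≤E-refl e)
    ... | ()

  sortS-alternating : ∀ {φ} → AlternatingOn G φ → ∀ σ → All G σ →
    φ σ ≡ sgnσ σ *ℤ φ (sorted σ) × All G (sorted σ)
  sortS-alternating {φ} A [] g = sym (ℤP.*-identityˡ _) , []
  sortS-alternating {φ} A (e ∷ σ) (ge ∷ g)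
    with sortS σ | sortS-alternating {φ ∘ (e ∷_)} (λ {σ} → AlternatingOn-∷ {φ} {e} A ge {σ}) σ g
  ... | (r , k) | ih , g'
    with insertS e r | insertS-alternating {φ} A e r (ge ∷ g')
  ... | (r' , k') | ih' , g'' =
    ≡.trans ih (≡.trans (cong (sgn k *ℤ_) ih') (≡.trans (sym (ℤP.*-assoc (sgn k) (sgn k') _))
      (cong (_*ℤ φ r') (sym (sgn-+ k k'))))) , g''

-- Both orders of insertion make `e` and `f` pass the same entries of `r`. In exactly one of them
-- the second edge must also pass the first, which accounts for the sign.
insertS-swap : ∀ e f r → e ≢ f → let (r₁ , k₁) = insertS f r ; (r₂ , k₂) = insertS e r in
  proj₁ (insertS e r₁) ≡ proj₁ (insertS f r₂) ×
  sgn (k₁ ℕ.+ proj₂ (insertS e r₁)) ≡ - sgn (k₂ ℕ.+ proj₂ (insertS f r₂))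
insertS-swap e f [] e≢f with e ≤E f in p | f ≤E e in q
... | true | true = contradiction (≤E-antisym e f p q) e≢f
... | true | false = ≡.refl , ≡.refl
... | false | true = ≡.refl , ≡.refl
... | false | false = contradiction (≡.trans (sym q) (≤E-total e f p)) λ ()
insertS-swap e f (g ∷ r) e≢f with e ≤E g in p | f ≤E g in q
... | true | true with e ≤E f in p' | f ≤E e in q'
...   | true | true = contradiction (≤E-antisym e f p' q') e≢f
...   | true | false rewrite q = ≡.refl , ≡.refl
...   | false | true rewrite p = ≡.refl , ≡.refl
...   | false | false = contradiction (≡.trans (sym q') (≤E-total e f p')) λ ()
insertS-swap e f (g ∷ r) e≢f | true | false with f ≤E e in q'
...   | true = contradiction (≡.trans (sym q) (≤E-trans f e g q' p)) λ ()
...   | false rewrite p | q with insertS f r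
...   | (r' , k) = ≡.refl , ≡.trans (cong (-_ ∘ sgn) (ℕP.+-identityʳ k)) (sym (cong -_ (ℤP.neg-involutive (sgn k))))
insertS-swap e f (g ∷ r) e≢f | false | true with e ≤E f in p'
...   | true = contradiction (≡.trans (sym p) (≤E-trans e f g p' q)) λ ()
...   | false rewrite p | q with insertS e r
...   | (r' , k) = ≡.refl , ≡.trans (ℤP.neg-involutive (sgn k)) (≡.trans (cong sgn (sym (ℕP.+-identityʳ k))) (sym (ℤP.neg-involutive _)))
insertS-swap e f (g ∷ r) e≢f | false | false
  with insertS e r | insertS f r | insertS-swap e f r e≢f
... | (r₂ , k₂) | (r₁ , k₁) | eq , seq rewrite p | q
  with insertS e r₁ | insertS f r₂
... | (r₁' , k₁') | (r₂' , k₂') =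
  cong (g ∷_) eq ,
  cong -_ (≡.trans (cong sgn (ℕP.+-suc k₁ k₁')) (≡.trans (cong -_ seq) (cong (-_ ∘ sgn) (sym (ℕP.+-suc k₂ k₂')))))

sortS-swap : ∀ {σ τ} → Swap σ τ → sorted σ ≡ sorted τ × sgnσ σ ≡ - sgnσ τ
sortS-swap (here {e} {f} {σ} e≢f) with sortS σ
... | (r , k) with insertS e r | insertS f r | insertS-swap e f r e≢f
... | (r₂ , k₂) | (r₁ , k₁) | eq , seq with insertS e r₁ | insertS f r₂
... | (_ , k₁') | (_ , k₂') = eq , lem
  where
  open ≡.≡-Reasoning
  lem : sgn (k ℕ.+ k₁ ℕ.+ k₁') ≡ - sgn (k ℕ.+ k₂ ℕ.+ k₂')
  lem = begin
    sgn (k ℕ.+ k₁ ℕ.+ k₁')          ≡⟨ cong sgn (ℕP.+-assoc k k₁ k₁') ⟩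
    sgn (k ℕ.+ (k₁ ℕ.+ k₁'))        ≡⟨ sgn-+ k _ ⟩
    sgn k *ℤ sgn (k₁ ℕ.+ k₁')       ≡⟨ cong (sgn k *ℤ_) seq ⟩
    sgn k *ℤ (- sgn (k₂ ℕ.+ k₂'))   ≡⟨ sym (ℤP.neg-distribʳ-* (sgn k) _) ⟩
    - (sgn k *ℤ sgn (k₂ ℕ.+ k₂'))   ≡⟨ cong -_ (sym (sgn-+ k _)) ⟩
    - sgn (k ℕ.+ (k₂ ℕ.+ k₂'))      ≡⟨ cong (-_ ∘ sgn) (sym (ℕP.+-assoc k k₂ k₂')) ⟩
    - sgn (k ℕ.+ k₂ ℕ.+ k₂')        ∎
sortS-swap (there {e} {σ} {τ} s) with sortS σ | sortS τ | sortS-swap s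
... | (r , k) | (.r , k') | ≡.refl , seq with insertS e r
... | (r' , j) = ≡.refl , ≡.trans (sgn-+ k j) (≡.trans (cong (_*ℤ sgn j) seq)
  (≡.trans (sym (ℤP.neg-distribˡ-* (sgn k') (sgn j))) (cong -_ (sym (sgn-+ k' j)))))

χ : Simplex → Cochain
χ τ σ = coeffTerm τ (1ℤ , σ)

coeffTerm-χ : ∀ τ k σ → coeffTerm τ (k , σ) ≡ k *ℤ χ τ σ
coeffTerm-χ τ k σ with does (sorted σ ≟S sorted τ)
... | true = lem (sgn (inversions σ ℕ.+ inversions τ)) k
  where
  lem : ∀ s k → s *ℤ k ≡ k *ℤ (s *ℤ 1ℤ)
  lem = solve-∀
... | false = sym (ℤP.*-zeroʳ k)

coeff-⟦⟧ : ∀ c τ → coeff c τ ≡ ⟦ c ⟧ (χ τ)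
coeff-⟦⟧ [] τ = ≡.refl
coeff-⟦⟧ ((k , σ) ∷ c) τ = cong₂ _+ℤ_ (coeffTerm-χ τ k σ) (coeff-⟦⟧ c τ)

χ-alternating : ∀ τ → Alternating (χ τ)
χ-alternating τ {σ} {σ'} s with sortS-swap s
... | eq , seq rewrite eq with does (sorted σ' ≟S sorted τ)
... | false = ≡.refl
... | true = ≡.trans (cong (_*ℤ 1ℤ) (≡.trans (sgn-+ (inversions σ) i) (cong (_*ℤ sgn i) seq)))
               (≡.trans (lem (sgnσ σ') (sgn i)) (cong (λ x → - (x *ℤ 1ℤ)) (sym (sgn-+ (inversions σ') i))))
  where
  i : ℕ
  i = inversions τ
  lem : ∀ a b → (- a) *ℤ b *ℤ 1ℤ ≡ - (a *ℤ b *ℤ 1ℤ)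
  lem = solve-∀

-- Pairing chains with cochains

⟦⟧-cong : ∀ {Q : Simplex → Set} {c φ ψ} → All (Q ∘ proj₂) c → (∀ σ → Q σ → φ σ ≡ ψ σ) → ⟦ c ⟧ φ ≡ ⟦ c ⟧ ψ
⟦⟧-cong [] h = ≡.refl
⟦⟧-cong {c = (k , σ) ∷ c} (q ∷ qs) h = cong₂ _+ℤ_ (cong (k *ℤ_) (h σ q)) (⟦⟧-cong qs h)

⟦⟧-ext : ∀ {φ ψ} c → (∀ σ → φ σ ≡ ψ σ) → ⟦ c ⟧ φ ≡ ⟦ c ⟧ ψ
⟦⟧-ext [] h = ≡.refl
⟦⟧-ext ((k , σ) ∷ c) h = cong₂ _+ℤ_ (cong (k *ℤ_) (h σ)) (⟦⟧-ext c h)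

⟦⟧-++ : ∀ c d φ → ⟦ c ++ d ⟧ φ ≡ ⟦ c ⟧ φ +ℤ ⟦ d ⟧ φ
⟦⟧-++ [] d φ = sym (ℤP.+-identityˡ _)
⟦⟧-++ ((k , σ) ∷ c) d φ = ≡.trans (cong (k *ℤ φ σ +ℤ_) (⟦⟧-++ c d φ)) (sym (ℤP.+-assoc (k *ℤ φ σ) _ _))

⟦⟧-scale : ∀ k c φ → ⟦ scale k c ⟧ φ ≡ k *ℤ ⟦ c ⟧ φ
⟦⟧-scale k [] φ = sym (ℤP.*-zeroʳ k)
⟦⟧-scale k ((l , σ) ∷ c) φ = ≡.trans (cong (k *ℤ l *ℤ φ σ +ℤ_) (⟦⟧-scale k c φ)) (lem k l (φ σ) (⟦ c ⟧ φ))
  where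
  lem : ∀ k l a b → k *ℤ l *ℤ a +ℤ k *ℤ b ≡ k *ℤ (l *ℤ a +ℤ b)
  lem = solve-∀

⟦⟧-linear : ∀ a b c φ ψ → ⟦ c ⟧ (λ σ → a *ℤ φ σ +ℤ b *ℤ ψ σ) ≡ a *ℤ ⟦ c ⟧ φ +ℤ b *ℤ ⟦ c ⟧ ψ
⟦⟧-linear a b [] φ ψ = lem a b
  where
  lem : ∀ a b → 0ℤ ≡ a *ℤ 0ℤ +ℤ b *ℤ 0ℤ
  lem = solve-∀
⟦⟧-linear a b ((k , σ) ∷ c) φ ψ =
  ≡.trans (cong (k *ℤ (a *ℤ φ σ +ℤ b *ℤ ψ σ) +ℤ_) (⟦⟧-linear a b c φ ψ)) (lem a b k (φ σ) (ψ σ) _ _)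
  where
  lem : ∀ a b k x y u v → k *ℤ (a *ℤ x +ℤ b *ℤ y) +ℤ (a *ℤ u +ℤ b *ℤ v) ≡ a *ℤ (k *ℤ x +ℤ u) +ℤ b *ℤ (k *ℤ y +ℤ v)
  lem = solve-∀

⟦⟧-0 : ∀ c → ⟦ c ⟧ (λ _ → 0ℤ) ≡ 0ℤ
⟦⟧-0 [] = ≡.refl
⟦⟧-0 ((k , σ) ∷ c) = ≡.trans (cong₂ _+ℤ_ (ℤP.*-zeroʳ k) (⟦⟧-0 c)) ≡.refl

⟦⟧-neg : ∀ c φ → ⟦ c ⟧ (-_ ∘ φ) ≡ - ⟦ c ⟧ φ
⟦⟧-neg [] φ = ≡.refl
⟦⟧-neg ((k , σ) ∷ c) φ = ≡.trans (cong (k *ℤ (- φ σ) +ℤ_) (⟦⟧-neg c φ)) (lem k (φ σ) _)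
  where
  lem : ∀ k a b → k *ℤ (- a) +ℤ (- b) ≡ - (k *ℤ a +ℤ b)
  lem = solve-∀

⟦⟧-⊖ : ∀ c d φ → ⟦ c ⊖ d ⟧ φ ≡ ⟦ c ⟧ φ -ℤ ⟦ d ⟧ φ
⟦⟧-⊖ c d φ = ≡.trans (⟦⟧-++ c _ φ) (cong (⟦ c ⟧ φ +ℤ_) (≡.trans (⟦⟧-scale -1ℤ d φ) (ℤP.-1*i≡-i _)))

extend : (Simplex → Chain) → Chain → Chain
extend F = concatMap (λ t → scale (proj₁ t) (F (proj₂ t)))

⟦⟧-extend : ∀ F c φ → ⟦ extend F c ⟧ φ ≡ ⟦ c ⟧ (λ σ → ⟦ F σ ⟧ φ)
⟦⟧-extend F [] φ = ≡.refl
⟦⟧-extend F ((k , σ) ∷ c) φ =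
  ≡.trans (⟦⟧-++ (scale k (F σ)) _ φ) (cong₂ _+ℤ_ (⟦⟧-scale k (F σ) φ) (⟦⟧-extend F c φ))

consAll : Edge → Chain → Chain
consAll e = map (λ t → (- proj₁ t , e ∷ proj₂ t))

⟦⟧-consAll : ∀ e c φ → ⟦ consAll e c ⟧ φ ≡ - ⟦ c ⟧ (φ ∘ (e ∷_))
⟦⟧-consAll e [] φ = ≡.refl
⟦⟧-consAll e ((k , σ) ∷ c) φ = ≡.trans (cong ((- k) *ℤ φ (e ∷ σ) +ℤ_) (⟦⟧-consAll e c φ)) (lem k _ _)
  where
  lem : ∀ k a b → (- k) *ℤ a +ℤ (- b) ≡ - (k *ℤ a +ℤ b)
  lem = solve-∀

⟦⟧-wedge : ∀ c d φ → ⟦ wedge c d ⟧ φ ≡ ⟦ c ⟧ (λ σ → ⟦ d ⟧ (λ τ → φ (σ ++ τ)))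
⟦⟧-wedge [] d φ = ≡.refl
⟦⟧-wedge ((k , σ) ∷ c) d φ = ≡.trans (⟦⟧-++ (prefix d) _ φ) (cong₂ _+ℤ_ (lem d) (⟦⟧-wedge c d φ))
  where
  prefix : Chain → Chain
  prefix = map (λ t' → (k *ℤ proj₁ t' , σ ++ proj₂ t'))
  ring : ∀ k l a b → k *ℤ l *ℤ a +ℤ k *ℤ b ≡ k *ℤ (l *ℤ a +ℤ b)
  ring = solve-∀
  lem : ∀ d → ⟦ prefix d ⟧ φ ≡ k *ℤ ⟦ d ⟧ (λ τ → φ (σ ++ τ))
  lem [] = sym (ℤP.*-zeroʳ k)
  lem ((l , τ) ∷ d) = ≡.trans (cong (k *ℤ l *ℤ φ (σ ++ τ) +ℤ_) (lem d)) (ring k l _ _)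

-- Contraction of cochains with a weight on edges; the weight 1 gives the coboundary.

κ : (Edge → ℤ) → Cochain → Cochain
κ w φ [] = 0ℤ
κ w φ (e ∷ σ) = w e *ℤ φ σ -ℤ κ w (φ ∘ (e ∷_)) σ

δ : Cochain → Cochain
δ = κ (λ _ → 1ℤ)

κ-ext : ∀ {φ ψ} w → (∀ σ → φ σ ≡ ψ σ) → ∀ σ → κ w φ σ ≡ κ w ψ σ
κ-ext w h [] = ≡.refl
κ-ext w h (e ∷ σ) = cong₂ _-ℤ_ (cong (w e *ℤ_) (h σ)) (κ-ext w (h ∘ (e ∷_)) σ)

κ-linear : ∀ w a b φ ψ σ → κ w (λ σ → a *ℤ φ σ +ℤ b *ℤ ψ σ) σ ≡ a *ℤ κ w φ σ +ℤ b *ℤ κ w ψ σ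
κ-linear w a b φ ψ [] = lem a b
  where
  lem : ∀ a b → 0ℤ ≡ a *ℤ 0ℤ +ℤ b *ℤ 0ℤ
  lem = solve-∀
κ-linear w a b φ ψ (e ∷ σ) =
  ≡.trans (cong (w e *ℤ (a *ℤ φ σ +ℤ b *ℤ ψ σ) -ℤ_) (κ-linear w a b (φ ∘ (e ∷_)) (ψ ∘ (e ∷_)) σ))
        (lem a b (w e) (φ σ) (ψ σ) _ _)
  where
  lem : ∀ a b k x y u v → k *ℤ (a *ℤ x +ℤ b *ℤ y) -ℤ (a *ℤ u +ℤ b *ℤ v) ≡ a *ℤ (k *ℤ x -ℤ u) +ℤ b *ℤ (k *ℤ y -ℤ v)
  lem = solve-∀

κ-neg : ∀ w φ σ → κ w (-_ ∘ φ) σ ≡ - κ w φ σ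
κ-neg w φ [] = ≡.refl
κ-neg w φ (e ∷ σ) = ≡.trans (cong (w e *ℤ (- φ σ) -ℤ_) (κ-neg w (φ ∘ (e ∷_)) σ)) (lem (w e) (φ σ) _)
  where
  lem : ∀ k a b → k *ℤ (- a) -ℤ (- b) ≡ - (k *ℤ a -ℤ b)
  lem = solve-∀

κ-0 : ∀ w σ → κ w (λ _ → 0ℤ) σ ≡ 0ℤ
κ-0 w [] = ≡.refl
κ-0 w (e ∷ σ) = cong₂ _-ℤ_ (ℤP.*-zeroʳ (w e)) (κ-0 w σ)

κ-⟦⟧ : ∀ w d (Φ : Simplex → Cochain) σ → κ w (λ σ → ⟦ d ⟧ (Φ σ)) σ ≡ ⟦ d ⟧ (λ τ → κ w (λ σ → Φ σ τ) σ)
κ-⟦⟧ w [] Φ σ = κ-0 w σ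
κ-⟦⟧ w ((k , τ) ∷ d) Φ σ =
  ≡.trans (κ-ext w (λ σ → cong (k *ℤ Φ σ τ +ℤ_) (sym (ℤP.*-identityˡ _))) σ)
  (≡.trans (κ-linear w k 1ℤ (λ σ → Φ σ τ) (λ σ → ⟦ d ⟧ (Φ σ)) σ)
  (cong (k *ℤ κ w (λ σ → Φ σ τ) σ +ℤ_) (≡.trans (ℤP.*-identityˡ _) (κ-⟦⟧ w d Φ σ))))

Alternating-∷ : ∀ {φ} e → Alternating φ → Alternating (φ ∘ (e ∷_))
Alternating-∷ e A s = A (there s)

κ-alternating : ∀ {φ} w → Alternating φ → Alternating (κ w φ)
κ-alternating {φ} w A (here {e} {f} {σ} e≢f) =
  ≡.trans (cong (λ x → w e *ℤ φ (f ∷ σ) -ℤ (w f *ℤ φ (e ∷ σ) -ℤ x))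
          (≡.trans (κ-ext w (λ τ → A (here e≢f)) σ) (κ-neg w (λ τ → φ (f ∷ e ∷ τ)) σ)))
        (lem (w e *ℤ φ (f ∷ σ)) (w f *ℤ φ (e ∷ σ)) _)
  where
  lem : ∀ a b x → a -ℤ (b -ℤ (- x)) ≡ - (b -ℤ (a -ℤ x))
  lem = solve-∀
κ-alternating {φ} w A (there {e} {σ} {τ} s) =
  ≡.trans (cong₂ (λ x y → w e *ℤ x -ℤ y) (A s) (κ-alternating w (Alternating-∷ e A) s)) (lem (w e) (φ τ) _)
  where
  lem : ∀ k a b → k *ℤ (- a) -ℤ (- b) ≡ - (k *ℤ a -ℤ b)
  lem = solve-∀

-- Removing two edges in the two possible orders gives opposite signs. The general weights let one
-- statement cover both δδ = 0 and the anticommutation of the boundary with `con`.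
κ-anticomm : ∀ v w φ σ → κ v (κ w φ) σ ≡ - κ w (κ v φ) σ
κ-anticomm v w φ [] = ≡.refl
κ-anticomm v w φ (e ∷ σ) = ≡.trans (expand v w) (≡.trans exchange (cong -_ (sym (expand w v))))
  where
  φₑ = φ ∘ (e ∷_)
  expand : ∀ v w → κ v (κ w φ) (e ∷ σ) ≡ v e *ℤ κ w φ σ -ℤ (w e *ℤ κ v φ σ +ℤ -1ℤ *ℤ κ v (κ w φₑ) σ)
  expand v w = cong (v e *ℤ κ w φ σ -ℤ_)
    (≡.trans (κ-ext v (λ τ → cong (w e *ℤ φ τ +ℤ_) (sym (ℤP.-1*i≡-i _))) σ) (κ-linear v (w e) -1ℤ φ (κ w φₑ) σ))
  lem : ∀ a b x → a -ℤ (b +ℤ -1ℤ *ℤ (- x)) ≡ - (b -ℤ (a +ℤ -1ℤ *ℤ x))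
  lem = solve-∀
  exchange : v e *ℤ κ w φ σ -ℤ (w e *ℤ κ v φ σ +ℤ -1ℤ *ℤ κ v (κ w φₑ) σ)
       ≡ - (w e *ℤ κ v φ σ -ℤ (v e *ℤ κ w φ σ +ℤ -1ℤ *ℤ κ w (κ v φₑ) σ))
  exchange = ≡.trans (cong (λ x → v e *ℤ κ w φ σ -ℤ (w e *ℤ κ v φ σ +ℤ -1ℤ *ℤ x)) (κ-anticomm v w φₑ σ))
               (lem (v e *ℤ κ w φ σ) (w e *ℤ κ v φ σ) _)

x≡-x⇒x≡0 : ∀ x → x ≡ - x → x ≡ 0ℤ
x≡-x⇒x≡0 (+ zero) eq = ≡.refl

-- Derived over the integers, before any reduction: modulo 2 the equation x = -x would say nothing.
δδ : ∀ φ σ → δ (δ φ) σ ≡ 0ℤ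
δδ φ σ = x≡-x⇒x≡0 _ (κ-anticomm _ _ φ σ)

κ-++ : ∀ w φ σ τ → κ w φ (σ ++ τ) ≡ κ w (λ σ → φ (σ ++ τ)) σ +ℤ sgn (length σ) *ℤ κ w (λ τ → φ (σ ++ τ)) τ
κ-++ w φ [] τ = lem (κ w φ τ)
  where
  lem : ∀ x → x ≡ 0ℤ +ℤ 1ℤ *ℤ x
  lem = solve-∀
κ-++ w φ (e ∷ σ) τ = ≡.trans (cong (w e *ℤ φ (σ ++ τ) -ℤ_) (κ-++ w (φ ∘ (e ∷_)) σ τ)) (lem (w e *ℤ φ (σ ++ τ)) _ (sgn (length σ)) _)
  where
  lem : ∀ a b s x → a -ℤ (b +ℤ s *ℤ x) ≡ (a -ℤ b) +ℤ (- s) *ℤ x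
  lem = solve-∀

⟦bdS⟧ : ∀ σ φ → ⟦ bdS σ ⟧ φ ≡ δ φ σ
⟦bdS⟧ [] φ = ≡.refl
⟦bdS⟧ (e ∷ σ) φ = cong (1ℤ *ℤ φ σ +ℤ_) (≡.trans (⟦⟧-consAll e (bdS σ) φ) (cong -_ (⟦bdS⟧ σ (φ ∘ (e ∷_)))))

⟦∂⟧ : ∀ c φ → ⟦ ∂ c ⟧ φ ≡ ⟦ c ⟧ (δ φ)
⟦∂⟧ c φ = ≡.trans (⟦⟧-extend bdS c φ) (⟦⟧-ext c (λ σ → ⟦bdS⟧ σ φ))

_≟E_ : (e f : Edge) → Dec (e ≡ f)
_≟E_ = PP.≡-dec ℕ._≟_ ℕ._≟_

[_≟₁_] : Edge → Edge → ℤ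
[ e ≟₁ f ] = if does (e ≟E f) then 1ℤ else 0ℤ

-- The interior product with the dual of `e`: on a matching, what multiplies `e` once `e` has been
-- moved to the front.
conS : Edge → Simplex → Chain
conS e [] = []
conS e (f ∷ σ) = (if does (e ≟E f) then (1ℤ , σ) ∷ [] else []) ++ consAll f (conS e σ)

con : Edge → Chain → Chain
con e = extend (conS e)

⟦conS⟧ : ∀ e σ φ → ⟦ conS e σ ⟧ φ ≡ κ [ e ≟₁_] φ σ
⟦conS⟧ e [] φ = ≡.refl
⟦conS⟧ e (f ∷ σ) φ with does (e ≟E f)
... | true  = cong (1ℤ *ℤ φ σ +ℤ_) (≡.trans (⟦⟧-consAll f (conS e σ) φ) (cong -_ (⟦conS⟧ e σ (φ ∘ (f ∷_)))))
... | false = ≡.trans (≡.trans (⟦⟧-consAll f (conS e σ) φ) (cong -_ (⟦conS⟧ e σ (φ ∘ (f ∷_))))) (lem (φ σ) _)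
  where
  lem : ∀ a b → - b ≡ 0ℤ *ℤ a -ℤ b
  lem = solve-∀

⟦con⟧ : ∀ e c φ → ⟦ con e c ⟧ φ ≡ ⟦ c ⟧ (κ [ e ≟₁_] φ)
⟦con⟧ e c φ = ≡.trans (⟦⟧-extend (conS e) c φ) (⟦⟧-ext c (λ σ → ⟦conS⟧ e σ φ))

-- The coefficients of a chain determine its pairing with alternating cochains.

drop-sorted : Simplex → Chain → Chain
drop-sorted r [] = []
drop-sorted r ((k , σ) ∷ c) with sorted σ ≟S r
... | yes _ = drop-sorted r c
... | no _  = (k , σ) ∷ drop-sorted r c

length-drop-sorted : ∀ r c → length (drop-sorted r c) ℕ.≤ length c
length-drop-sorted r [] = ℕ.z≤n
length-drop-sorted r ((k , σ) ∷ c) with sorted σ ≟S r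
... | yes _ = ℕP.m≤n⇒m≤1+n (length-drop-sorted r c)
... | no _  = ℕ.s≤s (length-drop-sorted r c)

All-drop-sorted : ∀ {Q : Term → Set} r {c} → All Q c → All Q (drop-sorted r c)
All-drop-sorted r [] = []
All-drop-sorted r {(k , σ) ∷ c} (q ∷ qs) with sorted σ ≟S r
... | yes _ = All-drop-sorted r qs
... | no _  = q ∷ All-drop-sorted r qs

drop-sorted-≢ : ∀ r c → All (λ t → sorted (proj₂ t) ≢ r) (drop-sorted r c)
drop-sorted-≢ r [] = []
drop-sorted-≢ r ((k , σ) ∷ c) with sorted σ ≟S r
... | yes _ = drop-sorted-≢ r c
... | no ≢r = ≢r ∷ drop-sorted-≢ r c

coeffTerm-≢ : ∀ {τ} k {σ} → sorted σ ≢ sorted τ → coeffTerm τ (k , σ) ≡ 0ℤ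
coeffTerm-≢ {τ} k {σ} ≢ rewrite dec-false (sorted σ ≟S sorted τ) ≢ = ≡.refl

coeff-drop-sorted : ∀ r c τ → sorted τ ≢ r → coeff (drop-sorted r c) τ ≡ coeff c τ
coeff-drop-sorted r [] τ _ = ≡.refl
coeff-drop-sorted r ((k , σ) ∷ c) τ τ≢r with sorted σ ≟S r
... | yes σ≡r = ≡.trans (coeff-drop-sorted r c τ τ≢r)
  (≡.trans (sym (ℤP.+-identityˡ _)) (cong (_+ℤ coeff c τ) (sym (coeffTerm-≢ {τ} k {σ} (λ eq → τ≢r (≡.trans (sym eq) σ≡r))))))
... | no _ = cong (coeffTerm τ (k , σ) +ℤ_) (coeff-drop-sorted r c τ τ≢r)

module _ {G : Edge → Set} {φ : Cochain} (A : AlternatingOn G φ) where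

  -- Every term that is a rearrangement of `σ` can be turned into a multiple of `σ` by sorting both;
  -- the two signs are those in `coeffTerm`, since the square of a sign is 1.
  split-sorted : ∀ {σ c} → All G σ → All (All G ∘ proj₂) c →
    ⟦ c ⟧ φ ≡ coeff c σ *ℤ φ σ +ℤ ⟦ drop-sorted (sorted σ) c ⟧ φ
  split-sorted {σ} gσ [] = lem (φ σ)
    where
    lem : ∀ x → 0ℤ ≡ 0ℤ *ℤ x +ℤ 0ℤ
    lem = solve-∀
  split-sorted {σ} {(k , ρ) ∷ c} gσ (gρ ∷ g) with sorted ρ ≟S sorted σ
  ... | no ρ≢σ = ≡.trans (cong (k *ℤ φ ρ +ℤ_) (split-sorted gσ g)) (lem (k *ℤ φ ρ) (coeff c σ) (φ σ) _)
    where
    lem : ∀ a b x y → a +ℤ (b *ℤ x +ℤ y) ≡ (0ℤ +ℤ b) *ℤ x +ℤ (a +ℤ y)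
    lem = solve-∀
  ... | yes ρ≡σ = ≡.trans (cong₂ _+ℤ_ head (split-sorted gσ g)) (lem (sgn (inversions ρ ℕ.+ inversions σ) *ℤ k) _ (φ σ) _)
    where
    lem : ∀ a b x y → a *ℤ x +ℤ (b *ℤ x +ℤ y) ≡ (a +ℤ b) *ℤ x +ℤ y
    lem = solve-∀
    sρ = sgnσ ρ
    sσ = sgnσ σ
    ring : ∀ k s t x → k *ℤ (s *ℤ x) *ℤ (t *ℤ t) ≡ s *ℤ t *ℤ k *ℤ (t *ℤ x)
    ring = solve-∀
    head : k *ℤ φ ρ ≡ sgn (inversions ρ ℕ.+ inversions σ) *ℤ k *ℤ φ σ
    head = begin
      k *ℤ φ ρ                                  ≡⟨ cong (k *ℤ_) (proj₁ (sortS-alternating A ρ gρ)) ⟩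
      k *ℤ (sρ *ℤ φ (sorted ρ))                 ≡⟨ sym (ℤP.*-identityʳ _) ⟩
      k *ℤ (sρ *ℤ φ (sorted ρ)) *ℤ 1ℤ           ≡⟨ cong₂ (λ r s → k *ℤ (sρ *ℤ φ r) *ℤ s) ρ≡σ (sym (sgn² (inversions σ))) ⟩
      k *ℤ (sρ *ℤ φ (sorted σ)) *ℤ (sσ *ℤ sσ)   ≡⟨ ring k sρ sσ _ ⟩
      sρ *ℤ sσ *ℤ k *ℤ (sσ *ℤ φ (sorted σ))     ≡⟨ cong₂ (λ s x → s *ℤ k *ℤ x) (sym (sgn-+ (inversions ρ) (inversions σ))) (sym (proj₁ (sortS-alternating A σ gσ))) ⟩
      sgn (inversions ρ ℕ.+ inversions σ) *ℤ k *ℤ φ σ ∎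
      where open ≡.≡-Reasoning

-- Congruence modulo p and equality of chains

module Modular (p : ℕ) where

  infix 4 _≡ₚ_ _≋_

  -- With the quotient as an argument, matching on the equation turns each law of congruences into a
  -- ring identity.
  data _≡ₚ_ (a b : ℤ) : Set where
    mod : ∀ k → a ≡ b +ℤ k *ℤ (+ p) → a ≡ₚ b

  ≡⇒≡ₚ : ∀ {a b} → a ≡ b → a ≡ₚ b
  ≡⇒≡ₚ {a} ≡.refl = mod 0ℤ (lem a (+ p))
    where
    lem : ∀ a p → a ≡ a +ℤ 0ℤ *ℤ p
    lem = solve-∀

  ≡ₚ-refl : ∀ {a} → a ≡ₚ a
  ≡ₚ-refl = ≡⇒≡ₚ ≡.refl

  ≡ₚ-sym : ∀ {a b} → a ≡ₚ b → b ≡ₚ a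
  ≡ₚ-sym {b = b} (mod k ≡.refl) = mod (- k) (lem b k (+ p))
    where
    lem : ∀ b k p → b ≡ b +ℤ k *ℤ p +ℤ (- k) *ℤ p
    lem = solve-∀

  ≡ₚ-trans : ∀ {a b c} → a ≡ₚ b → b ≡ₚ c → a ≡ₚ c
  ≡ₚ-trans {c = c} (mod k ≡.refl) (mod l ≡.refl) = mod (l +ℤ k) (lem c l k (+ p))
    where
    lem : ∀ c l k p → c +ℤ l *ℤ p +ℤ k *ℤ p ≡ c +ℤ (l +ℤ k) *ℤ p
    lem = solve-∀

  +-congₚ : ∀ {a b c d} → a ≡ₚ b → c ≡ₚ d → a +ℤ c ≡ₚ b +ℤ d
  +-congₚ {b = b} {d = d} (mod k ≡.refl) (mod l ≡.refl) = mod (k +ℤ l) (lem b d l k (+ p))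
    where
    lem : ∀ b d l k p → b +ℤ k *ℤ p +ℤ (d +ℤ l *ℤ p) ≡ b +ℤ d +ℤ (k +ℤ l) *ℤ p
    lem = solve-∀

  *-congₚ : ∀ m {a b} → a ≡ₚ b → m *ℤ a ≡ₚ m *ℤ b
  *-congₚ m {b = b} (mod k ≡.refl) = mod (m *ℤ k) (lem m b k (+ p))
    where
    lem : ∀ m b k p → m *ℤ (b +ℤ k *ℤ p) ≡ m *ℤ b +ℤ m *ℤ k *ℤ p
    lem = solve-∀

  neg-congₚ : ∀ {a b} → a ≡ₚ b → - a ≡ₚ - b
  neg-congₚ {b = b} (mod k ≡.refl) = mod (- k) (lem b k (+ p))
    where
    lem : ∀ b k p → - (b +ℤ k *ℤ p) ≡ - b +ℤ (- k) *ℤ p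
    lem = solve-∀

  via-zero : ∀ {a b d} → d ≡ₚ 0ℤ → a ≡ b +ℤ d → a ≡ₚ b
  via-zero {b = b} (mod k ≡.refl) ≡.refl = mod k (cong (b +ℤ_) (ℤP.+-identityˡ _))

  ≡ₚ0⇒∣ : ∀ {a} → a ≡ₚ 0ℤ → (+ p) ℤD.∣ a
  ≡ₚ0⇒∣ (mod k eq) = ℤD.divides k (≡.trans eq (ℤP.+-identityˡ _))

  ∣⇒≡ₚ0 : ∀ {a} → (+ p) ℤD.∣ a → a ≡ₚ 0ℤ
  ∣⇒≡ₚ0 (ℤD.divides k eq) = mod k (≡.trans eq (sym (ℤP.+-identityˡ _)))

  -ₚ⇒≡ₚ : ∀ {a b} → a -ℤ b ≡ₚ 0ℤ → a ≡ₚ b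
  -ₚ⇒≡ₚ {a} {b} h = via-zero h (lem a b)
    where
    lem : ∀ a b → a ≡ b +ℤ (a -ℤ b)
    lem = solve-∀

  ≡ₚ⇒-ₚ : ∀ {a b} → a ≡ₚ b → a -ℤ b ≡ₚ 0ℤ
  ≡ₚ⇒-ₚ {a} {b} h = ≡ₚ-trans (+-congₚ h (≡ₚ-refl { - b})) (≡⇒≡ₚ (ℤP.+-inverseʳ b))

  module _ {G : Edge → Set} {φ : Cochain} (A : AlternatingOn G φ) where

    -- Terms are removed one class of rearrangements at a time. A removed class pairs to a multiple
    -- of its coefficient, and the coefficients of the other classes do not change.
    ⟦⟧-vanishes : ∀ c → All (All G ∘ proj₂) c → All (λ t → coeff c (proj₂ t) ≡ₚ 0ℤ) c → ⟦ c ⟧ φ ≡ₚ 0ℤ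
    ⟦⟧-vanishes c = go (length c) c ℕP.≤-refl
      where
      -- A bound on the length drives the recursion, because a class may contain any number of
      -- terms.
      go : ∀ n c → length c ℕ.≤ n → All (All G ∘ proj₂) c → All (λ t → coeff c (proj₂ t) ≡ₚ 0ℤ) c → ⟦ c ⟧ φ ≡ₚ 0ℤ
      go n [] _ _ _ = ≡ₚ-refl
      go (suc n) c@((k , σ) ∷ c₀) (ℕ.s≤s l) g@(gσ ∷ _) h@(hσ ∷ _) =
        ≡ₚ-trans (≡⇒≡ₚ (split-sorted A gσ g))
          (+-congₚ (≡ₚ-trans (≡⇒≡ₚ (ℤP.*-comm (coeff c σ) (φ σ))) (≡ₚ-trans (*-congₚ (φ σ) hσ) (≡⇒≡ₚ (ℤP.*-zeroʳ (φ σ)))))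
                   (go n c' l' (All-drop-sorted (sorted σ) g) h'))
        where
        c' = drop-sorted (sorted σ) c
        l' : length c' ℕ.≤ n
        l' with sorted σ ≟S sorted σ
        ... | yes _ = ℕP.≤-trans (length-drop-sorted (sorted σ) c₀) l
        ... | no ≢ = contradiction ≡.refl ≢
        h' : All (λ t → coeff c' (proj₂ t) ≡ₚ 0ℤ) c'
        h' = All.zipWith (λ { {t} (≢ , h) → subst (_≡ₚ 0ℤ) (sym (coeff-drop-sorted (sorted σ) c (proj₂ t) ≢)) h })
               (drop-sorted-≢ (sorted σ) c , All-drop-sorted (sorted σ) h)

  -- Boundary, contraction and products all have adjoints on cochains that preserve alternation, so
  -- `≋` is a congruence for them without tracking the signs of rearranged terms.
  record _≋_ (c d : Chain) : Set where
    field at : ∀ φ → Alternating φ → ⟦ c ⟧ φ ≡ₚ ⟦ d ⟧ φ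
  open _≋_ public

  coeff-⊖ : ∀ c d τ → coeff (c ⊖ d) τ ≡ coeff c τ -ℤ coeff d τ
  coeff-⊖ c d τ = ≡.trans (coeff-⟦⟧ (c ⊖ d) τ) (≡.trans (⟦⟧-⊖ c d (χ τ)) (sym (cong₂ _-ℤ_ (coeff-⟦⟧ c τ) (coeff-⟦⟧ d τ))))

  ≈⇒≋ : ∀ {c d} → c ≈[ p ] d → c ≋ d
  ≈⇒≋ {c} {d} h .at φ A = -ₚ⇒≡ₚ (subst (_≡ₚ 0ℤ) (⟦⟧-⊖ c d φ)
    (⟦⟧-vanishes {λ _ → ⊤} {φ} (λ s _ → A s) (c ⊖ d) (All.tabulate (λ {t} _ → All.tabulate (λ _ → tt)))
      (All.tabulate (λ {t} _ → subst (_≡ₚ 0ℤ) (sym (coeff-⊖ c d (proj₂ t))) (∣⇒≡ₚ0 (ℤD.∣ᵤ⇒∣ (h (proj₂ t))))))))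

  ≋⇒≈ : ∀ {c d} → c ≋ d → c ≈[ p ] d
  ≋⇒≈ {c} {d} h τ = ℤD.∣⇒∣ᵤ (≡ₚ0⇒∣ (subst (_≡ₚ 0ℤ) (sym (cong₂ _-ℤ_ (coeff-⟦⟧ c τ) (coeff-⟦⟧ d τ)))
    (≡ₚ⇒-ₚ (h .at (χ τ) (χ-alternating τ)))))

-- Leibniz rules and products of chains

infixr 6 _∙_

_∙_ : Edge → Chain → Chain
e ∙ c = map (λ t → (proj₁ t , e ∷ proj₂ t)) c

⟦∙⟧ : ∀ e c φ → ⟦ e ∙ c ⟧ φ ≡ ⟦ c ⟧ (φ ∘ (e ∷_))
⟦∙⟧ e [] φ = ≡.refl
⟦∙⟧ e ((k , σ) ∷ c) φ = cong (k *ℤ φ (e ∷ σ) +ℤ_) (⟦∙⟧ e c φ)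

⟦∂∙⟧ : ∀ e c φ → ⟦ ∂ (e ∙ c) ⟧ φ ≡ ⟦ c ⟧ φ -ℤ ⟦ ∂ c ⟧ (φ ∘ (e ∷_))
⟦∂∙⟧ e c φ = begin
  ⟦ ∂ (e ∙ c) ⟧ φ                                     ≡⟨ ⟦∂⟧ (e ∙ c) φ ⟩
  ⟦ e ∙ c ⟧ (δ φ)                                     ≡⟨ ⟦∙⟧ e c (δ φ) ⟩
  ⟦ c ⟧ (λ σ → 1ℤ *ℤ φ σ -ℤ δ (φ ∘ (e ∷_)) σ)         ≡⟨ ⟦⟧-ext c (λ σ → cong (1ℤ *ℤ φ σ +ℤ_) (sym (ℤP.-1*i≡-i _))) ⟩
  ⟦ c ⟧ (λ σ → 1ℤ *ℤ φ σ +ℤ -1ℤ *ℤ δ (φ ∘ (e ∷_)) σ)  ≡⟨ ⟦⟧-linear 1ℤ -1ℤ c φ (δ (φ ∘ (e ∷_))) ⟩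
  1ℤ *ℤ ⟦ c ⟧ φ +ℤ -1ℤ *ℤ ⟦ c ⟧ (δ (φ ∘ (e ∷_)))      ≡⟨ cong₂ _+ℤ_ (ℤP.*-identityˡ (⟦ c ⟧ φ)) (ℤP.-1*i≡-i (⟦ c ⟧ (δ (φ ∘ (e ∷_))))) ⟩
  ⟦ c ⟧ φ -ℤ ⟦ c ⟧ (δ (φ ∘ (e ∷_)))                   ≡⟨ cong (⟦ c ⟧ φ -ℤ_) (sym (⟦∂⟧ c _)) ⟩
  ⟦ c ⟧ φ -ℤ ⟦ ∂ c ⟧ (φ ∘ (e ∷_))                     ∎
  where open ≡.≡-Reasoning

⟦∂-con⟧ : ∀ e c φ → ⟦ ∂ (con e c) ⟧ φ ≡ - ⟦ con e (∂ c) ⟧ φ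
⟦∂-con⟧ e c φ = begin
  ⟦ ∂ (con e c) ⟧ φ                  ≡⟨ ⟦∂⟧ (con e c) φ ⟩
  ⟦ con e c ⟧ (δ φ)                  ≡⟨ ⟦con⟧ e c (δ φ) ⟩
  ⟦ c ⟧ (κ [ e ≟₁_] (δ φ))           ≡⟨ ⟦⟧-ext c (κ-anticomm [ e ≟₁_] (λ _ → 1ℤ) φ) ⟩
  ⟦ c ⟧ (-_ ∘ δ (κ [ e ≟₁_] φ))      ≡⟨ ⟦⟧-neg c _ ⟩
  - ⟦ c ⟧ (δ (κ [ e ≟₁_] φ))         ≡⟨ cong -_ (sym (⟦∂⟧ c _)) ⟩
  - ⟦ ∂ c ⟧ (κ [ e ≟₁_] φ)           ≡⟨ cong -_ (sym (⟦con⟧ e (∂ c) φ)) ⟩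
  - ⟦ con e (∂ c) ⟧ φ                ∎
  where open ≡.≡-Reasoning

⟦∂∂⟧ : ∀ c φ → ⟦ ∂ (∂ c) ⟧ φ ≡ 0ℤ
⟦∂∂⟧ c φ = ≡.trans (⟦∂⟧ (∂ c) φ) (≡.trans (⟦∂⟧ c (δ φ)) (≡.trans (⟦⟧-ext c (δδ φ)) (⟦⟧-0 c)))

⟦∂++⟧ : ∀ c d φ → ⟦ ∂ (c ++ d) ⟧ φ ≡ ⟦ ∂ c ⟧ φ +ℤ ⟦ ∂ d ⟧ φ
⟦∂++⟧ c d φ = ≡.trans (⟦∂⟧ (c ++ d) φ) (≡.trans (⟦⟧-++ c d (δ φ)) (cong₂ _+ℤ_ (sym (⟦∂⟧ c φ)) (sym (⟦∂⟧ d φ))))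

⟦∂scale⟧ : ∀ k c φ → ⟦ ∂ (scale k c) ⟧ φ ≡ k *ℤ ⟦ ∂ c ⟧ φ
⟦∂scale⟧ k c φ = ≡.trans (⟦∂⟧ (scale k c) φ) (≡.trans (⟦⟧-scale k c (δ φ)) (cong (k *ℤ_) (sym (⟦∂⟧ c φ))))

⟦∂-wedge⟧ : ∀ {m c} → All (λ t → length (proj₂ t) ≡ m) c → ∀ d φ →
  ⟦ ∂ (wedge c d) ⟧ φ ≡ ⟦ wedge (∂ c) d ⟧ φ +ℤ sgn m *ℤ ⟦ wedge c (∂ d) ⟧ φ
⟦∂-wedge⟧ {m} {c} hom d φ = begin
  ⟦ ∂ (wedge c d) ⟧ φ                         ≡⟨ ⟦∂⟧ (wedge c d) φ ⟩
  ⟦ wedge c d ⟧ (δ φ)                         ≡⟨ ⟦⟧-wedge c d (δ φ) ⟩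
  ⟦ c ⟧ (λ σ → ⟦ d ⟧ (λ τ → δ φ (σ ++ τ)))    ≡⟨ ⟦⟧-cong hom (λ { σ ≡.refl → leibniz σ }) ⟩
  ⟦ c ⟧ (λ σ → 1ℤ *ℤ δ Φ σ +ℤ sgn m *ℤ Ψ σ)   ≡⟨ ⟦⟧-linear 1ℤ (sgn m) c (δ Φ) Ψ ⟩
  1ℤ *ℤ ⟦ c ⟧ (δ Φ) +ℤ sgn m *ℤ ⟦ c ⟧ Ψ       ≡⟨ cong₂ (λ x y → x +ℤ sgn m *ℤ y)
                                                  (≡.trans (ℤP.*-identityˡ _) (≡.trans (sym (⟦∂⟧ c Φ)) (sym (⟦⟧-wedge (∂ c) d φ))))
                                                  (sym (⟦⟧-wedge c (∂ d) φ)) ⟩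
  ⟦ wedge (∂ c) d ⟧ φ +ℤ sgn m *ℤ ⟦ wedge c (∂ d) ⟧ φ ∎
  where
  open ≡.≡-Reasoning
  Φ Ψ : Cochain
  Φ σ = ⟦ d ⟧ (λ τ → φ (σ ++ τ))
  Ψ σ = ⟦ ∂ d ⟧ (λ τ → φ (σ ++ τ))
  leibniz : ∀ σ → ⟦ d ⟧ (λ τ → δ φ (σ ++ τ)) ≡ 1ℤ *ℤ δ Φ σ +ℤ sgn (length σ) *ℤ Ψ σ
  leibniz σ = begin
    ⟦ d ⟧ (λ τ → δ φ (σ ++ τ))
      ≡⟨ ⟦⟧-ext d (λ τ → ≡.trans (κ-++ _ φ σ τ) (cong (_+ℤ sgn (length σ) *ℤ δ (λ τ → φ (σ ++ τ)) τ) (sym (ℤP.*-identityˡ (δ (λ σ → φ (σ ++ τ)) σ))))) ⟩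
    ⟦ d ⟧ (λ τ → 1ℤ *ℤ δ (λ σ → φ (σ ++ τ)) σ +ℤ sgn (length σ) *ℤ δ (λ τ → φ (σ ++ τ)) τ)
      ≡⟨ ⟦⟧-linear 1ℤ (sgn (length σ)) d (λ τ → δ (λ σ → φ (σ ++ τ)) σ) (δ (λ τ → φ (σ ++ τ))) ⟩
    1ℤ *ℤ ⟦ d ⟧ (λ τ → δ (λ σ → φ (σ ++ τ)) σ) +ℤ sgn (length σ) *ℤ ⟦ d ⟧ (δ (λ τ → φ (σ ++ τ)))
      ≡⟨ cong₂ (λ x y → 1ℤ *ℤ x +ℤ sgn (length σ) *ℤ y) (sym (κ-⟦⟧ _ d (λ σ τ → φ (σ ++ τ)) σ)) (sym (⟦∂⟧ d _)) ⟩
    1ℤ *ℤ δ Φ σ +ℤ sgn (length σ) *ℤ Ψ σ ∎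

⟦wedge-assoc⟧ : ∀ a b c φ → ⟦ wedge (wedge a b) c ⟧ φ ≡ ⟦ wedge a (wedge b c) ⟧ φ
⟦wedge-assoc⟧ a b c φ = begin
  ⟦ wedge (wedge a b) c ⟧ φ                                         ≡⟨ ⟦⟧-wedge (wedge a b) c φ ⟩
  ⟦ wedge a b ⟧ (λ σ → ⟦ c ⟧ (λ τ → φ (σ ++ τ)))                    ≡⟨ ⟦⟧-wedge a b _ ⟩
  ⟦ a ⟧ (λ ρ → ⟦ b ⟧ (λ σ → ⟦ c ⟧ (λ τ → φ ((ρ ++ σ) ++ τ))))
    ≡⟨ ⟦⟧-ext a (λ ρ → ≡.trans (⟦⟧-ext b (λ σ → ⟦⟧-ext c (λ τ → cong φ (++-assoc ρ σ τ)))) (sym (⟦⟧-wedge b c _))) ⟩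
  ⟦ a ⟧ (λ ρ → ⟦ wedge b c ⟧ (λ τ → φ (ρ ++ τ)))                    ≡⟨ sym (⟦⟧-wedge a (wedge b c) φ) ⟩
  ⟦ wedge a (wedge b c) ⟧ φ                                         ∎
  where open ≡.≡-Reasoning

⟦wedge-unitˡ⟧ : ∀ c φ → ⟦ wedge unitChain c ⟧ φ ≡ ⟦ c ⟧ φ
⟦wedge-unitˡ⟧ c φ = ≡.trans (⟦⟧-wedge unitChain c φ) (lem (⟦ c ⟧ φ))
  where
  lem : ∀ x → 1ℤ *ℤ x +ℤ 0ℤ ≡ x
  lem = solve-∀

⟦wedge-unitʳ⟧ : ∀ c φ → ⟦ wedge c unitChain ⟧ φ ≡ ⟦ c ⟧ φ
⟦wedge-unitʳ⟧ c φ = ≡.trans (⟦⟧-wedge c unitChain φ)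
  (⟦⟧-ext c (λ σ → ≡.trans (lem _) (cong φ (++-identityʳ σ))))
  where
  lem : ∀ x → 1ℤ *ℤ x +ℤ 0ℤ ≡ x
  lem = solve-∀

Alternating-++ˡ : ∀ {φ} → Alternating φ → ∀ τ → Alternating (λ σ → φ (σ ++ τ))
Alternating-++ˡ A τ s = A (lem s)
  where
  lem : ∀ {σ σ'} → Swap σ σ' → Swap (σ ++ τ) (σ' ++ τ)
  lem (here ≢) = here ≢
  lem (there s) = there (lem s)

Alternating-++ʳ : ∀ {φ} → Alternating φ → ∀ σ → Alternating (λ τ → φ (σ ++ τ))
Alternating-++ʳ A [] = A
Alternating-++ʳ A (e ∷ σ) = Alternating-++ʳ (Alternating-∷ e A) σ

Alternating-⟦⟧ : ∀ d {Φ : Simplex → Cochain} → (∀ τ → Alternating (λ σ → Φ σ τ)) → Alternating (λ σ → ⟦ d ⟧ (Φ σ))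
Alternating-⟦⟧ d {Φ} A s = ≡.trans (⟦⟧-ext d (λ τ → A τ s)) (⟦⟧-neg d _)

shift-edge : ∀ {φ} → Alternating φ → ∀ e τ {ρ} → e ∉ τ → φ (e ∷ τ ++ ρ) ≡ sgn (length τ) *ℤ φ (τ ++ e ∷ ρ)
shift-edge A e [] e∉ = sym (ℤP.*-identityˡ _)
shift-edge {φ} A e (f ∷ τ) e∉ =
  ≡.trans (A (here (λ { ≡.refl → e∉ (here ≡.refl) })))
  (≡.trans (cong -_ (shift-edge (Alternating-∷ f A) e τ (λ e∈ → e∉ (there e∈)))) (ℤP.neg-distribˡ-* (sgn (length τ)) _))

sgn-*-suc : ∀ m n → sgn n *ℤ sgn (m ℕ.* n) ≡ sgn (suc m ℕ.* n)
sgn-*-suc m n = sym (sgn-+ n (m ℕ.* n))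

shift-simplex : ∀ {φ} → Alternating φ → ∀ σ τ → All (_∉ τ) σ → φ (σ ++ τ) ≡ sgn (length σ ℕ.* length τ) *ℤ φ (τ ++ σ)
shift-simplex {φ} A [] τ _ = ≡.trans (cong φ (sym (++-identityʳ τ))) (sym (ℤP.*-identityˡ _))
shift-simplex {φ} A (e ∷ σ) τ (e∉ ∷ σ∉) = begin
  φ (e ∷ σ ++ τ)                                         ≡⟨ shift-simplex (Alternating-∷ e A) σ τ σ∉ ⟩
  s *ℤ φ (e ∷ τ ++ σ)                                    ≡⟨ cong (s *ℤ_) (shift-edge A e τ e∉) ⟩
  s *ℤ (sgn (length τ) *ℤ φ (τ ++ e ∷ σ))                ≡⟨ lem s (sgn (length τ)) _ ⟩
  (sgn (length τ) *ℤ s) *ℤ φ (τ ++ e ∷ σ)                ≡⟨ cong (_*ℤ φ (τ ++ e ∷ σ)) (sgn-*-suc (length σ) (length τ)) ⟩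
  sgn (length (e ∷ σ) ℕ.* length τ) *ℤ φ (τ ++ e ∷ σ)    ∎
  where
  open ≡.≡-Reasoning
  s = sgn (length σ ℕ.* length τ)
  lem : ∀ a b x → a *ℤ (b *ℤ x) ≡ b *ℤ a *ℤ x
  lem = solve-∀

⟦⟧-swap : ∀ c d (Φ : Simplex → Cochain) → ⟦ c ⟧ (λ σ → ⟦ d ⟧ (Φ σ)) ≡ ⟦ d ⟧ (λ τ → ⟦ c ⟧ (λ σ → Φ σ τ))
⟦⟧-swap [] d Φ = sym (⟦⟧-0 d)
⟦⟧-swap ((k , σ) ∷ c) d Φ = begin
  k *ℤ ⟦ d ⟧ (Φ σ) +ℤ ⟦ c ⟧ (λ σ → ⟦ d ⟧ (Φ σ))           ≡⟨ cong (k *ℤ ⟦ d ⟧ (Φ σ) +ℤ_) (≡.trans (⟦⟧-swap c d Φ) (sym (ℤP.*-identityˡ _))) ⟩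
  k *ℤ ⟦ d ⟧ (Φ σ) +ℤ 1ℤ *ℤ ⟦ d ⟧ (λ τ → ⟦ c ⟧ (λ σ → Φ σ τ)) ≡⟨ sym (⟦⟧-linear k 1ℤ d (Φ σ) _) ⟩
  ⟦ d ⟧ (λ τ → k *ℤ Φ σ τ +ℤ 1ℤ *ℤ ⟦ c ⟧ (λ σ → Φ σ τ))  ≡⟨ ⟦⟧-ext d (λ τ → cong (k *ℤ Φ σ τ +ℤ_) (ℤP.*-identityˡ _)) ⟩
  ⟦ d ⟧ (λ τ → k *ℤ Φ σ τ +ℤ ⟦ c ⟧ (λ σ → Φ σ τ))        ∎
  where open ≡.≡-Reasoning

-- Congruence properties and closed chains modulo p

module ModularC (p : ℕ) where
  open Modular p

  ≋-refl : ∀ {c} → c ≋ c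
  ≋-refl .at φ A = ≡ₚ-refl

  ≋-sym : ∀ {c d} → c ≋ d → d ≋ c
  ≋-sym h .at φ A = ≡ₚ-sym (h .at φ A)

  ≋-trans : ∀ {b c d} → b ≋ c → c ≋ d → b ≋ d
  ≋-trans h i .at φ A = ≡ₚ-trans (h .at φ A) (i .at φ A)

  exact : ∀ {c d} → (∀ φ → Alternating φ → ⟦ c ⟧ φ ≡ ⟦ d ⟧ φ) → c ≋ d
  exact h .at φ A = ≡⇒≡ₚ (h φ A)

  ++-cong : ∀ {a b c d} → a ≋ b → c ≋ d → (a ++ c) ≋ (b ++ d)
  ++-cong {a} {b} {c} {d} h i .at φ A =
    subst₂ _≡ₚ_ (sym (⟦⟧-++ a c φ)) (sym (⟦⟧-++ b d φ)) (+-congₚ (h .at φ A) (i .at φ A))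

  ∂-cong : ∀ {c d} → c ≋ d → ∂ c ≋ ∂ d
  ∂-cong {c} {d} h .at φ A = subst₂ _≡ₚ_ (sym (⟦∂⟧ c φ)) (sym (⟦∂⟧ d φ)) (h .at (δ φ) (κ-alternating _ A))

  con-cong : ∀ e {c d} → c ≋ d → con e c ≋ con e d
  con-cong e {c} {d} h .at φ A = subst₂ _≡ₚ_ (sym (⟦con⟧ e c φ)) (sym (⟦con⟧ e d φ)) (h .at _ (κ-alternating _ A))

  ∙-cong : ∀ e {c d} → c ≋ d → e ∙ c ≋ e ∙ d
  ∙-cong e {c} {d} h .at φ A = subst₂ _≡ₚ_ (sym (⟦∙⟧ e c φ)) (sym (⟦∙⟧ e d φ)) (h .at _ (Alternating-∷ e A))

  wedge-congˡ : ∀ {c d} b → c ≋ d → wedge c b ≋ wedge d b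
  wedge-congˡ {c} {d} b h .at φ A = subst₂ _≡ₚ_ (sym (⟦⟧-wedge c b φ)) (sym (⟦⟧-wedge d b φ))
    (h .at _ (Alternating-⟦⟧ b (Alternating-++ˡ A)))

  wedge-congʳ : ∀ b {c d} → c ≋ d → wedge b c ≋ wedge b d
  wedge-congʳ b {c} {d} h .at φ A = subst₂ _≡ₚ_ (sym (⟦⟧-wedge b c φ)) (sym (⟦⟧-wedge b d φ)) (go b)
    where
    go : ∀ b → ⟦ b ⟧ (λ σ → ⟦ c ⟧ (λ τ → φ (σ ++ τ))) ≡ₚ ⟦ b ⟧ (λ σ → ⟦ d ⟧ (λ τ → φ (σ ++ τ)))
    go [] = ≡ₚ-refl
    go ((k , σ) ∷ b) = +-congₚ (*-congₚ k (h .at _ (Alternating-++ʳ A σ))) (go b)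

  record Closed (c : Chain) : Set where
    constructor closed
    field boundary : ∂ c ≋ []
  open Closed public

  Closed-resp : ∀ {c d} → c ≋ d → Closed c → Closed d
  Closed-resp h z = closed (≋-trans (∂-cong (≋-sym h)) (z .boundary))

  Closed-∂ : ∀ c → Closed (∂ c)
  Closed-∂ c = closed (exact (λ φ _ → ⟦∂∂⟧ c φ))

  Closed-++ : ∀ {c d} → Closed c → Closed d → Closed (c ++ d)
  Closed-++ {c} {d} zc zd .boundary .at φ A = subst (_≡ₚ 0ℤ) (sym (⟦∂++⟧ c d φ)) (+-congₚ (zc .boundary .at φ A) (zd .boundary .at φ A))

  Closed-scale : ∀ k {c} → Closed c → Closed (scale k c)
  Closed-scale k {c} z .boundary .at φ A =
    subst (_≡ₚ 0ℤ) (sym (⟦∂scale⟧ k c φ)) (≡ₚ-trans (*-congₚ k (z .boundary .at φ A)) (≡⇒≡ₚ (ℤP.*-zeroʳ k)))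

  -- Contraction anticommutes with the boundary, so the coefficient of an edge in a cycle is a
  -- cycle. Applied twice, this makes the coefficient of xs ∧ yt a cycle, to which the induction can
  -- be applied.
  Closed-con : ∀ e {c} → Closed c → Closed (con e c)
  Closed-con e {c} z .boundary .at φ A =
    subst (_≡ₚ 0ℤ) (sym (⟦∂-con⟧ e c φ)) (neg-congₚ {b = 0ℤ} (con-cong e (z .boundary) .at φ A))

  wedge-[]ʳ : ∀ c → wedge c [] ≋ []
  wedge-[]ʳ c = exact (λ φ _ → ≡.trans (⟦⟧-wedge c [] φ) (⟦⟧-0 c))

  Closed-wedge : ∀ {m c d} → All (λ t → length (proj₂ t) ≡ m) c → Closed c → Closed d → Closed (wedge c d)
  Closed-wedge {m} {c} {d} hom zc zd .boundary .at φ A = subst (_≡ₚ 0ℤ) (sym (⟦∂-wedge⟧ hom d φ))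
    (+-congₚ (wedge-congˡ d (zc .boundary) .at φ A)
      (≡ₚ-trans (*-congₚ (sgn m) (≋-trans (wedge-congʳ c (zd .boundary)) (wedge-[]ʳ c) .at φ A)) (≡⇒≡ₚ (ℤP.*-zeroʳ (sgn m)))))

  ∂-wedgeʳ-closed : ∀ {m c d} → All (λ t → length (proj₂ t) ≡ m) c → Closed d → ∂ (wedge c d) ≋ wedge (∂ c) d
  ∂-wedgeʳ-closed {m} {c} {d} hom zd .at φ A = via-zero
    (≡ₚ-trans (*-congₚ (sgn m) (≋-trans (wedge-congʳ c (zd .boundary)) (wedge-[]ʳ c) .at φ A)) (≡⇒≡ₚ (ℤP.*-zeroʳ (sgn m))))
    (⟦∂-wedge⟧ hom d φ)

  ∂-wedgeˡ-closed : ∀ {m c d} → All (λ t → length (proj₂ t) ≡ m) c → Closed c → scale (sgn m) (∂ (wedge c d)) ≋ wedge c (∂ d)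
  ∂-wedgeˡ-closed {m} {c} {d} hom zc .at φ A = via-zero
    (≡ₚ-trans (*-congₚ (sgn m) (wedge-congˡ d (zc .boundary) .at φ A)) (≡⇒≡ₚ (ℤP.*-zeroʳ (sgn m))))
    (≡.trans (⟦⟧-scale (sgn m) (∂ (wedge c d)) φ) (≡.trans (cong (sgn m *ℤ_) (⟦∂-wedge⟧ hom d φ))
      (≡.trans (lem (sgn m) (⟦ wedge (∂ c) d ⟧ φ) (⟦ wedge c (∂ d) ⟧ φ))
        (cong (_+ℤ sgn m *ℤ ⟦ wedge (∂ c) d ⟧ φ)
          (≡.trans (cong (_*ℤ ⟦ wedge c (∂ d) ⟧ φ) (sgn² m)) (ℤP.*-identityˡ (⟦ wedge c (∂ d) ⟧ φ)))))))
    where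
    lem : ∀ s a b → s *ℤ (a +ℤ s *ℤ b) ≡ s *ℤ s *ℤ b +ℤ s *ℤ a
    lem = solve-∀

-- Matchings as faces, and edges as unordered pairs

Unique-↭ : ∀ {xs ys : List ℕ} → xs ↭ ys → Unique xs → Unique ys
Unique-↭ p = ↭ₛP.Unique-resp-↭ (≡.setoid ℕ) (↭⇒↭ₛ p)

vertices-++ : ∀ σ τ → vertices (σ ++ τ) ≡ vertices σ ++ vertices τ
vertices-++ = concatMap-++ (λ e → proj₁ e ∷ proj₂ e ∷ [])

vertices-↭ : ∀ {σ τ} → σ ↭ τ → vertices σ ↭ vertices τ
vertices-↭ refl = refl
vertices-↭ (prep e p) = prep _ (prep _ (vertices-↭ p))
vertices-↭ (swap (a , b) (c , d) p) = trans (↭P.shifts (a ∷ b ∷ []) (c ∷ d ∷ [])) (prep _ (prep _ (prep _ (prep _ (vertices-↭ p)))))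
vertices-↭ (trans p q) = trans (vertices-↭ p) (vertices-↭ q)

fst∈vertices : ∀ {e σ} → e ∈ σ → proj₁ e ∈ vertices σ
fst∈vertices (here ≡.refl) = here ≡.refl
fst∈vertices (there e∈) = there (there (fst∈vertices e∈))

snd∈vertices : ∀ {e σ} → e ∈ σ → proj₂ e ∈ vertices σ
snd∈vertices (here ≡.refl) = there (here ≡.refl)
snd∈vertices (there e∈) = there (there (snd∈vertices e∈))

-- Membership and distinctness are conditions on the vertex list, where they are invariant under
-- permutation; edges can thus be reordered and ends exchanged freely.
record Face (S : List ℕ) (d : ℕ) (σ : Simplex) : Set where
  constructor face
  field
    ordered  : All (λ e → proj₁ e < proj₂ e) σ
    inside   : All (_∈ S) (vertices σ)
    distinct : Unique (vertices σ)
    size     : length σ ≡ d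
open Face public

On : List ℕ → ℕ → Chain → Set
On S d = All (Face S d ∘ proj₂)

toOn : ∀ {S d c} → ChainOn S d c → On S d c
toOn = All.map λ { ((es , u) , l) → face (All.map proj₁ es) (go es) u l }
  where
  go : ∀ {S σ} → All (IsEdgeOn S) σ → All (_∈ S) (vertices σ)
  go [] = []
  go ((_ , a , b) ∷ es) = a ∷ b ∷ go es

fromOn : ∀ {S d c} → On S d c → ChainOn S d c
fromOn = All.map λ { (face o i u l) → (go o i , u) , l }
  where
  go : ∀ {S σ} → All (λ e → proj₁ e < proj₂ e) σ → All (_∈ S) (vertices σ) → All (IsEdgeOn S) σ
  go [] [] = []
  go (a<b ∷ o) (a ∷ b ∷ i) = (a<b , a , b) ∷ go o i

Face-mono : ∀ {S T d σ} → (∀ {v} → v ∈ S → v ∈ T) → Face S d σ → Face T d σ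
Face-mono h f = record { ordered = ordered f ; inside = All.map h (inside f) ; distinct = distinct f ; size = size f }

On-mono : ∀ {S T d c} → (∀ {v} → v ∈ S → v ∈ T) → On S d c → On T d c
On-mono h = All.map (Face-mono h)

On-↭ : ∀ {S T d c} → S ↭ T → On S d c → On T d c
On-↭ p = On-mono (↭P.∈-resp-↭ p)

Face-resp-↭ : ∀ {S d σ τ} → σ ↭ τ → Face S d σ → Face S d τ
Face-resp-↭ p (face o i u l) =
  face (↭P.All-resp-↭ p o) (↭P.All-resp-↭ (vertices-↭ p) i) (Unique-↭ (vertices-↭ p) u) (≡.trans (sym (↭P.↭-length p)) l)

Face-tail : ∀ {S d e σ} → Face S (suc d) (e ∷ σ) → Face S d σ
Face-tail (face (_ ∷ o) (_ ∷ _ ∷ i) (_ ∷ _ ∷ u) l) = face o i u (ℕP.suc-injective l)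

mk : ℕ → ℕ → Edge
mk x y = x ⊓ y , x ⊔ y

mk-comm : ∀ x y → mk x y ≡ mk y x
mk-comm x y = cong₂ _,_ (ℕP.⊓-comm x y) (ℕP.⊔-comm x y)

mk-< : ∀ {x y} → x < y → mk x y ≡ (x , y)
mk-< x<y = cong₂ _,_ (ℕP.m≤n⇒m⊓n≡m (ℕP.<⇒≤ x<y)) (ℕP.m≤n⇒m⊔n≡n (ℕP.<⇒≤ x<y))

mk-> : ∀ {x y} → y < x → mk x y ≡ (y , x)
mk-> {x} {y} y<x = ≡.trans (mk-comm x y) (mk-< y<x)

mk-ordered : ∀ {x y} → x ≢ y → proj₁ (mk x y) < proj₂ (mk x y)
mk-ordered {x} {y} x≢y with ℕP.≤-total x y
... | inj₁ x≤y rewrite ℕP.m≤n⇒m⊓n≡m x≤y | ℕP.m≤n⇒m⊔n≡n x≤y = ℕP.≤∧≢⇒< x≤y x≢y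
... | inj₂ y≤x rewrite ℕP.m≥n⇒m⊓n≡n y≤x | ℕP.m≥n⇒m⊔n≡m y≤x = ℕP.≤∧≢⇒< y≤x (≢-sym x≢y)

mk-↭ : ∀ x y {vs} → proj₁ (mk x y) ∷ proj₂ (mk x y) ∷ vs ↭ x ∷ y ∷ vs
mk-↭ x y with ℕP.≤-total x y
... | inj₁ x≤y rewrite ℕP.m≤n⇒m⊓n≡m x≤y | ℕP.m≤n⇒m⊔n≡n x≤y = refl
... | inj₂ y≤x rewrite ℕP.m≥n⇒m⊓n≡n y≤x | ℕP.m≥n⇒m⊔n≡m y≤x = swap _ _ refl

edge-view : ∀ {S e x} → proj₁ e < proj₂ e → proj₁ e ∈ S → proj₂ e ∈ S → x ∈ proj₁ e ∷ proj₂ e ∷ [] →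
  ∃ λ s → s ∈ S × x ≢ s × e ≡ mk x s
edge-view {e = a , b} a<b a∈ b∈ (here ≡.refl) = b , b∈ , ℕP.<⇒≢ a<b , sym (mk-< a<b)
edge-view {e = a , b} a<b a∈ b∈ (there (here ≡.refl)) = a , a∈ , ≢-sym (ℕP.<⇒≢ a<b) , sym (mk-> a<b)

Face-mk : ∀ {x s R d τ} → Unique (x ∷ s ∷ R) → Face R d τ → Face (x ∷ s ∷ R) (suc d) (mk x s ∷ τ)
Face-mk {x} {s} ((x≢s ∷ x∉) ∷ s∉ ∷ _) (face o i u l) = face
  (mk-ordered x≢s ∷ o)
  (↭P.All-resp-↭ (↭-sym (mk-↭ x s)) (here ≡.refl ∷ there (here ≡.refl) ∷ All.map (λ v∈ → there (there v∈)) i))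
  (Unique-↭ (↭-sym (mk-↭ x s)) ((x≢s ∷ All.map (All.lookup x∉) i) ∷ All.map (All.lookup s∉) i ∷ u))
  (cong suc l)

-- Distinctness of the vertices keeps `x` and `s` out of all the other edges.
Face-unmk : ∀ {x s R S d τ} → S ↭ x ∷ s ∷ R → Face S (suc d) (mk x s ∷ τ) → Face R d τ
Face-unmk {x} {s} {R} p f@(face _ _ u _) with Unique-↭ (mk-↭ x s) u | Face-tail f
... | (_ ∷ x∉) ∷ s∉ ∷ _ | face o i u' l = face o (All.zipWith lem (All.zip (x∉ , s∉) , All.map (↭P.∈-resp-↭ p) i)) u' l
  where
  lem : ∀ {v} → (x ≢ v × s ≢ v) × v ∈ x ∷ s ∷ R → v ∈ R
  lem (_ , there (there v∈)) = v∈
  lem ((x≢ , _) , here eq) = contradiction (sym eq) x≢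
  lem ((_ , s≢) , there (here eq)) = contradiction (sym eq) s≢

Unique-++-disjoint : ∀ {S T : List ℕ} → Unique (S ++ T) → ∀ {v} → v ∈ S → v ∉ T
Unique-++-disjoint {x ∷ S} (x∉ ∷ u) (here ≡.refl) v∈T = All.lookup x∉ (∈-++⁺ʳ S v∈T) ≡.refl
Unique-++-disjoint {x ∷ S} (x∉ ∷ u) (there v∈S) v∈T = Unique-++-disjoint u v∈S v∈T

Unique-++ˡ : ∀ {S T : List ℕ} → Unique (S ++ T) → Unique S
Unique-++ˡ {[]} u = []
Unique-++ˡ {x ∷ S} (x∉ ∷ u) = AllP.++⁻ˡ S x∉ ∷ Unique-++ˡ u

Unique-++ʳ : ∀ S {T : List ℕ} → Unique (S ++ T) → Unique T
Unique-++ʳ [] u = u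
Unique-++ʳ (x ∷ S) (_ ∷ u) = Unique-++ʳ S u

Face-++ : ∀ {S T d e σ τ} → Unique (S ++ T) → Face S d σ → Face T e τ → Face (S ++ T) (d ℕ.+ e) (σ ++ τ)
Face-++ {S} {T} {σ = σ} {τ} u (face o i v l) (face o' i' v' l') = face
  (AllP.++⁺ o o')
  (subst (All (_∈ S ++ T)) (sym (vertices-++ σ τ)) (AllP.++⁺ (All.map ∈-++⁺ˡ i) (All.map (∈-++⁺ʳ S) i')))
  (subst Unique (sym (vertices-++ σ τ)) (UniqueP.++⁺ v v' (λ (p , q) → Unique-++-disjoint u (All.lookup i p) (All.lookup i' q))))
  (≡.trans (length-++ σ) (cong₂ ℕ._+_ l l'))

-- Supports of the operations on chains

extend-All : ∀ {Q R : Simplex → Set} F → (∀ σ → Q σ → All (R ∘ proj₂) (F σ)) → ∀ {c} → All (Q ∘ proj₂) c → All (R ∘ proj₂) (extend F c)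
extend-All F h [] = []
extend-All F h (q ∷ qs) = AllP.++⁺ (AllP.map⁺ (h _ q)) (extend-All F h qs)

conS-↭ : ∀ e σ → All (λ t → e ∷ proj₂ t ↭ σ) (conS e σ)
conS-↭ e [] = []
conS-↭ e (f ∷ σ) with e ≟E f
... | yes ≡.refl = refl ∷ AllP.map⁺ (All.map (λ p → trans (swap _ _ refl) (prep f p)) (conS-↭ e σ))
... | no _ = AllP.map⁺ (All.map (λ p → trans (swap _ _ refl) (prep f p)) (conS-↭ e σ))

On-con : ∀ {x s R S d c} → S ↭ x ∷ s ∷ R → On S (suc d) c → On R d (con (mk x s) c)
On-con {x} {s} p = extend-All (conS (mk x s)) (λ σ f → All.map (λ q → Face-unmk p (Face-resp-↭ (↭-sym q) f)) (conS-↭ (mk x s) σ))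

On-++ : ∀ {S d a b} → On S d a → On S d b → On S d (a ++ b)
On-++ = AllP.++⁺

On-scale : ∀ {S d c} k → On S d c → On S d (scale k c)
On-scale k o = AllP.map⁺ o

On-∙ : ∀ {x s R d c} → Unique (x ∷ s ∷ R) → On R d c → On (x ∷ s ∷ R) (suc d) (mk x s ∙ c)
On-∙ u o = AllP.map⁺ (All.map (Face-mk u) o)

On-wedge : ∀ {S T d e a b} → Unique (S ++ T) → On S d a → On T e b → On (S ++ T) (d ℕ.+ e) (wedge a b)
On-wedge u [] o' = []
On-wedge u (f ∷ o) o' = AllP.++⁺ (AllP.map⁺ (All.map (Face-++ u f) o')) (On-wedge u o o')

On-homogeneous : ∀ {S d c} → On S d c → All (λ t → length (proj₂ t) ≡ d) c
On-homogeneous = All.map size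

without : Edge → Chain → Chain
without e [] = []
without e ((k , σ) ∷ c) with any? (e ≟E_) σ
... | yes _ = without e c
... | no _  = (k , σ) ∷ without e c

All-without : ∀ {Q : Simplex → Set} e {c} → All (Q ∘ proj₂) c → All (λ t → Q (proj₂ t) × e ∉ proj₂ t) (without e c)
All-without e [] = []
All-without e {(k , σ) ∷ c} (q ∷ qs) with any? (e ≟E_) σ
... | yes _ = All-without e qs
... | no e∉ = (q , e∉) ∷ All-without e qs

κ-∉ : ∀ {e σ} φ → e ∉ σ → κ [ e ≟₁_] φ σ ≡ 0ℤ
κ-∉ {e} {[]} φ e∉ = ≡.refl
κ-∉ {e} {f ∷ σ} φ e∉ rewrite dec-false (e ≟E f) (e∉ ∘ here) | κ-∉ (φ ∘ (f ∷_)) (e∉ ∘ there) = ≡.refl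

κ-∈ : ∀ {e σ φ} → Alternating φ → e ∈ σ → Unique (vertices σ) → κ [ e ≟₁_] (φ ∘ (e ∷_)) σ ≡ φ σ
κ-∈ {e} {f ∷ σ} {φ} A e∈ u with e ≟E f
κ-∈ {e} {e ∷ σ} {φ} A e∈ ((_ ∷ a∉) ∷ _) | yes ≡.refl
  rewrite κ-∉ {e} {σ} (λ τ → φ (e ∷ e ∷ τ)) (λ e∈σ → All.lookup a∉ (fst∈vertices e∈σ) ≡.refl) = lem (φ (e ∷ σ))
  where
  lem : ∀ x → 1ℤ *ℤ x -ℤ 0ℤ ≡ x
  lem = solve-∀
κ-∈ A (here e≡f) u | no e≢f = contradiction e≡f e≢f
κ-∈ {e} {f ∷ σ} {φ} A (there e∈) (_ ∷ _ ∷ u) | no e≢f =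
  ≡.trans (cong (0ℤ *ℤ φ (e ∷ σ) -ℤ_) (≡.trans (κ-ext _ (λ τ → A (here e≢f)) σ) (κ-neg _ (λ τ → φ (f ∷ e ∷ τ)) σ)))
  (≡.trans (lem (φ (e ∷ σ)) _) (κ-∈ (Alternating-∷ f A) e∈ u))
  where
  lem : ∀ a b → 0ℤ *ℤ a -ℤ (- b) ≡ b
  lem = solve-∀

-- A matching contains `e` at most once. Terms without `e` are killed by contraction, and the others
-- are restored when `e` is put back in front.
⟦split⟧ : ∀ e {S d c φ} → Alternating φ → On S d c → ⟦ c ⟧ φ ≡ ⟦ without e c ⟧ φ +ℤ ⟦ e ∙ con e c ⟧ φ
⟦split⟧ e {c = c} {φ} A o = ≡.trans (go o) (cong (⟦ without e c ⟧ φ +ℤ_) (sym (≡.trans (⟦∙⟧ e (con e c) φ) (⟦con⟧ e c (φ ∘ (e ∷_))))))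
  where
  go : ∀ {S d c} → On S d c → ⟦ c ⟧ φ ≡ ⟦ without e c ⟧ φ +ℤ ⟦ c ⟧ (κ [ e ≟₁_] (φ ∘ (e ∷_)))
  go [] = ≡.refl
  go {c = (k , σ) ∷ c} (f ∷ o) with any? (e ≟E_) σ
  ... | yes e∈ = ≡.trans (cong₂ (λ x y → k *ℤ x +ℤ y) (sym (κ-∈ A e∈ (distinct f))) (go o)) (lem (k *ℤ κ [ e ≟₁_] (φ ∘ (e ∷_)) σ) (⟦ without e c ⟧ φ) (⟦ c ⟧ (κ [ e ≟₁_] (φ ∘ (e ∷_)))))
    where
    lem : ∀ a b c → a +ℤ (b +ℤ c) ≡ b +ℤ (a +ℤ c)
    lem = solve-∀
  ... | no e∉ = ≡.trans (cong (k *ℤ φ σ +ℤ_) (go o))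
    (≡.trans (lem (k *ℤ φ σ) (⟦ without e c ⟧ φ) _ k)
      (cong (λ x → k *ℤ φ σ +ℤ ⟦ without e c ⟧ φ +ℤ (k *ℤ x +ℤ ⟦ c ⟧ (κ [ e ≟₁_] (φ ∘ (e ∷_))))) (sym (κ-∉ (φ ∘ (e ∷_)) e∉))))
    where
    lem : ∀ a b c k → a +ℤ (b +ℤ c) ≡ a +ℤ b +ℤ (k *ℤ 0ℤ +ℤ c)
    lem = solve-∀

⟦wedge-++ˡ⟧ : ∀ a b c φ → ⟦ wedge (a ++ b) c ⟧ φ ≡ ⟦ wedge a c ++ wedge b c ⟧ φ
⟦wedge-++ˡ⟧ a b c φ = ≡.trans (⟦⟧-wedge (a ++ b) c φ) (≡.trans (⟦⟧-++ a b _)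
  (≡.trans (cong₂ _+ℤ_ (sym (⟦⟧-wedge a c φ)) (sym (⟦⟧-wedge b c φ))) (sym (⟦⟧-++ (wedge a c) (wedge b c) φ))))

⟦wedge-++ʳ⟧ : ∀ a b c φ → ⟦ wedge c (a ++ b) ⟧ φ ≡ ⟦ wedge c a ++ wedge c b ⟧ φ
⟦wedge-++ʳ⟧ a b c φ = ≡.trans (⟦⟧-wedge c (a ++ b) φ)
  (≡.trans (⟦⟧-ext c (λ σ → ≡.trans (⟦⟧-++ a b _) (sym (cong₂ _+ℤ_ (ℤP.*-identityˡ (Φ a σ)) (ℤP.*-identityˡ (Φ b σ))))))
  (≡.trans (⟦⟧-linear 1ℤ 1ℤ c (Φ a) (Φ b))
  (≡.trans (cong₂ _+ℤ_ (≡.trans (ℤP.*-identityˡ _) (sym (⟦⟧-wedge c a φ))) (≡.trans (ℤP.*-identityˡ _) (sym (⟦⟧-wedge c b φ))))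
  (sym (⟦⟧-++ (wedge c a) (wedge c b) φ)))))
  where
  Φ : Chain → Cochain
  Φ d σ = ⟦ d ⟧ (λ τ → φ (σ ++ τ))

⟦⟧-* : ∀ k c φ → ⟦ c ⟧ (λ σ → k *ℤ φ σ) ≡ k *ℤ ⟦ c ⟧ φ
⟦⟧-* k [] φ = sym (ℤP.*-zeroʳ k)
⟦⟧-* k ((l , σ) ∷ c) φ = ≡.trans (cong (l *ℤ (k *ℤ φ σ) +ℤ_) (⟦⟧-* k c φ)) (lem k l (φ σ) (⟦ c ⟧ φ))
  where
  lem : ∀ k l a b → l *ℤ (k *ℤ a) +ℤ k *ℤ b ≡ k *ℤ (l *ℤ a +ℤ b)
  lem = solve-∀

⟦wedge-scaleˡ⟧ : ∀ k a c φ → ⟦ wedge (scale k a) c ⟧ φ ≡ ⟦ scale k (wedge a c) ⟧ φ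
⟦wedge-scaleˡ⟧ k a c φ = ≡.trans (⟦⟧-wedge (scale k a) c φ) (≡.trans (⟦⟧-scale k a _)
  (≡.trans (cong (k *ℤ_) (sym (⟦⟧-wedge a c φ))) (sym (⟦⟧-scale k (wedge a c) φ))))

⟦wedge-scaleʳ⟧ : ∀ k a c φ → ⟦ wedge c (scale k a) ⟧ φ ≡ ⟦ scale k (wedge c a) ⟧ φ
⟦wedge-scaleʳ⟧ k a c φ = ≡.trans (⟦⟧-wedge c (scale k a) φ) (≡.trans (⟦⟧-ext c (λ σ → ⟦⟧-scale k a _))
  (≡.trans (⟦⟧-* k c (λ σ → ⟦ a ⟧ (λ τ → φ (σ ++ τ))))
  (≡.trans (cong (k *ℤ_) (sym (⟦⟧-wedge c a φ))) (sym (⟦⟧-scale k (wedge c a) φ)))))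

-- Disjoint vertex sets guarantee that the factors share no edge, so every exchange is between
-- distinct edges; there are d times e exchanges.
⟦wedge-comm⟧ : ∀ {S T d e a b} → Unique (S ++ T) → On S d a → On T e b → ∀ {φ} → Alternating φ →
  ⟦ wedge a b ⟧ φ ≡ ⟦ scale (sgn (d ℕ.* e)) (wedge b a) ⟧ φ
⟦wedge-comm⟧ {S} {T} {d} {e} {a} {b} u oa ob {φ} A = begin
  ⟦ wedge a b ⟧ φ                                          ≡⟨ ⟦⟧-wedge a b φ ⟩
  ⟦ a ⟧ (λ σ → ⟦ b ⟧ (λ τ → φ (σ ++ τ)))                   ≡⟨ ⟦⟧-cong oa (λ σ f → ≡.trans (⟦⟧-cong ob (λ τ g → commute f g)) (⟦⟧-* s b _)) ⟩
  ⟦ a ⟧ (λ σ → s *ℤ ⟦ b ⟧ (λ τ → φ (τ ++ σ)))              ≡⟨ ⟦⟧-* s a _ ⟩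
  s *ℤ ⟦ a ⟧ (λ σ → ⟦ b ⟧ (λ τ → φ (τ ++ σ)))              ≡⟨ cong (s *ℤ_) (⟦⟧-swap a b _) ⟩
  s *ℤ ⟦ b ⟧ (λ τ → ⟦ a ⟧ (λ σ → φ (τ ++ σ)))              ≡⟨ cong (s *ℤ_) (sym (⟦⟧-wedge b a φ)) ⟩
  s *ℤ ⟦ wedge b a ⟧ φ                                     ≡⟨ sym (⟦⟧-scale s (wedge b a) φ) ⟩
  ⟦ scale s (wedge b a) ⟧ φ                                ∎
  where
  open ≡.≡-Reasoning
  s = sgn (d ℕ.* e)
  commute : ∀ {σ τ} → Face S d σ → Face T e τ → φ (σ ++ τ) ≡ s *ℤ φ (τ ++ σ)
  commute {σ} {τ} f g = ≡.trans
    (shift-simplex A σ τ (All.tabulate (λ e∈σ e∈τ → Unique-++-disjoint u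
      (All.lookup (inside f) (fst∈vertices e∈σ)) (All.lookup (inside g) (fst∈vertices e∈τ)))))
    (cong₂ (λ m n → sgn (m ℕ.* n) *ℤ φ (τ ++ σ)) (size f) (size g))

-- Spans of homology classes and types of cycles

module Spans (p : ℕ) where
  open Modular p public
  open ModularC p public

  Cycle : List ℕ → ℕ → Chain → Set
  Cycle S d c = On S d c × Closed c

  -- The cycles homologous to a combination of generators. As an inductive type it lets generators
  -- be replaced one at a time, with no filling carried along; `present` recovers the explicit
  -- combination and filling at the end.
  data Span (S : List ℕ) (e : ℕ) (P : Chain → Set) : Chain → Set where
    gen    : ∀ {z} → Cycle S e z → P z → Span S e P z
    bdry   : ∀ {b} → On S (suc e) b → Span S e P (∂ b)
    zero   : Span S e P []
    add    : ∀ {z w} → Span S e P z → Span S e P w → Span S e P (z ++ w)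
    smul   : ∀ k {z} → Span S e P z → Span S e P (scale k z)
    resp   : ∀ {z w} → z ≋ w → Span S e P w → Span S e P z

  span-closed : ∀ {S e P z} → Span S e P z → Closed z
  span-closed (gen (_ , c) _) = c
  span-closed (bdry {b} _) = Closed-∂ b
  span-closed zero = closed ≋-refl
  span-closed (add {z} {w} s t) = Closed-++ {z} {w} (span-closed s) (span-closed t)
  span-closed (smul k {z} s) = Closed-scale k {z} (span-closed s)
  span-closed (resp h s) = Closed-resp (≋-sym h) (span-closed s)

  span-bind : ∀ {S e} {P Q : Chain → Set} {z} → Span S e P z →
    (∀ {g} → Cycle S e g → P g → Span S e Q g) → Span S e Q z
  span-bind (gen c pz) h = h c pz
  span-bind (bdry o) h = bdry o
  span-bind zero h = zero
  span-bind (add s t) h = add (span-bind s h) (span-bind t h)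
  span-bind (smul k s) h = smul k (span-bind s h)
  span-bind (resp r s) h = resp r (span-bind s h)

  span-map : ∀ {S e} {P Q : Chain → Set} {z} → (∀ {g} → P g → Q g) → Span S e P z → Span S e Q z
  span-map h s = span-bind s (λ c pg → gen c (h pg))

  Cycle-mono : ∀ {S T d c} → (∀ {v} → v ∈ S → v ∈ T) → Cycle S d c → Cycle T d c
  Cycle-mono h (o , c) = On-mono h o , c

  Cycle-↭ : ∀ {S T d c} → S ↭ T → Cycle S d c → Cycle T d c
  Cycle-↭ p = Cycle-mono (↭P.∈-resp-↭ p)

  span-mono : ∀ {S T e P z} → (∀ {v} → v ∈ S → v ∈ T) → Span S e P z → Span T e P z
  span-mono h (gen c pz) = gen (Cycle-mono h c) pz
  span-mono h (bdry o) = bdry (On-mono h o)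
  span-mono h zero = zero
  span-mono h (add s t) = add (span-mono h s) (span-mono h t)
  span-mono h (smul k s) = smul k (span-mono h s)
  span-mono h (resp r s) = resp r (span-mono h s)

  span-↭ : ∀ {S T e P z} → S ↭ T → Span S e P z → Span T e P z
  span-↭ p = span-mono (↭P.∈-resp-↭ p)

  Cycle-wedge : ∀ {S T d e a b} → Unique (S ++ T) → Cycle S d a → Cycle T e b → Cycle (S ++ T) (d ℕ.+ e) (wedge a b)
  Cycle-wedge {a = a} {b} u (oa , ca) (ob , cb) = On-wedge u oa ob , Closed-wedge {c = a} {d = b} (On-homogeneous oa) ca cb

  -- By linearity only generators need attention: since `w` is closed, the product of a boundary
  -- with `w` is again a boundary.
  span-wedgeˡ : ∀ {S T d e} {P Q : Chain → Set} {z w} → Unique (S ++ T) → Span S d P z → Cycle T e w →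
    (∀ {g} → Cycle S d g → P g → Span (S ++ T) (d ℕ.+ e) Q (wedge g w)) → Span (S ++ T) (d ℕ.+ e) Q (wedge z w)
  span-wedgeˡ u (gen c pz) cw h = h c pz
  span-wedgeˡ {w = w} u (bdry {b} o) cw h =
    resp (≋-sym (∂-wedgeʳ-closed {c = b} {d = w} (On-homogeneous o) (proj₂ cw))) (bdry (On-wedge u o (proj₁ cw)))
  span-wedgeˡ u zero cw h = zero
  span-wedgeˡ {w = w} u (add {z₁} {z₂} s t) cw h =
    resp (exact (λ φ _ → ⟦wedge-++ˡ⟧ z₁ z₂ w φ)) (add (span-wedgeˡ u s cw h) (span-wedgeˡ u t cw h))
  span-wedgeˡ {w = w} u (smul k {z} s) cw h =
    resp (exact (λ φ _ → ⟦wedge-scaleˡ⟧ k z w φ)) (smul k (span-wedgeˡ u s cw h))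
  span-wedgeˡ {w = w} u (resp r s) cw h = resp (wedge-congˡ w r) (span-wedgeˡ u s cw h)

  span-wedgeʳ : ∀ {S T d e} {P Q : Chain → Set} {z w} → Unique (S ++ T) → Cycle S d z → Span T e P w →
    (∀ {g} → Cycle T e g → P g → Span (S ++ T) (d ℕ.+ e) Q (wedge z g)) → Span (S ++ T) (d ℕ.+ e) Q (wedge z w)
  span-wedgeʳ u cz (gen c pw) h = h c pw
  span-wedgeʳ {S} {T} {d} {e} {z = z} u cz (bdry {b} o) h =
    resp (≋-sym (∂-wedgeˡ-closed {c = z} {d = b} (On-homogeneous (proj₁ cz)) (proj₂ cz)))
      (smul (sgn d) (bdry (subst (λ n → On (S ++ T) n (wedge z b)) (ℕP.+-suc d e) (On-wedge u (proj₁ cz) o))))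
  span-wedgeʳ {z = z} u cz zero h = resp (wedge-[]ʳ z) zero
  span-wedgeʳ {z = z} u cz (add {w₁} {w₂} s t) h =
    resp (exact (λ φ _ → ⟦wedge-++ʳ⟧ w₁ w₂ z φ)) (add (span-wedgeʳ u cz s h) (span-wedgeʳ u cz t h))
  span-wedgeʳ {z = z} u cz (smul k {w} s) h =
    resp (exact (λ φ _ → ⟦wedge-scaleʳ⟧ k w z φ)) (smul k (span-wedgeʳ u cz s h))
  span-wedgeʳ {z = z} u cz (resp r s) h = resp (wedge-congʳ z r) (span-wedgeʳ u cz s h)

  Family : Set₁
  Family = List ℕ → Chain → Set

  -- type [m,d] ∧ P
  record Joined (m d e : ℕ) (P : Family) (S : List ℕ) (z : Chain) : Set where
    constructor joined
    field
      {left right} : List ℕ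
      {a b}        : Chain
      perm         : left ++ right ↭ S
      size-left    : length left ≡ m
      cycleˡ       : Cycle left d a
      cycleʳ       : Cycle right e b
      member       : P right b
      split        : z ≋ wedge a b

  -- type [1,0] ∧ P
  record Pointed (e : ℕ) (P : Family) (S : List ℕ) (z : Chain) : Set where
    constructor pointed
    field
      {point} : ℕ
      {rest}  : List ℕ
      {chain} : Chain
      perm    : point ∷ rest ↭ S
      cycle   : Cycle rest e chain
      member  : P rest chain
      same    : z ≋ chain

  Joined-↭ : ∀ {m d e P S T z} → S ↭ T → Joined m d e P S z → Joined m d e P T z
  Joined-↭ p (joined q l ca cb m s) = joined (trans q p) l ca cb m s

  Pointed-↭ : ∀ {e P S T z} → S ↭ T → Pointed e P S z → Pointed e P T z
  Pointed-↭ p (pointed q c m s) = pointed (trans q p) c m s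

  size-right : ∀ {m n S} {left right : List ℕ} → left ++ right ↭ S → length left ≡ m → length S ≡ m ℕ.+ n → length right ≡ n
  size-right {left = left} {right} p ≡.refl l =
    ℕP.+-cancelˡ-≡ (length left) _ _ (≡.trans (sym (length-++ left)) (≡.trans (↭P.↭-length p) l))

  joined-bind : ∀ {m d e n P Q S z} → Unique S → length S ≡ m ℕ.+ n → Joined m d e P S z →
    (∀ {R b} → Unique R → length R ≡ n → Cycle R e b → P R b → Span R e (Q R) b) →
    Span S (d ℕ.+ e) (Joined m d e Q S) z
  joined-bind u l (joined {left} p l' ca cb m s) h = resp s (span-map (Joined-↭ p) (span-↭ p
    (span-wedgeʳ uLR ca (h (Unique-++ʳ left uLR) (size-right {left = left} p l' l) cb m)
      (λ cg pg → gen (Cycle-wedge uLR ca cg) (joined {left = left} refl l' ca cg pg ≋-refl)))))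
    where uLR = Unique-↭ (↭-sym p) u

-- Edges of a matching at a given vertex

pick : ∀ {s} {S : List ℕ} → s ∈ S → ∃ λ R → S ↭ s ∷ R
pick s∈ with ∈-∃++ s∈
... | ws , xs , ≡.refl = ws ++ xs , ↭P.shift _ ws xs

edge-at : ∀ {S v σ} → All (λ e → proj₁ e ℕ.< proj₂ e) σ → All (_∈ S) (vertices σ) → v ∈ vertices σ →
  ∃ λ s → s ∈ S × v ≢ s × mk v s ∈ σ
edge-at (o ∷ _) (a ∷ b ∷ _) (here v≡) with edge-view o a b (here v≡)
... | s , s∈ , ≢ , eq = s , s∈ , ≢ , here (sym eq)
edge-at (o ∷ _) (a ∷ b ∷ _) (there (here v≡)) with edge-view o a b (there (here v≡))
... | s , s∈ , ≢ , eq = s , s∈ , ≢ , here (sym eq)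
edge-at (_ ∷ o) (_ ∷ _ ∷ i) (there (there v∈)) with edge-at o i v∈
... | s , s∈ , ≢ , e∈ = s , s∈ , ≢ , there e∈

ends∈ : ∀ u v {σ} → mk u v ∈ σ → All (_∈ vertices σ) (u ∷ v ∷ [])
ends∈ u v e∈ = ↭P.All-resp-↭ (mk-↭ u v) (fst∈vertices e∈ ∷ snd∈vertices e∈ ∷ [])

mk-∉ : ∀ {u v} e → u ∉ proj₁ e ∷ proj₂ e ∷ [] → mk u v ≢ e
mk-∉ {u} {v} e u∉ ≡.refl = u∉ (↭P.∈-resp-↭ (↭-sym (mk-↭ u v)) (here ≡.refl))

-- Two different entries of a matching at `v` would make `v` occur twice among its vertices.
mk-injective : ∀ {v s t σ} → Unique (vertices σ) → mk v s ∈ σ → mk v t ∈ σ → mk v s ≡ mk v t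
mk-injective {v} {s} {t} u (here p) (here q) = ≡.trans p (sym q)
mk-injective {v} {s} {t} {σ = e ∷ σ} u (here ≡.refl) (there q) with Unique-↭ (mk-↭ v s) u
... | (_ ∷ v∉) ∷ _ = contradiction ≡.refl (All.lookup v∉ (All.head (ends∈ v t q)))
mk-injective {v} {s} {t} {σ = e ∷ σ} u (there q) (here ≡.refl) with Unique-↭ (mk-↭ v t) u
... | (_ ∷ v∉) ∷ _ = contradiction ≡.refl (All.lookup v∉ (All.head (ends∈ v s q)))
mk-injective (_ ∷ _ ∷ u) (there p) (there q) = mk-injective u p q

mk-cancel : ∀ v {s t} → v ≢ s → mk v s ≡ mk v t → s ≡ t
mk-cancel v {s} {t} v≢s eq with ↭P.∈-resp-↭ (mk-↭ v t {[]})
  (subst (λ e → s ∈ proj₁ e ∷ proj₂ e ∷ []) eq (↭P.∈-resp-↭ (↭-sym (mk-↭ v s)) (there (here ≡.refl))))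
... | here s≡v = contradiction (sym s≡v) v≢s
... | there (here s≡t) = s≡t

Face-drop : ∀ {w R d σ} → Face (w ∷ R) d σ → w ∉ vertices σ → Face R d σ
Face-drop {w} {R} {σ = σ} (face o i u l) w∉ = face o (All.tabulate λ v∈ → lem v∈ (All.lookup i v∈)) u l
  where
  lem : ∀ {v} → v ∈ vertices σ → v ∈ w ∷ R → v ∈ R
  lem v∈σ (here ≡.refl) = contradiction v∈σ w∉
  lem v∈σ (there v∈) = v∈

All-con : ∀ {Q : Simplex → Set} e → (∀ {σ τ} → σ ↭ τ → Q σ → Q τ) → ∀ {c} → All (Q ∘ proj₂) c → All (λ t → Q (e ∷ proj₂ t)) (con e c)
All-con {Q} e r = extend-All {Q} {λ τ → Q (e ∷ τ)} (conS e) (λ σ q → All.map (λ p → r (↭-sym p) q) (conS-↭ e σ))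

face2 : ∀ {V u v w x} → Unique (u ∷ v ∷ w ∷ x ∷ []) → All (_∈ V) (u ∷ v ∷ w ∷ x ∷ []) → Face V 2 (mk u v ∷ mk w x ∷ [])
face2 {u = u} {v} U@(_ ∷ _ ∷ U') i =
  Face-mono (All.lookup i) (Face-mk U (Face-mk {R = []} U' (face [] [] [] ≡.refl)))

face1 : ∀ {V u v} → u ≢ v → u ∈ V → v ∈ V → Face V 1 (mk u v ∷ [])
face1 {u = u} {v} u≢v i j = Face-mono (All.lookup (i ∷ j ∷ [])) (Face-mk ((u≢v ∷ []) ∷ [] ∷ []) (face [] [] [] ≡.refl))

-- Used for the pentagon xs, yt, sa, xy, ta of the Petersen graph M₅, in which only the term xs ∧ yt has x and y on
-- different edges.

pentagonRest : (A B C D E : Edge) → Chain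
pentagonRest A B C D E = (1ℤ , B ∷ C ∷ []) ∷ (1ℤ , C ∷ D ∷ []) ∷ (1ℤ , D ∷ E ∷ []) ∷ (1ℤ , E ∷ A ∷ []) ∷ []

pentagon : (A B C D E : Edge) → Chain
pentagon A B C D E = (1ℤ , A ∷ B ∷ []) ∷ pentagonRest A B C D E

⟦∂pentagon⟧ : ∀ A B C D E φ → ⟦ ∂ (pentagon A B C D E) ⟧ φ ≡ 0ℤ
⟦∂pentagon⟧ A B C D E φ = lem (φ (A ∷ [])) (φ (B ∷ [])) (φ (C ∷ [])) (φ (D ∷ [])) (φ (E ∷ []))
  where
  lem : ∀ a b c d e → 1ℤ *ℤ b +ℤ (-1ℤ *ℤ a +ℤ (1ℤ *ℤ c +ℤ (-1ℤ *ℤ b +ℤ (1ℤ *ℤ d +ℤ (-1ℤ *ℤ c +ℤ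
    (1ℤ *ℤ e +ℤ (-1ℤ *ℤ d +ℤ (1ℤ *ℤ a +ℤ (-1ℤ *ℤ e +ℤ 0ℤ))))))))) ≡ 0ℤ
  lem = solve-∀

-- Replacing the edges at x and y by the edge xy

module TwoVertices (p : ℕ) where
  open Spans p

  Closed-summand : ∀ {z a c} → z ≋ a ++ c → Closed z → Closed a → Closed c
  Closed-summand {z} {a} {c} h cz ca .boundary .at φ A = via-zero
    (+-congₚ (Closed-resp h cz .boundary .at φ A) (neg-congₚ {b = 0ℤ} (ca .boundary .at φ A)))
    (≡.trans (lem (⟦ ∂ a ⟧ φ) (⟦ ∂ c ⟧ φ)) (cong (λ t → 0ℤ +ℤ (t -ℤ ⟦ ∂ a ⟧ φ)) (sym (⟦∂++⟧ a c φ))))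
    where
    lem : ∀ a b → b ≡ 0ℤ +ℤ (a +ℤ b -ℤ a)
    lem = solve-∀

  Any : Family
  Any _ _ = ⊤

  module Pair (x y : ℕ) (S' : List ℕ) (uniq : Unique (x ∷ y ∷ S')) where

    S : List ℕ
    S = x ∷ y ∷ S'

    xy : Edge
    xy = mk x y

    x≢y : x ≢ y
    x≢y = All.head (AllPairs.head uniq)

    x∉S' : x ∉ S'
    x∉S' x∈ = All.lookup (All.tail (AllPairs.head uniq)) x∈ ≡.refl

    y∉S' : y ∉ S'
    y∉S' y∈ = All.lookup (AllPairs.head (AllPairs.tail uniq)) y∈ ≡.refl

    -- Modulo cycles of type [3,1] ∧ [n-3,e], an edge vs can be replaced by the edge xy.

    module _ {v w : ℕ} (vw : v ∷ w ∷ S' ↭ S) (mk-vw : mk v w ≡ xy)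
             {e : ℕ} {Q : Chain → Set} (triple : ∀ {z} → Joined 3 1 e Any S z → Q z)
             {Good : Simplex → Set} (good-∉ : ∀ {σ} → Good σ → v ∉ vertices σ)
             (finish : ∀ {z} → Cycle S (suc e) z → All (λ t → Good (proj₂ t) ⊎ xy ∈ proj₂ t) z → Span S (suc e) Q z)
             where

      -- The list `L` holds the neighbours of `v` still to be treated. In the last case `w` must be
      -- free, because `vs` is to be exchanged for `vw`, which is `xy`.
      Clearing : List ℕ → Simplex → Set
      Clearing L σ = Good σ ⊎ xy ∈ σ ⊎ (w ∉ vertices σ × ∃ λ s → s ∈ L × mk v s ∈ σ)

      clear : ∀ L → (∀ {s} → s ∈ L → s ∈ S') → ∀ {z} → Cycle S (suc e) z → All (Clearing L ∘ proj₂) z → Span S (suc e) Q z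
      clear [] L⊆ cz inv = finish cz (All.map (λ { (inj₁ g) → inj₁ g ; (inj₂ (inj₁ xy∈)) → inj₂ xy∈ }) inv)
      clear (s ∷ L) L⊆ {z} (oz , cz) inv = resp decompose (add (gen joined-cycle (triple joined-z)) (clear L (L⊆ ∘ there) cz' inv'))
        where
        s∈S' = L⊆ (here ≡.refl)
        R = proj₁ (pick s∈S')
        S'↭ = proj₂ (pick s∈S')
        u-vws : Unique (v ∷ w ∷ s ∷ R)
        u-vws = Unique-↭ (trans (↭-sym vw) (prep v (prep w S'↭))) uniq
        u-vsw : Unique (v ∷ s ∷ w ∷ R)
        u-vsw = Unique-↭ (prep v (swap w s refl)) u-vws
        S↭ : S ↭ v ∷ s ∷ w ∷ R
        S↭ = trans (↭-sym vw) (prep v (trans (prep w S'↭) (swap w s refl)))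
        v≢w : v ≢ w
        v≢w = All.head (AllPairs.head u-vws)
        v≢s : v ≢ s
        v≢s = All.head (AllPairs.head u-vsw)
        s≢w : s ≢ w
        s≢w = All.head (AllPairs.head (AllPairs.tail u-vsw))
        f = mk v s
        b = con f z
        f≢xy : f ≢ xy
        f≢xy eq = s≢w (mk-cancel v v≢s (≡.trans eq (sym mk-vw)))
        -- No term containing `vs` meets `w`: good terms avoid `v`, terms with `xy` use `v` in
        -- another edge, and the rest avoid `w` by the invariant. So `b` leaves `v`, `s`, `w` free
        -- for the triangle cycle `a`.
        on-b : On R e b
        on-b = extend-All (conS f) (λ σ (fc , inv) → All.map (λ {t} q →
                 Face-drop (Face-unmk S↭ (Face-resp-↭ (↭-sym q) fc)) (w∉con {τ = proj₂ t} q fc inv)) (conS-↭ f σ)) (All.zip (oz , inv))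
          where
          w∉con : ∀ {σ τ} → f ∷ τ ↭ σ → Face S (suc e) σ → Clearing (s ∷ L) σ → w ∉ vertices τ
          w∉con {τ = τ} q fc (inj₁ g) w∈ = good-∉ g (↭P.∈-resp-↭ (vertices-↭ q) (All.head (ends∈ v s {f ∷ τ} (here ≡.refl))))
          w∉con q fc (inj₂ (inj₁ xy∈)) w∈ = f≢xy (≡.trans
            (mk-injective (distinct fc) (↭P.∈-resp-↭ q (here ≡.refl)) (subst (_∈ _) (sym mk-vw) xy∈)) mk-vw)
          w∉con q fc (inj₂ (inj₂ (w∉ , _))) w∈ = w∉ (↭P.∈-resp-↭ (vertices-↭ q) (there (there w∈)))
        a : Chain
        a = (1ℤ , f ∷ []) ∷ (-1ℤ , xy ∷ []) ∷ []
        V = v ∷ s ∷ w ∷ []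
        cycle-a : Cycle V 1 a
        cycle-a = (face1 v≢s (here ≡.refl) (there (here ≡.refl))
          ∷ subst (λ g → Face V 1 (g ∷ [])) mk-vw (face1 v≢w (here ≡.refl) (there (there (here ≡.refl)))) ∷ [])
          , closed (exact (λ φ _ → lem (φ [])))
          where
          lem : ∀ x → 1ℤ *ℤ x +ℤ (-1ℤ *ℤ x +ℤ 0ℤ) ≡ 0ℤ
          lem = solve-∀
        cycle-b : Cycle R e b
        cycle-b = on-b , Closed-con f {z} cz
        joined-z : Joined 3 1 e Any S (wedge a b)
        joined-z = joined {left = V} (↭-sym S↭) ≡.refl cycle-a cycle-b tt ≋-refl
        joined-cycle : Cycle S (suc e) (wedge a b)
        joined-cycle = Cycle-↭ (↭-sym S↭) (Cycle-wedge {S = V} u-vsw cycle-a cycle-b)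
        -- This is `z` with `xy` in place of every `vs`; the difference is `a` times `b`.
        z' : Chain
        z' = without f z ++ xy ∙ b
        on-z' : On S (suc e) z'
        on-z' = On-++ (All.map proj₁ (All-without f oz))
          (subst (λ g → On S (suc e) (g ∙ b)) mk-vw
            (On-↭ (trans (prep v (swap w s refl)) (↭-sym S↭))
              (On-mono (λ { (here eq) → here eq ; (there (here eq)) → there (here eq) ; (there (there i)) → there (there (there i)) })
                (On-∙ {R = R} u-vwR on-b))))
          where
          u-vwR : Unique (v ∷ w ∷ R)
          u-vwR with u-vws
          ... | (p ∷ _ ∷ q) ∷ (_ ∷ r) ∷ _ ∷ t = (p ∷ q) ∷ r ∷ t
        decompose : z ≋ wedge a b ++ z'
        decompose = exact (λ φ A → ≡.trans (⟦split⟧ f A oz)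
          (≡.trans (cong (⟦ without f z ⟧ φ +ℤ_) (⟦∙⟧ f b φ))
          (≡.trans (lem (⟦ without f z ⟧ φ) (⟦ b ⟧ (φ ∘ (f ∷_))) (⟦ b ⟧ (φ ∘ (xy ∷_))))
          (sym (≡.trans (⟦⟧-++ (wedge a b) z' φ) (cong₂ _+ℤ_ (⟦⟧-wedge a b φ)
            (≡.trans (⟦⟧-++ (without f z) (xy ∙ b) φ) (cong (⟦ without f z ⟧ φ +ℤ_) (⟦∙⟧ xy b φ)))))))))
          where
          lem : ∀ p q r → p +ℤ q ≡ 1ℤ *ℤ q +ℤ (-1ℤ *ℤ r +ℤ 0ℤ) +ℤ (p +ℤ r)
          lem = solve-∀
        cz' : Cycle S (suc e) z'
        cz' = on-z' , Closed-summand {z} {wedge a b} {z'} decompose cz (proj₂ joined-cycle)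
        inv' : All (Clearing L ∘ proj₂) z'
        inv' = AllP.++⁺ (All.map (λ {t} → keep {t}) (All-without f inv)) (AllP.map⁺ (All.tabulate (λ _ → inj₂ (inj₁ (here ≡.refl)))))
          where
          keep : ∀ {t : Term} → Clearing (s ∷ L) (proj₂ t) × f ∉ proj₂ t → Clearing L (proj₂ t)
          keep (inj₁ g , _) = inj₁ g
          keep (inj₂ (inj₁ xy∈) , _) = inj₂ (inj₁ xy∈)
          keep (inj₂ (inj₂ (w∉ , s' , here ≡.refl , f∈)) , f∉) = contradiction f∈ f∉
          keep (inj₂ (inj₂ (w∉ , s' , there s'∈ , f∈)) , f∉) = inj₂ (inj₂ (w∉ , s' , s'∈ , f∈))

module StageTwo (p : ℕ) (x y : ℕ) (S' : List ℕ) (uniq : Unique (x ∷ y ∷ S')) where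
  open Spans p
  open TwoVertices p
  open Pair x y S' uniq

  -- z = z₀ + xy ∧ a with z₀ avoiding x and y, and then z = ∂ (xy ∧ z₀)
  cone : ∀ {e Q z} → Cycle S (suc e) z →
    All (λ t → (x ∉ vertices (proj₂ t) × y ∉ vertices (proj₂ t)) ⊎ xy ∈ proj₂ t) z → Span S (suc e) Q z
  cone {e} {z = z} (oz , cz) good = resp z≋∂ (bdry {b = xy ∙ z₀} (On-∙ uniq on-z₀))
    where
    z₀ a : Chain
    z₀ = without xy z
    a = con xy z
    on-z₀ : On S' (suc e) z₀
    on-z₀ = All.map (λ {t} → inS' {t}) (All-without xy (All.zip (oz , good)))
      where
      inS' : ∀ {t : Term} → (Face S (suc e) (proj₂ t) × ((x ∉ vertices (proj₂ t) × y ∉ vertices (proj₂ t)) ⊎ xy ∈ proj₂ t))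
        × xy ∉ proj₂ t → Face S' (suc e) (proj₂ t)
      inS' {k , σ} ((f , inj₁ (x∉ , y∉)) , _) = Face-drop {σ = σ} (Face-drop {σ = σ} f x∉) y∉
      inS' ((_ , inj₂ xy∈) , xy∉) = contradiction xy∈ xy∉
    ∂z₀ : ∀ {φ} → Alternating φ → ⟦ ∂ z₀ ⟧ φ ≡ₚ - ⟦ a ⟧ φ
    ∂z₀ {φ} A = via-zero (+-congₚ (∂z .boundary .at φ A) (Closed-con xy {z} cz .boundary .at (φ ∘ (xy ∷_)) (Alternating-∷ xy A)))
      (≡.trans (lem (⟦ ∂ z₀ ⟧ φ) (⟦ a ⟧ φ) (⟦ ∂ a ⟧ (φ ∘ (xy ∷_))))
        (cong (λ t → - ⟦ a ⟧ φ +ℤ (t +ℤ ⟦ ∂ a ⟧ (φ ∘ (xy ∷_))))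
          (≡.trans (cong (⟦ ∂ z₀ ⟧ φ +ℤ_) (sym (⟦∂∙⟧ xy a φ))) (sym (⟦∂++⟧ z₀ (xy ∙ a) φ)))))
      where
      ∂z : Closed (z₀ ++ xy ∙ a)
      ∂z = Closed-resp (exact (λ φ A → ≡.trans (⟦split⟧ xy A oz) (sym (⟦⟧-++ z₀ (xy ∙ a) φ)))) cz
      lem : ∀ p q r → p ≡ - q +ℤ (p +ℤ (q -ℤ r) +ℤ r)
      lem = solve-∀
    z≋∂ : z ≋ ∂ (xy ∙ z₀)
    z≋∂ .at φ A = ≡ₚ-trans (≡⇒≡ₚ (≡.trans (⟦split⟧ xy A oz) (cong (⟦ z₀ ⟧ φ +ℤ_) (≡.trans (⟦∙⟧ xy a φ) (sym (ℤP.neg-involutive _))))))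
      (≡ₚ-trans (+-congₚ (≡ₚ-refl {⟦ z₀ ⟧ φ}) (neg-congₚ (≡ₚ-sym (∂z₀ (Alternating-∷ xy A)))))
        (≡⇒≡ₚ (sym (⟦∂∙⟧ xy z₀ φ))))

  Undivided : Simplex → Set
  Undivided σ = x ∉ vertices σ ⊎ y ∉ vertices σ ⊎ xy ∈ σ

  -- Two passes of `clear`. The first moves the edges at `x` while `y` is free and leaves terms that
  -- avoid `x` or contain `xy`; hence `x` is free at every edge `yt` treated by the second, and
  -- `cone` finishes.
  stage-two : ∀ {e} {Q : Chain → Set} → (∀ {z} → Joined 3 1 e Any S z → Q z) →
    ∀ {z} → Cycle S (suc e) z → All (Undivided ∘ proj₂) z → Span S (suc e) Q z
  stage-two {e} {Q} triple {z} cz und =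
    clear {x} {y} refl ≡.refl triple {Good = λ σ → x ∉ vertices σ} (λ g → g) second S' (λ s∈ → s∈) cz
      (All.zipWith (λ {t} → start {t}) (proj₁ cz , und))
    where
    start : ∀ {t : Term} → Face S (suc e) (proj₂ t) × Undivided (proj₂ t) →
      x ∉ vertices (proj₂ t) ⊎ xy ∈ proj₂ t ⊎ (y ∉ vertices (proj₂ t) × ∃ λ s → s ∈ S' × mk x s ∈ proj₂ t)
    start (f , inj₁ x∉) = inj₁ x∉
    start (f , inj₂ (inj₂ xy∈)) = inj₂ (inj₁ xy∈)
    start {t} (f , inj₂ (inj₁ y∉)) with x ∈? vertices (proj₂ t)
    ... | no x∉ = inj₁ x∉
    ... | yes x∈ with edge-at (ordered f) (inside f) x∈
    ... | s , here s≡x , x≢s , _ = contradiction (sym s≡x) x≢s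
    ... | s , there (here ≡.refl) , _ , xy∈ = inj₂ (inj₁ xy∈)
    ... | s , there (there s∈) , _ , e∈ = inj₂ (inj₂ (y∉ , s , s∈ , e∈))
    restart : ∀ {t : Term} → Face S (suc e) (proj₂ t) × (x ∉ vertices (proj₂ t) ⊎ xy ∈ proj₂ t) →
      (x ∉ vertices (proj₂ t) × y ∉ vertices (proj₂ t)) ⊎ xy ∈ proj₂ t ⊎ (x ∉ vertices (proj₂ t) × ∃ λ s → s ∈ S' × mk y s ∈ proj₂ t)
    restart (f , inj₂ xy∈) = inj₂ (inj₁ xy∈)
    restart {t} (f , inj₁ x∉) with y ∈? vertices (proj₂ t)
    ... | no y∉ = inj₁ (x∉ , y∉)
    ... | yes y∈ with edge-at (ordered f) (inside f) y∈
    ... | s , here ≡.refl , _ , yx∈ = inj₂ (inj₁ (subst (_∈ proj₂ t) (mk-comm y x) yx∈))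
    ... | s , there (here s≡y) , y≢s , _ = contradiction (sym s≡y) y≢s
    ... | s , there (there s∈) , _ , e∈ = inj₂ (inj₂ (x∉ , s , s∈ , e∈))
    second : ∀ {z} → Cycle S (suc e) z → All (λ t → x ∉ vertices (proj₂ t) ⊎ xy ∈ proj₂ t) z → Span S (suc e) Q z
    second cz h = clear {y} {x} (swap y x refl) (mk-comm y x) triple {Good = λ σ → x ∉ vertices σ × y ∉ vertices σ} proj₂ cone
      S' (λ s∈ → s∈) cz (All.zipWith (λ {t} → restart {t}) (proj₁ cz , h))

-- Removing terms with x and y on different edges

module StageOne (p : ℕ) (x y : ℕ) (S' : List ℕ) (uniq : Unique (x ∷ y ∷ S')) where
  open Spans p
  open TwoVertices p
  open Pair x y S' uniq
  open StageTwo p x y S' uniq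

  Undivided-↭ : ∀ {σ τ} → σ ↭ τ → Undivided σ → Undivided τ
  Undivided-↭ q (inj₁ x∉) = inj₁ (x∉ ∘ ↭P.∈-resp-↭ (vertices-↭ (↭-sym q)))
  Undivided-↭ q (inj₂ (inj₁ y∉)) = inj₂ (inj₁ (y∉ ∘ ↭P.∈-resp-↭ (vertices-↭ (↭-sym q))))
  Undivided-↭ q (inj₂ (inj₂ xy∈)) = inj₂ (inj₂ (↭P.∈-resp-↭ q xy∈))

  Dividing : List (ℕ × ℕ) → Simplex → Set
  Dividing L σ = Undivided σ ⊎ ∃ λ st → st ∈ L × mk x (proj₁ st) ∈ σ × mk y (proj₂ st) ∈ σ

  Dividing-↭ : ∀ {L σ τ} → σ ↭ τ → Dividing L σ → Dividing L τ
  Dividing-↭ q (inj₁ u) = inj₁ (Undivided-↭ q u)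
  Dividing-↭ q (inj₂ (st , st∈ , f∈ , g∈)) = inj₂ (st , st∈ , ↭P.∈-resp-↭ q f∈ , ↭P.∈-resp-↭ q g∈)

  dividing : ∀ {d σ} → Face S d σ → Dividing (cartesianProduct S' S') σ
  dividing {σ = σ} F with x ∈? vertices σ | y ∈? vertices σ
  ... | no x∉ | _ = inj₁ (inj₁ x∉)
  ... | yes _ | no y∉ = inj₁ (inj₂ (inj₁ y∉))
  ... | yes x∈ | yes y∈ with edge-at (ordered F) (inside F) x∈ | edge-at (ordered F) (inside F) y∈
  ... | s , here s≡x , x≢s , _ | _ = contradiction (sym s≡x) x≢s
  ... | s , there (here ≡.refl) , _ , xy∈ | _ = inj₁ (inj₂ (inj₂ xy∈))
  ... | _ | t , here ≡.refl , _ , yx∈ = inj₁ (inj₂ (inj₂ (subst (_∈ σ) (mk-comm y x) yx∈)))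
  ... | _ | t , there (here t≡y) , y≢t , _ = contradiction (sym t≡y) y≢t
  ... | s , there (there s∈) , _ , f∈ | t , there (there t∈) , _ , g∈ =
    inj₂ ((s , t) , ∈-cartesianProduct⁺ s∈ t∈ , f∈ , g∈)

  module _ {e : ℕ} {P : Family} {Q : Chain → Set} (pent : ∀ {z} → Joined 5 2 e P S z → Q z)
           {s t : ℕ} {R : List ℕ} (S'↭ : S' ↭ s ∷ t ∷ R) where

    private
      f g : Edge
      f = mk x s
      g = mk y t

      u-xyst : Unique (x ∷ y ∷ s ∷ t ∷ R)
      u-xyst = Unique-↭ (prep x (prep y S'↭)) uniq

      xyst↭ : S ↭ x ∷ y ∷ s ∷ t ∷ R
      xyst↭ = prep x (prep y S'↭)

      x∉R : x ∉ R
      x∉R v∈ = x∉S' (↭P.∈-resp-↭ (↭-sym S'↭) (there (there v∈)))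

      y∉R : y ∉ R
      y∉R v∈ = y∉S' (↭P.∈-resp-↭ (↭-sym S'↭) (there (there v∈)))

      ∉-face : ∀ {v V d τ} → v ∉ V → Face V d τ → v ∉ vertices τ
      ∉-face v∉ F v∈ = v∉ (All.lookup (inside F) v∈)

      ∉-mk : ∀ {v a b τ} → v ≢ a → v ≢ b → v ∉ vertices τ → v ∉ vertices (mk a b ∷ τ)
      ∉-mk {a = a} {b} v≢a v≢b v∉ v∈ with ↭P.∈-resp-↭ (mk-↭ a b) v∈
      ... | here v≡a = v≢a v≡a
      ... | there (here v≡b) = v≢b v≡b
      ... | there (there v∈') = v∉ v∈'

      x≢s : x ≢ s
      x≢s ≡.refl = x∉S' (↭P.∈-resp-↭ (↭-sym S'↭) (here ≡.refl))
      x≢t : x ≢ t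
      x≢t ≡.refl = x∉S' (↭P.∈-resp-↭ (↭-sym S'↭) (there (here ≡.refl)))
      y≢s : y ≢ s
      y≢s ≡.refl = y∉S' (↭P.∈-resp-↭ (↭-sym S'↭) (here ≡.refl))
      y≢t : y ≢ t
      y≢t ≡.refl = y∉S' (↭P.∈-resp-↭ (↭-sym S'↭) (there (here ≡.refl)))

    -- What is needed of a coefficient `d`: modulo the span, its product with xs ∧ yt can be traded
    -- for terms that are undivided. The property is linear in `d`, so it can be proved along the
    -- constructors of `Span`.
    record Lifted (d : Chain) : Set where
      constructor lifted
      field
        {main tail} : Chain
        span-main   : Span S (suc (suc e)) Q main
        on-tail     : On S (suc (suc e)) tail
        undivided   : All (Undivided ∘ proj₂) tail
        lift        : f ∙ g ∙ d ≋ main ++ tail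

    private
      ⟦∙∙⟧ : ∀ d φ → ⟦ f ∙ g ∙ d ⟧ φ ≡ ⟦ d ⟧ (λ τ → φ (f ∷ g ∷ τ))
      ⟦∙∙⟧ d φ = ≡.trans (⟦∙⟧ f (g ∙ d) φ) (⟦∙⟧ g d (φ ∘ (f ∷_)))

      wedge-Undivided : ∀ {V d b c} → (∀ {σ} → Face V d σ → All (λ t → Undivided (proj₂ t ++ σ)) c) → On V d b →
        All (Undivided ∘ proj₂) (wedge c b)
      wedge-Undivided {c = []} h o = []
      wedge-Undivided {V} {d} {b} {(k , ρ) ∷ c} h o =
        AllP.++⁺ (AllP.map⁺ (All.map (λ F → All.head (h F)) o)) (wedge-Undivided (λ F → All.tail (h F)) o)

    lift-pointed : ∀ {d} → Pointed e P R d → Lifted d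
    lift-pointed {d} (pointed {a} {W} {w} R↭ (ow , cw) pw d≋w) = lifted
      (gen (Cycle-↭ perm (Cycle-wedge {S = V} u-all cycle-pent (ow , cw)))
           (pent (joined {left = V} perm ≡.refl cycle-pent (ow , cw) pw ≋-refl)))
      (On-scale -1ℤ (On-↭ perm (On-wedge {S = V} u-all (All.tail on-pent) ow)))
      (AllP.map⁺ (wedge-Undivided undiv ow))
      decomposition
      where
      V = x ∷ y ∷ s ∷ t ∷ a ∷ []
      A B C D E : Edge
      A = f
      B = g
      C = mk s a
      D = xy
      E = mk t a
      perm : V ++ W ↭ S
      perm = ↭-sym (trans xyst↭ (prep x (prep y (prep s (prep t (↭-sym R↭))))))
      u-all : Unique (V ++ W)
      u-all = Unique-↭ (↭-sym perm) uniq
      on-pent : On V 2 (pentagon A B C D E)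
      on-pent with Unique-++ˡ {V} u-all
      ... | (xy≢ ∷ xs ∷ xt ∷ xa ∷ []) ∷ (ys ∷ yt ∷ ya ∷ []) ∷ (st ∷ sa ∷ []) ∷ (ta ∷ []) ∷ [] ∷ [] =
        face2 {V} ((xs ∷ xy≢ ∷ xt ∷ []) ∷ (≢-sym ys ∷ st ∷ []) ∷ (yt ∷ []) ∷ [] ∷ []) (x∈ ∷ s∈ ∷ y∈ ∷ t∈ ∷ []) ∷
        face2 {V} ((yt ∷ ys ∷ ya ∷ []) ∷ (≢-sym st ∷ ta ∷ []) ∷ (sa ∷ []) ∷ [] ∷ []) (y∈ ∷ t∈ ∷ s∈ ∷ a∈ ∷ []) ∷
        face2 {V} ((sa ∷ ≢-sym xs ∷ ≢-sym ys ∷ []) ∷ (≢-sym xa ∷ ≢-sym ya ∷ []) ∷ (xy≢ ∷ []) ∷ [] ∷ []) (s∈ ∷ a∈ ∷ x∈ ∷ y∈ ∷ []) ∷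
        face2 {V} ((xy≢ ∷ xt ∷ xa ∷ []) ∷ (yt ∷ ya ∷ []) ∷ (ta ∷ []) ∷ [] ∷ []) (x∈ ∷ y∈ ∷ t∈ ∷ a∈ ∷ []) ∷
        face2 {V} ((ta ∷ ≢-sym xt ∷ ≢-sym st ∷ []) ∷ (≢-sym xa ∷ ≢-sym sa ∷ []) ∷ (xs ∷ []) ∷ [] ∷ []) (t∈ ∷ a∈ ∷ x∈ ∷ s∈ ∷ []) ∷ []
        where
        x∈ : x ∈ V
        x∈ = here ≡.refl
        y∈ : y ∈ V
        y∈ = there (here ≡.refl)
        s∈ : s ∈ V
        s∈ = there (there (here ≡.refl))
        t∈ : t ∈ V
        t∈ = there (there (there (here ≡.refl)))
        a∈ : a ∈ V
        a∈ = there (there (there (there (here ≡.refl))))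
      cycle-pent : Cycle V 2 (pentagon A B C D E)
      cycle-pent = on-pent , closed (exact (λ φ _ → ⟦∂pentagon⟧ A B C D E φ))
      a∈R : a ∈ R
      a∈R = ↭P.∈-resp-↭ R↭ (here ≡.refl)
      W⊆R : ∀ {v} → v ∈ W → v ∈ R
      W⊆R v∈ = ↭P.∈-resp-↭ R↭ (there v∈)
      -- In the order of `pentagonRest`: yt ∧ sa avoids `x`, the next two terms contain `xy`, and ta
      -- ∧ xs avoids `y`.
      undiv : ∀ {σ} → Face W e σ → All (λ t → Undivided (proj₂ t ++ σ)) (pentagonRest A B C D E)
      undiv {σ} F = inj₁ (∉-mk {a = y} {t} {C ∷ σ} x≢y x≢t (∉-mk {a = s} {a} {σ} x≢s x≢a x∉))
              ∷ inj₂ (inj₂ (there (here ≡.refl))) ∷ inj₂ (inj₂ (here ≡.refl))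
              ∷ inj₂ (inj₁ (∉-mk {a = t} {a} {A ∷ σ} y≢t y≢a (∉-mk {a = x} {s} {σ} (≢-sym x≢y) y≢s y∉))) ∷ []
        where
        x∉ = ∉-face {τ = σ} (x∉R ∘ W⊆R) F
        y∉ = ∉-face {τ = σ} (y∉R ∘ W⊆R) F
        x≢a : x ≢ a
        x≢a ≡.refl = x∉R a∈R
        y≢a : y ≢ a
        y≢a ≡.refl = y∉R a∈R
      decomposition : f ∙ g ∙ d ≋ wedge (pentagon A B C D E) w ++ scale -1ℤ (wedge (pentagonRest A B C D E) w)
      decomposition = ≋-trans (∙-cong f (∙-cong g d≋w)) (exact (λ φ _ → ≡.trans (⟦∙∙⟧ w φ)
        (≡.trans (lem (⟦ w ⟧ (λ τ → φ (f ∷ g ∷ τ))) (⟦ pentagonRest A B C D E ⟧ (λ σ → ⟦ w ⟧ (λ τ → φ (σ ++ τ)))))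
        (sym (≡.trans (⟦⟧-++ (wedge (pentagon A B C D E) w) _ φ) (cong₂ _+ℤ_ (⟦⟧-wedge (pentagon A B C D E) w φ)
          (≡.trans (⟦⟧-scale -1ℤ (wedge (pentagonRest A B C D E) w) φ) (cong (-1ℤ *ℤ_) (⟦⟧-wedge (pentagonRest A B C D E) w φ)))))))))
        where
        lem : ∀ a b → a ≡ 1ℤ *ℤ a +ℤ b +ℤ -1ℤ *ℤ b
        lem = solve-∀

    -- By Leibniz, f ∧ g ∧ ∂b = ∂(f ∧ g ∧ b) - g ∧ b + f ∧ b, and the last two products avoid `x`
    -- and `y` respectively.
    lift-bdry : ∀ {b} → On R (suc e) b → Lifted (∂ b)
    lift-bdry {b} o = lifted (bdry on-fgb)
      (On-++ (On-scale -1ℤ (On-mono g-mono on-gb)) (On-mono f-mono on-fb))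
      (AllP.++⁺ (AllP.map⁺ (AllP.map⁺ (All.map (λ {u} F → inj₁ (∉-mk {a = y} {t} {proj₂ u} x≢y x≢t (∉-face x∉R F))) o)))
                (AllP.map⁺ (All.map (λ {u} F → inj₂ (inj₁ (∉-mk {a = x} {s} {proj₂ u} (≢-sym x≢y) y≢s (∉-face y∉R F)))) o)))
      (exact (λ φ _ → ≡.trans (⟦∙∙⟧ (∂ b) φ)
        (≡.trans (lem (⟦ ∂ b ⟧ (λ τ → φ (f ∷ g ∷ τ))) (⟦ b ⟧ (φ ∘ (f ∷_))) (⟦ b ⟧ (φ ∘ (g ∷_))))
        (sym (≡.trans (⟦⟧-++ (∂ (f ∙ g ∙ b)) _ φ) (cong₂ _+ℤ_
          (≡.trans (⟦∂∙⟧ f (g ∙ b) φ) (cong₂ _-ℤ_ (⟦∙⟧ g b φ) (⟦∂∙⟧ g b (φ ∘ (f ∷_)))))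
          (≡.trans (⟦⟧-++ (scale -1ℤ (g ∙ b)) (f ∙ b) φ) (cong₂ _+ℤ_
            (≡.trans (⟦⟧-scale -1ℤ (g ∙ b) φ) (cong (-1ℤ *ℤ_) (⟦∙⟧ g b φ))) (⟦∙⟧ f b φ)))))))))
      where
      lem : ∀ a b c → a ≡ c -ℤ (b -ℤ a) +ℤ (-1ℤ *ℤ c +ℤ b)
      lem = solve-∀
      u-ytR : Unique (y ∷ t ∷ R)
      u-ytR with AllPairs.tail u-xyst
      ... | (_ ∷ h) ∷ _ ∷ u = h ∷ u
      u-xsR : Unique (x ∷ s ∷ R)
      u-xsR with u-xyst
      ... | (_ ∷ h ∷ _ ∷ h') ∷ _ ∷ (_ ∷ k) ∷ _ ∷ u = (h ∷ h') ∷ k ∷ u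
      on-gb : On (y ∷ t ∷ R) (suc (suc e)) (g ∙ b)
      on-gb = On-∙ u-ytR o
      on-fb : On (x ∷ s ∷ R) (suc (suc e)) (f ∙ b)
      on-fb = On-∙ u-xsR o
      xsyt↭ : x ∷ s ∷ y ∷ t ∷ R ↭ S
      xsyt↭ = trans (prep x (swap s y refl)) (↭-sym xyst↭)
      on-fgb : On S (suc (suc (suc e))) (f ∙ g ∙ b)
      on-fgb = On-↭ xsyt↭ (On-∙ (Unique-↭ (↭-sym xsyt↭) uniq) on-gb)
      g-mono : ∀ {v} → v ∈ y ∷ t ∷ R → v ∈ S
      g-mono v∈ = ↭P.∈-resp-↭ xsyt↭ (there (there v∈))
      f-mono : ∀ {v} → v ∈ x ∷ s ∷ R → v ∈ S
      f-mono (here v≡) = here v≡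
      f-mono (there (here v≡)) = ↭P.∈-resp-↭ xsyt↭ (there (here v≡))
      f-mono (there (there v∈)) = ↭P.∈-resp-↭ xsyt↭ (there (there (there (there v∈))))

    lift-span : ∀ {d} → Span R e (Pointed e P R) d → Lifted d
    lift-span (gen c m) = lift-pointed m
    lift-span (bdry o) = lift-bdry o
    lift-span zero = lifted zero [] [] ≋-refl
    lift-span (add {z} {w} m n) with lift-span m | lift-span n
    ... | lifted {G} {N} sG oN uN eG | lifted {G'} {N'} sG' oN' uN' eG' = lifted {main = G ++ G'} {N ++ N'} (add sG sG') (On-++ oN oN') (AllP.++⁺ uN uN')
      λ where .at φ A → ≡ₚ-trans (≡⇒≡ₚ (≡.trans (⟦∙∙⟧ (z ++ w) φ) (≡.trans (⟦⟧-++ z w _) (sym (cong₂ _+ℤ_ (⟦∙∙⟧ z φ) (⟦∙∙⟧ w φ))))))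
                (≡ₚ-trans (+-congₚ (eG .at φ A) (eG' .at φ A)) (≡⇒≡ₚ (≡.trans (cong₂ _+ℤ_ (⟦⟧-++ G N φ) (⟦⟧-++ G' N' φ))
                  (≡.trans (lem (⟦ G ⟧ φ) (⟦ N ⟧ φ) (⟦ G' ⟧ φ) (⟦ N' ⟧ φ))
                  (sym (≡.trans (⟦⟧-++ (G ++ G') (N ++ N') φ) (cong₂ _+ℤ_ (⟦⟧-++ G G' φ) (⟦⟧-++ N N' φ))))))))
      where
      lem : ∀ a b c d → a +ℤ b +ℤ (c +ℤ d) ≡ a +ℤ c +ℤ (b +ℤ d)
      lem = solve-∀
    lift-span (smul k {z} m) with lift-span m
    ... | lifted {G} {N} sG oN uN eG = lifted {main = scale k G} {scale k N} (smul k sG) (On-scale k oN) (AllP.map⁺ uN)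
      λ where .at φ A → ≡ₚ-trans (≡⇒≡ₚ (≡.trans (⟦∙∙⟧ (scale k z) φ) (≡.trans (⟦⟧-scale k z _) (cong (k *ℤ_) (sym (⟦∙∙⟧ z φ))))))
                (≡ₚ-trans (*-congₚ k (eG .at φ A)) (≡⇒≡ₚ (≡.trans (cong (k *ℤ_) (⟦⟧-++ G N φ)) (≡.trans (ℤP.*-distribˡ-+ k (⟦ G ⟧ φ) (⟦ N ⟧ φ))
                  (sym (≡.trans (⟦⟧-++ (scale k G) (scale k N) φ) (cong₂ _+ℤ_ (⟦⟧-scale k G φ) (⟦⟧-scale k N φ))))))))
    lift-span (resp r m) with lift-span m
    ... | lifted sG oN uN eG = lifted sG oN uN (≋-trans (∙-cong f (∙-cong g r)) eG)

-- Generation by triangles and pentagons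

module Generation (p : ℕ) (x y : ℕ) (S' : List ℕ) (uniq : Unique (x ∷ y ∷ S')) where
  open Spans p
  open TwoVertices p
  open Pair x y S' uniq
  open StageTwo p x y S' uniq
  open StageOne p x y S' uniq

  -- Recursion over the pairs (s,t) that may still occur. Treating one pair adds only undivided
  -- terms, so earlier pairs do not return. A pair with s = t is dropped, since no matching contains
  -- both xs and ys.
  stage-one : ∀ {e} {P : Family} {Q : Chain → Set} →
    (∀ {z} → Joined 3 1 (suc e) Any S z → Q z) → (∀ {z} → Joined 5 2 e P S z → Q z) →
    (∀ {s t R} → S' ↭ s ∷ t ∷ R → ∀ {d} → Cycle R e d → Span R e (Pointed e P R) d) →
    ∀ L → (∀ {s t} → (s , t) ∈ L → s ∈ S' × t ∈ S') →
    ∀ {z} → Cycle S (suc (suc e)) z → All (Dividing L ∘ proj₂) z → Span S (suc (suc e)) Q z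
  stage-one triple pent hyp [] L⊆ cz inv =
    stage-two triple cz (All.map (λ { (inj₁ u) → u ; (inj₂ (_ , () , _)) }) inv)
  stage-one triple pent hyp ((s , t) ∷ L) L⊆ {z} (oz , cz) inv with s ℕ.≟ t
  ... | yes ≡.refl = stage-one triple pent hyp L (L⊆ ∘ there) (oz , cz) (All.zipWith (λ { (F , i) → shorten F i }) (oz , inv))
    where
    s≢x : s ≢ x
    s≢x ≡.refl = x∉S' (proj₁ (L⊆ (here ≡.refl)))
    shorten : ∀ {d σ} → Face S d σ → Dividing ((s , s) ∷ L) σ → Dividing L σ
    shorten F (inj₁ u) = inj₁ u
    shorten F (inj₂ (st , there st∈ , h)) = inj₂ (st , st∈ , h)
    shorten {σ = σ} F (inj₂ (_ , here ≡.refl , f∈ , g∈)) = contradiction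
      (mk-cancel s s≢x (mk-injective (distinct F) (subst (_∈ σ) (mk-comm x s) f∈) (subst (_∈ σ) (mk-comm y s) g∈))) x≢y
  ... | no s≢t = subgoal (pick (proj₁ (L⊆ (here ≡.refl))))
    where
    subgoal : ∃ (λ R → S' ↭ s ∷ R) → Span S _ _ z
    subgoal (R₁ , S'↭₁) with ↭P.∈-resp-↭ S'↭₁ (proj₂ (L⊆ (here ≡.refl)))
    ... | here t≡s = contradiction (sym t≡s) s≢t
    ... | there t∈R₁ with pick t∈R₁
    ... | R , R₁↭ = descend (lift-span pent S'↭ (hyp S'↭ cycle-d))
      where
      S'↭ : S' ↭ s ∷ t ∷ R
      S'↭ = trans S'↭₁ (prep s R₁↭)
      S↭ : S ↭ x ∷ s ∷ y ∷ t ∷ R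
      S↭ = trans (prep x (prep y S'↭)) (prep x (swap y s refl))
      f g : Edge
      f = mk x s
      g = mk y t
      b d : Chain
      b = con f z
      d = con g b
      cycle-b : Cycle (y ∷ t ∷ R) _ b
      cycle-b = On-con S↭ oz , Closed-con f cz
      cycle-d : Cycle R _ d
      cycle-d = On-con refl (proj₁ cycle-b) , Closed-con g (proj₂ cycle-b)
      x≢s : x ≢ s
      x≢s ≡.refl = x∉S' (proj₁ (L⊆ (here ≡.refl)))
      y≢s : y ≢ s
      y≢s ≡.refl = y∉S' (proj₁ (L⊆ (here ≡.refl)))
      g≢f : g ≢ f
      g≢f = mk-∉ f λ y∈ → y∉xs (↭P.∈-resp-↭ (mk-↭ x s) y∈)
        where
        y∉xs : y ∉ x ∷ s ∷ []
        y∉xs (here y≡x) = x≢y (sym y≡x)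
        y∉xs (there (here y≡s)) = y≢s y≡s
      keep-z : ∀ {σ} → Dividing ((s , t) ∷ L) σ × f ∉ σ → Dividing L σ
      keep-z (inj₁ u , _) = inj₁ u
      keep-z (inj₂ (_ , here ≡.refl , f∈ , _) , f∉) = contradiction f∈ f∉
      keep-z (inj₂ (st , there st∈ , h) , _) = inj₂ (st , st∈ , h)
      keep-b : ∀ {τ} → Dividing ((s , t) ∷ L) (f ∷ τ) × g ∉ τ → Dividing L (f ∷ τ)
      keep-b (inj₁ u , _) = inj₁ u
      keep-b (inj₂ (_ , here ≡.refl , _ , here g≡f) , _) = contradiction g≡f g≢f
      keep-b (inj₂ (_ , here ≡.refl , _ , there g∈) , g∉) = contradiction g∈ g∉
      keep-b (inj₂ (st , there st∈ , h) , _) = inj₂ (st , st∈ , h)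
      -- The terms of `z` that do not contain both `f` and `g`: those without `f`, and `f` times the
      -- part of its coefficient without `g`.
      z₁ : Chain
      z₁ = without f z ++ f ∙ without g b
      on-z₁ : On S _ z₁
      on-z₁ = On-++ (All.map proj₁ (All-without f oz))
        (On-↭ (↭-sym S↭) (On-∙ (Unique-↭ S↭ uniq) (All.map proj₁ (All-without g (proj₁ cycle-b)))))
      inv-z₁ : All (Dividing L ∘ proj₂) z₁
      inv-z₁ = AllP.++⁺ (All.map keep-z (All-without f inv))
        (AllP.map⁺ (All.map keep-b (All-without {Q = λ τ → Dividing ((s , t) ∷ L) (f ∷ τ)} g (All-con f Dividing-↭ inv))))
      z≋ : z ≋ z₁ ++ f ∙ g ∙ d
      z≋ = exact (λ φ A → ≡.trans (⟦split⟧ f A oz)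
        (≡.trans (cong (⟦ without f z ⟧ φ +ℤ_) (≡.trans (⟦∙⟧ f b φ) (≡.trans (⟦split⟧ g (Alternating-∷ f A) (proj₁ cycle-b))
          (cong₂ _+ℤ_ (sym (⟦∙⟧ f (without g b) φ)) (sym (⟦∙⟧ f (g ∙ d) φ))))))
        (≡.trans (sym (ℤP.+-assoc (⟦ without f z ⟧ φ) (⟦ f ∙ without g b ⟧ φ) (⟦ f ∙ g ∙ d ⟧ φ)))
        (sym (≡.trans (⟦⟧-++ z₁ (f ∙ g ∙ d) φ) (cong (_+ℤ ⟦ f ∙ g ∙ d ⟧ φ) (⟦⟧-++ (without f z) (f ∙ without g b) φ)))))))
      descend : Lifted pent S'↭ d → Span S _ _ z
      descend (lifted {M} {N} span-M on-N und-N lift) = resp z≋M (add span-M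
        (stage-one triple pent hyp L (L⊆ ∘ there) (On-++ on-z₁ on-N , Closed-summand z≋M cz (span-closed span-M))
          (AllP.++⁺ inv-z₁ (All.map inj₁ und-N))))
        where
        z≋M : z ≋ M ++ z₁ ++ N
        z≋M = ≋-trans z≋ (≋-trans (++-cong (≋-refl {z₁}) lift) (exact (λ φ _ →
          ≡.trans (≡.trans (⟦⟧-++ z₁ (M ++ N) φ) (cong (⟦ z₁ ⟧ φ +ℤ_) (⟦⟧-++ M N φ)))
          (≡.trans (lem (⟦ z₁ ⟧ φ) (⟦ M ⟧ φ) (⟦ N ⟧ φ))
          (sym (≡.trans (⟦⟧-++ M (z₁ ++ N) φ) (cong (⟦ M ⟧ φ +ℤ_) (⟦⟧-++ z₁ N φ))))))))
          where
          lem : ∀ a b c → a +ℤ (b +ℤ c) ≡ b +ℤ (a +ℤ c)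
          lem = solve-∀

  -- The index `e` is one less than the number of edges. A single edge cannot put `x` and `y` on
  -- different edges, so the hypotheses about pentagons and coefficients start at two edges.
  generation : ∀ e {P : Family} {Q : Chain → Set} →
    (∀ {z} → Joined 3 1 e Any S z → Q z) →
    (∀ {e'} → e ≡ suc e' → ∀ {z} → Joined 5 2 e' P S z → Q z) →
    (∀ {e' R d} → e ≡ suc e' → Unique R → 4 ℕ.+ length R ≡ length S → Cycle R e' d → Span R e' (Pointed e' P R) d) →
    ∀ {z} → Cycle S (suc e) z → Span S (suc e) Q z
  generation zero triple pent hyp {z} cz = stage-two triple cz (All.map undivided (proj₁ cz))
    where
    undivided : ∀ {σ} → Face S 1 σ → Undivided σ
    undivided F with dividing F
    ... | inj₁ u = u
    undivided {e ∷ []} F | inj₂ ((s , t) , st∈ , here f≡ , here g≡) =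
      contradiction (≡.trans g≡ (sym f≡)) (mk-∉ (mk x s) λ y∈ → y∉xs (↭P.∈-resp-↭ (mk-↭ x s) y∈))
      where
      y∉xs : y ∉ x ∷ s ∷ []
      y∉xs (here y≡x) = x≢y (sym y≡x)
      y∉xs (there (here ≡.refl)) = y∉S' (proj₁ (∈-cartesianProduct⁻ S' S' st∈))
    undivided {e ∷ e' ∷ σ} F | inj₂ _ with size F
    ... | ()
  generation (suc e) triple pent hyp cz = stage-one triple (pent ≡.refl)
    (λ {s} {t} {R} p cd → hyp ≡.refl (uR p) (cong (λ n → suc (suc n)) (sym (↭P.↭-length p))) cd)
    (cartesianProduct S' S') (∈-cartesianProduct⁻ S' S') cz (All.map dividing (proj₁ cz))
    where
    uR : ∀ {s t R} → S' ↭ s ∷ t ∷ R → Unique R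
    uR p = AllPairs.tail (AllPairs.tail (Unique-↭ p (AllPairs.tail (AllPairs.tail uniq))))

-- Deciding properties of explicit chains

face? : ∀ S d σ → Dec (Face S d σ)
face? S d σ = map′ (λ (o , i , u , l) → face o i u l) (λ F → ordered F , inside F , distinct F , size F)
  (All.all? (λ e → proj₁ e ℕ.<? proj₂ e) σ ×-dec All.all? (_∈? S) (vertices σ) ×-dec
   allPairs? (λ a b → ¬? (a ℕ.≟ b)) (vertices σ) ×-dec (length σ ℕ.≟ d))

On? : ∀ S d c → Dec (On S d c)
On? S d = All.all? (λ t → face? S d (proj₂ t))

-- Testing only the simplices that occur in the chain keeps this a finite computation; by
-- `⟦⟧-vanishes` it suffices for all pairings.
Null : Chain → Set
Null c = All (λ t → coeff c (proj₂ t) ≡ 0ℤ) c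

null? : ∀ c → Dec (Null c)
null? c = All.all? (λ t → coeff c (proj₂ t) ℤ.≟ 0ℤ) c

nth : List ℕ → ℕ → ℕ
nth [] i = 0
nth (x ∷ xs) zero = x
nth (x ∷ xs) (suc i) = nth xs i

nth∈ : ∀ xs {i} → i ℕ.< length xs → nth xs i ∈ xs
nth∈ (x ∷ xs) {zero} _ = here ≡.refl
nth∈ (x ∷ xs) {suc i} (ℕ.s≤s i<) = there (nth∈ xs i<)

nth-injective : ∀ {xs} → Unique xs → ∀ {i j} → i ℕ.< length xs → j ℕ.< length xs → nth xs i ≡ nth xs j → i ≡ j
nth-injective (x∉ ∷ u) {zero} {zero} i< j< eq = ≡.refl
nth-injective {x ∷ xs} (x∉ ∷ u) {zero} {suc j} i< (ℕ.s≤s j<) eq = contradiction eq (All.lookup x∉ (nth∈ xs j<))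
nth-injective {x ∷ xs} (x∉ ∷ u) {suc i} {zero} (ℕ.s≤s i<) j< eq = contradiction (sym eq) (All.lookup x∉ (nth∈ xs i<))
nth-injective (x∉ ∷ u) {suc i} {suc j} (ℕ.s≤s i<) (ℕ.s≤s j<) eq = cong suc (nth-injective u i< j< eq)

-- Transport of chains along a labelling of vertices

module Relabel (V : List ℕ) (uniq : Unique V) where

  v : ℕ → ℕ
  v = nth V

  relabel : Edge → Edge
  relabel (i , j) = mk (v i) (v j)

  push : Chain → Chain
  push = map (λ t → proj₁ t , map relabel (proj₂ t))

  ⟦push⟧ : ∀ c φ → ⟦ push c ⟧ φ ≡ ⟦ c ⟧ (φ ∘ map relabel)
  ⟦push⟧ [] φ = ≡.refl
  ⟦push⟧ ((k , σ) ∷ c) φ = cong (k *ℤ φ (map relabel σ) +ℤ_) (⟦push⟧ c φ)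

  δ-relabel : ∀ φ σ → δ φ (map relabel σ) ≡ δ (φ ∘ map relabel) σ
  δ-relabel φ [] = ≡.refl
  δ-relabel φ (e ∷ σ) = cong (1ℤ *ℤ φ (map relabel σ) -ℤ_) (δ-relabel (φ ∘ (relabel e ∷_)) σ)

  ⟦∂push⟧ : ∀ c φ → ⟦ ∂ (push c) ⟧ φ ≡ ⟦ push (∂ c) ⟧ φ
  ⟦∂push⟧ c φ = ≡.trans (⟦∂⟧ (push c) φ) (≡.trans (⟦push⟧ c (δ φ)) (≡.trans (⟦⟧-ext c (δ-relabel φ))
    (≡.trans (sym (⟦∂⟧ c (φ ∘ map relabel))) (sym (⟦push⟧ (∂ c) φ)))))

  EdgeLabel : Edge → Set
  EdgeLabel e = proj₁ e ℕ.< proj₂ e × proj₂ e ℕ.< length V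

  relabel-injective : ∀ {e f} → EdgeLabel e → EdgeLabel f → relabel e ≡ relabel f → e ≡ f
  relabel-injective {i , j} {k , l} (i<j , j<) (k<l , l<) eq
    with ↭P.∈-resp-↭ (mk-↭ (v k) (v l) {[]}) (subst (λ e → v i ∈ proj₁ e ∷ proj₂ e ∷ []) eq (↭P.∈-resp-↭ (↭-sym (mk-↭ (v i) (v j))) (here ≡.refl)))
       | ↭P.∈-resp-↭ (mk-↭ (v k) (v l) {[]}) (subst (λ e → v j ∈ proj₁ e ∷ proj₂ e ∷ []) eq (↭P.∈-resp-↭ (↭-sym (mk-↭ (v i) (v j))) (there (here ≡.refl))))
  ... | here p | there (here q) =
    cong₂ _,_ (nth-injective uniq (ℕP.<-trans i<j j<) (ℕP.<-trans k<l l<) p) (nth-injective uniq j< l< q)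
  ... | here p | here q = contradiction (nth-injective uniq (ℕP.<-trans i<j j<) j< (≡.trans p (sym q))) (ℕP.<⇒≢ i<j)
  ... | there (here p) | there (here q) = contradiction (nth-injective uniq (ℕP.<-trans i<j j<) j< (≡.trans p (sym q))) (ℕP.<⇒≢ i<j)
  ... | there (here p) | here q
    with nth-injective uniq (ℕP.<-trans i<j j<) l< p | nth-injective uniq j< (ℕP.<-trans k<l l<) q
  ... | ≡.refl | ≡.refl = contradiction i<j (ℕP.<-asym k<l)

  relabel-alternating : ∀ {φ} → Alternating φ → AlternatingOn EdgeLabel (φ ∘ map relabel)
  relabel-alternating A (here e≢f) (le ∷ lf ∷ _) = A (here (e≢f ∘ relabel-injective le lf))
  relabel-alternating A (there {e} s) (_ ∷ ls) = relabel-alternating (Alternating-∷ (relabel e) A) s ls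

  vertices-relabel : ∀ σ → vertices (map relabel σ) ↭ map v (vertices σ)
  vertices-relabel [] = refl
  vertices-relabel ((i , j) ∷ σ) = trans (mk-↭ (v i) (v j)) (prep (v i) (prep (v j) (vertices-relabel σ)))

  Unique-map : ∀ {is} → All (ℕ._< length V) is → Unique is → Unique (map v is)
  Unique-map [] [] = []
  Unique-map (i< ∷ is<) (i∉ ∷ u) =
    AllP.map⁺ (All.zipWith (λ (j< , i≢j) eq → i≢j (nth-injective uniq i< j< eq)) (is< , i∉)) ∷ Unique-map is< u

  Face-relabel : ∀ {I d σ} → All (ℕ._< length V) I → Face I d σ → Face (map v I) d (map relabel σ)
  Face-relabel {I} {d} {σ} I< (face o i u l) = face
    (go o (All.map (All.lookup I<) i))
    (↭P.All-resp-↭ (↭-sym (vertices-relabel σ)) (AllP.map⁺ (All.map (∈-map⁺ v) i)))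
    (Unique-↭ (↭-sym (vertices-relabel σ)) (Unique-map (All.map (All.lookup I<) i) u))
    (≡.trans (length-map relabel σ) l)
    where
    go : ∀ {σ} → All (λ e → proj₁ e ℕ.< proj₂ e) σ → All (ℕ._< length V) (vertices σ) → All (λ e → proj₁ e ℕ.< proj₂ e) (map relabel σ)
    go [] [] = []
    go (i<j ∷ o) (i< ∷ j< ∷ b) = mk-ordered (ℕP.<⇒≢ i<j ∘ nth-injective uniq i< j<) ∷ go o b

  On-push : ∀ {I d c} → All (ℕ._< length V) I → On I d c → On (map v I) d (push c)
  On-push I< o = AllP.map⁺ (All.map (Face-relabel I<) o)

  EdgeLabels : Chain → Set
  EdgeLabels = All (All EdgeLabel ∘ proj₂)

  edgeLabels? : ∀ c → Dec (EdgeLabels c)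
  edgeLabels? = All.all? (λ t → All.all? (λ e → (proj₁ e ℕ.<? proj₂ e) ×-dec (proj₂ e ℕ.<? length V)) (proj₂ t))

  module _ (p : ℕ) where
    open Spans p

    -- An identity computed once on the labels 0, 1, 2, ... thereby holds for any choice of distinct
    -- vertices.
    push-null : ∀ {c} → EdgeLabels c → Null c → push c ≋ []
    push-null {c} ls n .at φ A = ≡ₚ-trans (≡⇒≡ₚ (⟦push⟧ c φ))
      (⟦⟧-vanishes {EdgeLabel} {φ ∘ map relabel} (relabel-alternating A) c ls (All.map ≡⇒≡ₚ n))

-- Products of two triangle cycles on six and seven vertices

arm : ℕ → ℕ → ℕ → Chain
arm u v w = (1ℤ , mk u w ∷ []) ∷ (-1ℤ , mk u v ∷ []) ∷ []

pentagonAt : (x y s t a : ℕ) → Chain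
pentagonAt x y s t a = pentagon (mk x s) (mk y t) (mk s a) (mk x y) (mk t a)

arms : Chain
arms = wedge (arm 0 1 2) (arm 3 4 5)

-- Three times the product of two arms is a sum of 1-cycles P_i of M₆ missing the vertex i plus the boundary
-- of filling₆, and in M₇ it is the boundary of filling₇; both were found by linear algebra.

P₁ P₂ P₄ P₅ filling₆ filling₇ : Chain
P₁ = scale (+ 2) (pentagonAt 0 2 4 5 3)
P₂ = pentagonAt 0 1 5 3 4 ++ scale -1ℤ (pentagonAt 0 1 4 3 5)
P₄ = pentagonAt 0 1 5 2 3 ++ scale -1ℤ (pentagonAt 0 1 5 3 2) ++ scale -1ℤ (pentagonAt 0 1 2 3 5)
P₅ = pentagonAt 0 2 4 1 3
filling₆ =
  (-[1+ 0 ] , (0 , 5) ∷ (1 , 2) ∷ (3 , 4) ∷ []) ∷ (-[1+ 0 ] , (0 , 4) ∷ (1 , 2) ∷ (3 , 5) ∷ []) ∷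
  (-[1+ 1 ] , (0 , 1) ∷ (2 , 5) ∷ (3 , 4) ∷ []) ∷ (+ 2 , (0 , 4) ∷ (1 , 3) ∷ (2 , 5) ∷ []) ∷ []
filling₇ =
  (-[1+ 1 ] , (0 , 1) ∷ (2 , 5) ∷ (3 , 4) ∷ []) ∷ (+ 2 , (0 , 1) ∷ (2 , 5) ∷ (4 , 6) ∷ []) ∷
  (-[1+ 0 ] , (0 , 1) ∷ (2 , 6) ∷ (3 , 4) ∷ []) ∷ (+ 1 , (0 , 1) ∷ (2 , 6) ∷ (3 , 5) ∷ []) ∷
  (-[1+ 1 ] , (0 , 1) ∷ (3 , 5) ∷ (4 , 6) ∷ []) ∷ (+ 2 , (0 , 2) ∷ (1 , 5) ∷ (3 , 4) ∷ []) ∷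
  (-[1+ 1 ] , (0 , 2) ∷ (1 , 5) ∷ (4 , 6) ∷ []) ∷ (+ 1 , (0 , 2) ∷ (1 , 6) ∷ (3 , 4) ∷ []) ∷
  (-[1+ 0 ] , (0 , 2) ∷ (1 , 6) ∷ (3 , 5) ∷ []) ∷ (+ 2 , (0 , 2) ∷ (3 , 5) ∷ (4 , 6) ∷ []) ∷
  (-[1+ 0 ] , (0 , 3) ∷ (1 , 4) ∷ (2 , 5) ∷ []) ∷ (+ 1 , (0 , 3) ∷ (1 , 4) ∷ (2 , 6) ∷ []) ∷
  (-[1+ 0 ] , (0 , 3) ∷ (1 , 5) ∷ (2 , 4) ∷ []) ∷ (-[1+ 0 ] , (0 , 3) ∷ (1 , 5) ∷ (2 , 6) ∷ []) ∷
  (+ 2 , (0 , 3) ∷ (1 , 5) ∷ (4 , 6) ∷ []) ∷ (+ 1 , (0 , 3) ∷ (1 , 6) ∷ (2 , 4) ∷ []) ∷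
  (-[1+ 0 ] , (0 , 3) ∷ (1 , 6) ∷ (2 , 5) ∷ []) ∷ (-[1+ 1 ] , (0 , 3) ∷ (2 , 5) ∷ (4 , 6) ∷ []) ∷
  (+ 1 , (0 , 6) ∷ (1 , 4) ∷ (2 , 5) ∷ []) ∷ (-[1+ 0 ] , (0 , 6) ∷ (1 , 4) ∷ (3 , 5) ∷ []) ∷
  (+ 1 , (0 , 6) ∷ (1 , 5) ∷ (2 , 4) ∷ []) ∷ (-[1+ 0 ] , (0 , 6) ∷ (1 , 5) ∷ (3 , 4) ∷ []) ∷
  (+ 1 , (0 , 6) ∷ (2 , 4) ∷ (3 , 5) ∷ []) ∷ (+ 1 , (0 , 6) ∷ (2 , 5) ∷ (3 , 4) ∷ []) ∷
  (-[1+ 0 ] , (1 , 4) ∷ (2 , 6) ∷ (3 , 5) ∷ []) ∷ (+ 1 , (1 , 5) ∷ (2 , 6) ∷ (3 , 4) ∷ []) ∷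
  (-[1+ 0 ] , (1 , 6) ∷ (2 , 4) ∷ (3 , 5) ∷ []) ∷ (+ 1 , (1 , 6) ∷ (2 , 5) ∷ (3 , 4) ∷ []) ∷ []

missing : Chain
missing = P₁ ++ P₂ ++ P₄ ++ P₅

discrepancy₆ discrepancy₇ : Chain
discrepancy₆ = scale (+ 3) arms ⊖ (missing ++ ∂ filling₆)
discrepancy₇ = scale (+ 3) arms ⊖ ∂ filling₇

null₆ : Null discrepancy₆
null₆ = toWitness {a? = null? discrepancy₆} tt

null₇ : Null discrepancy₇
null₇ = toWitness {a? = null? discrepancy₇} tt

-- The two facts that need 3 to be invertible

module Local (p : ℕ) where
  open Spans p
  open TwoVertices p using (Any)

  ⟦⟧-⊖-null : ∀ {c d} (ψ : Cochain) → ⟦ c ⊖ d ⟧ ψ ≡ₚ 0ℤ → ⟦ c ⟧ ψ ≡ₚ ⟦ d ⟧ ψ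
  ⟦⟧-⊖-null {c} {d} ψ h = -ₚ⇒≡ₚ (subst (_≡ₚ 0ℤ) (⟦⟧-⊖ c d ψ) h)

  module _ {v₀ v₁ v₂ v₃ v₄ v₅ : ℕ} (uniq : Unique (v₀ ∷ v₁ ∷ v₂ ∷ v₃ ∷ v₄ ∷ v₅ ∷ [])) where
    private
      V : List ℕ
      V = v₀ ∷ v₁ ∷ v₂ ∷ v₃ ∷ v₄ ∷ v₅ ∷ []
      open Relabel V uniq

      label< : ∀ I → {True (All.all? (ℕ._<? 6) I)} → All (ℕ._< 6) I
      label< I {t} = toWitness t

      missing-cycle : ∀ I P → {True (All.all? (ℕ._<? 6) I)} → {True (On? I 2 P)} →
        {True (edgeLabels? (∂ P))} → {True (null? (∂ P))} → Cycle (map v I) 2 (push P)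
      missing-cycle I P {i} {o} {l} {n} = On-push (toWitness i) (toWitness {a? = On? I 2 P} o) ,
        closed (≋-trans (exact (λ φ _ → ⟦∂push⟧ P φ)) (push-null p (toWitness {a? = edgeLabels? (∂ P)} l) (toWitness {a? = null? (∂ P)} n)))

      missing-gen : ∀ {w} I P → w ∷ map v I ↭ V → Cycle (map v I) 2 (push P) → Span V 2 (Pointed 2 Any V) (push P)
      missing-gen I P q c = gen (Cycle-mono (λ v∈ → ↭P.∈-resp-↭ q (there v∈)) c) (pointed q c tt ≋-refl)

      missing-span : Span V 2 (Pointed 2 Any V) (push P₁ ++ push P₂ ++ push P₄ ++ push P₅)
      missing-span =
        add (missing-gen (0 ∷ 2 ∷ 3 ∷ 4 ∷ 5 ∷ []) P₁ (↭-sym (↭P.shift v₁ (v₀ ∷ []) _)) (missing-cycle (0 ∷ 2 ∷ 3 ∷ 4 ∷ 5 ∷ []) P₁))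
        (add (missing-gen (0 ∷ 1 ∷ 3 ∷ 4 ∷ 5 ∷ []) P₂ (↭-sym (↭P.shift v₂ (v₀ ∷ v₁ ∷ []) _)) (missing-cycle (0 ∷ 1 ∷ 3 ∷ 4 ∷ 5 ∷ []) P₂))
        (add (missing-gen (0 ∷ 1 ∷ 2 ∷ 3 ∷ 5 ∷ []) P₄ (↭-sym (↭P.shift v₄ (v₀ ∷ v₁ ∷ v₂ ∷ v₃ ∷ []) _)) (missing-cycle (0 ∷ 1 ∷ 2 ∷ 3 ∷ 5 ∷ []) P₄))
        (missing-gen (0 ∷ 1 ∷ 2 ∷ 3 ∷ 4 ∷ []) P₅ (↭-sym (↭P.shift v₅ (v₀ ∷ v₁ ∷ v₂ ∷ v₃ ∷ v₄ ∷ []) _)) (missing-cycle (0 ∷ 1 ∷ 2 ∷ 3 ∷ 4 ∷ []) P₅))))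

    arms-pointed : Span V 2 (Pointed 2 Any V) (scale (+ 3) (wedge (arm v₀ v₁ v₂) (arm v₃ v₄ v₅)))
    arms-pointed = resp same (add missing-span (bdry {b = push filling₆}
      (On-push (label< (0 ∷ 1 ∷ 2 ∷ 3 ∷ 4 ∷ 5 ∷ [])) (toWitness {a? = On? (0 ∷ 1 ∷ 2 ∷ 3 ∷ 4 ∷ 5 ∷ []) 3 filling₆} tt))))
      where
      same : push (scale (+ 3) arms) ≋ (push P₁ ++ push P₂ ++ push P₄ ++ push P₅) ++ ∂ (push filling₆)
      same .at φ A = ≡ₚ-trans (≡⇒≡ₚ (⟦push⟧ (scale (+ 3) arms) φ))
        (≡ₚ-trans (⟦⟧-⊖-null {scale (+ 3) arms} {missing ++ ∂ filling₆} (φ ∘ map relabel)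
          (subst (_≡ₚ 0ℤ) (⟦push⟧ discrepancy₆ φ) (push-null p {discrepancy₆} (toWitness {a? = edgeLabels? discrepancy₆} tt) null₆ .at φ A)))
        (≡⇒≡ₚ (≡.trans (⟦⟧-++ missing (∂ filling₆) (φ ∘ map relabel))
          (sym (≡.trans (⟦⟧-++ (push missing) (∂ (push filling₆)) φ)
            (cong₂ _+ℤ_ (⟦push⟧ missing φ) (≡.trans (⟦∂push⟧ filling₆ φ) (⟦push⟧ (∂ filling₆) φ))))))))

  arms-bound : ∀ {v₀ v₁ v₂ v₃ v₄ v₅ v₆} {Q : Chain → Set} → Unique (v₀ ∷ v₁ ∷ v₂ ∷ v₃ ∷ v₄ ∷ v₅ ∷ v₆ ∷ []) →
    Span (v₀ ∷ v₁ ∷ v₂ ∷ v₃ ∷ v₄ ∷ v₅ ∷ v₆ ∷ []) 2 Q (scale (+ 3) (wedge (arm v₀ v₁ v₂) (arm v₃ v₄ v₅)))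
  arms-bound {v₀} {v₁} {v₂} {v₃} {v₄} {v₅} {v₆} uniq = resp same (bdry {b = push filling₇}
    (On-push (toWitness {a? = All.all? (ℕ._<? 7) labels} tt) (toWitness {a? = On? labels 3 filling₇} tt)))
    where
    labels : List ℕ
    labels = 0 ∷ 1 ∷ 2 ∷ 3 ∷ 4 ∷ 5 ∷ 6 ∷ []
    open Relabel (v₀ ∷ v₁ ∷ v₂ ∷ v₃ ∷ v₄ ∷ v₅ ∷ v₆ ∷ []) uniq
    same : push (scale (+ 3) arms) ≋ ∂ (push filling₇)
    same .at φ A = ≡ₚ-trans (≡⇒≡ₚ (⟦push⟧ (scale (+ 3) arms) φ))
      (≡ₚ-trans (⟦⟧-⊖-null {scale (+ 3) arms} {∂ filling₇} (φ ∘ map relabel)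
        (subst (_≡ₚ 0ℤ) (⟦push⟧ discrepancy₇ φ) (push-null p {discrepancy₇} (toWitness {a? = edgeLabels? discrepancy₇} tt) null₇ .at φ A)))
      (≡⇒≡ₚ (≡.trans (sym (⟦push⟧ (∂ filling₇) φ)) (sym (⟦∂push⟧ filling₇ φ)))))

  -- The complex of a triangle is three isolated points, and arms are differences of two of them.
  -- They span its cycles, which reduces the two facts to products of arms.
  Arm : List ℕ → Chain → Set
  Arm S g = ∃ λ u → ∃ λ v → ∃ λ w → (u ∷ v ∷ w ∷ [] ↭ S) × g ≋ arm u v w

  module _ {a b c : ℕ} (uniq : Unique (a ∷ b ∷ c ∷ [])) where
    private
      S : List ℕ
      S = a ∷ b ∷ c ∷ []
      ab : Edge
      ab = mk a b

      rebase : Simplex → Chain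
      rebase σ = (1ℤ , σ) ∷ (-1ℤ , ab ∷ []) ∷ []

      ⟦extend-rebase⟧ : ∀ z φ → ⟦ z ⟧ φ ≡ ⟦ extend rebase z ⟧ φ +ℤ ⟦ z ⟧ (λ _ → 1ℤ) *ℤ φ (ab ∷ [])
      ⟦extend-rebase⟧ z φ = ≡.trans (lem (⟦ z ⟧ φ) (⟦ z ⟧ (λ _ → 1ℤ)) (φ (ab ∷ [])))
        (cong (_+ℤ ⟦ z ⟧ (λ _ → 1ℤ) *ℤ φ (ab ∷ []))
          (sym (≡.trans (⟦⟧-extend rebase z φ) (≡.trans (⟦⟧-ext z (λ σ → lem' (φ σ) (φ (ab ∷ [])))) (⟦⟧-linear 1ℤ (- φ (ab ∷ [])) z φ (λ _ → 1ℤ))))))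
        where
        lem : ∀ x y w → x ≡ 1ℤ *ℤ x +ℤ (- w) *ℤ y +ℤ y *ℤ w
        lem = solve-∀
        lem' : ∀ x w → 1ℤ *ℤ x +ℤ (-1ℤ *ℤ w +ℤ 0ℤ) ≡ 1ℤ *ℤ x +ℤ (- w) *ℤ 1ℤ
        lem' = solve-∀

      -- Pairing with it reads off the coefficient of the empty simplex, so that closedness of a
      -- chain of single edges says that its coefficients sum to zero modulo p.
      ε : Cochain
      ε [] = 1ℤ
      ε (_ ∷ _) = 0ℤ

      ε-alternating : Alternating ε
      ε-alternating (here _) = ≡.refl
      ε-alternating (there _) = ≡.refl

      augmentation : ∀ {z} → On S 1 z → ⟦ ∂ z ⟧ ε ≡ ⟦ z ⟧ (λ _ → 1ℤ)
      augmentation {z} o = ≡.trans (⟦∂⟧ z ε) (⟦⟧-cong o δε)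
        where
        δε : ∀ σ → Face S 1 σ → δ ε σ ≡ 1ℤ
        δε [] F = contradiction (size F) λ ()
        δε (e ∷ []) F = ≡.refl
        δε (_ ∷ _ ∷ _) F = contradiction (size F) λ ()

      -- Subtracting `ab` from every term changes `z` by `ab` times the sum of its coefficients,
      -- which is zero.
      rebased : ∀ z → Cycle S 1 z → z ≋ extend rebase z
      rebased z (o , cz) .at φ A = via-zero null (⟦extend-rebase⟧ z φ)
        where
        null : ⟦ z ⟧ (λ _ → 1ℤ) *ℤ φ (ab ∷ []) ≡ₚ 0ℤ
        null = ≡ₚ-trans (≡⇒≡ₚ (ℤP.*-comm (⟦ z ⟧ (λ _ → 1ℤ)) (φ (ab ∷ []))))
          (≡ₚ-trans (*-congₚ (φ (ab ∷ [])) (subst (_≡ₚ 0ℤ) (augmentation o) (cz .boundary .at ε ε-alternating)))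
            (≡⇒≡ₚ (ℤP.*-zeroʳ (φ (ab ∷ [])))))

      trivial : Span S 1 (Arm S) (rebase (ab ∷ []))
      trivial = resp (exact (λ φ _ → lem (φ (ab ∷ [])))) zero
        where
        lem : ∀ x → 1ℤ *ℤ x +ℤ (-1ℤ *ℤ x +ℤ 0ℤ) ≡ 0ℤ
        lem = solve-∀

      arm-span : ∀ {u v w} → u ∷ v ∷ w ∷ [] ↭ S → Span S 1 (Arm S) (arm u v w)
      arm-span {u} {v} {w} q = gen (Cycle-↭ q (on-arm , closed (exact (λ φ _ → lem (φ []))))) (u , v , w , q , ≋-refl)
        where
        u-uvw : Unique (u ∷ v ∷ w ∷ [])
        u-uvw = Unique-↭ (↭-sym q) uniq
        on-arm : On (u ∷ v ∷ w ∷ []) 1 (arm u v w)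
        on-arm = face1 (All.head (All.tail (AllPairs.head u-uvw))) (here ≡.refl) (there (there (here ≡.refl)))
               ∷ face1 (All.head (AllPairs.head u-uvw)) (here ≡.refl) (there (here ≡.refl)) ∷ []
        lem : ∀ x → 1ℤ *ℤ x +ℤ (-1ℤ *ℤ x +ℤ 0ℤ) ≡ 0ℤ
        lem = solve-∀

      rebase-mk : ∀ i j → i ∈ S → j ∈ S → i ≢ j → Span S 1 (Arm S) (rebase (mk i j ∷ []))
      rebase-mk i j (here ≡.refl) (here ≡.refl) i≢j = contradiction ≡.refl i≢j
      rebase-mk i j (here ≡.refl) (there (here ≡.refl)) i≢j = trivial
      rebase-mk i j (here ≡.refl) (there (there (here ≡.refl))) i≢j = arm-span refl
      rebase-mk i j (there (here ≡.refl)) (here ≡.refl) i≢j rewrite mk-comm b a = trivial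
      rebase-mk i j (there (here ≡.refl)) (there (here ≡.refl)) i≢j = contradiction ≡.refl i≢j
      rebase-mk i j (there (here ≡.refl)) (there (there (here ≡.refl))) i≢j rewrite mk-comm a b = arm-span (swap b a refl)
      rebase-mk i j (there (there (here ≡.refl))) (here ≡.refl) i≢j rewrite mk-comm c a = arm-span refl
      rebase-mk i j (there (there (here ≡.refl))) (there (here ≡.refl)) i≢j rewrite mk-comm c b | mk-comm a b = arm-span (swap b a refl)
      rebase-mk i j (there (there (here ≡.refl))) (there (there (here ≡.refl))) i≢j = contradiction ≡.refl i≢j

      rebase-face : ∀ {σ} → Face S 1 σ → Span S 1 (Arm S) (rebase σ)
      rebase-face {[]} F = contradiction (size F) λ ()
      rebase-face {_ ∷ _ ∷ _} F = contradiction (size F) λ ()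
      rebase-face {(i , j) ∷ []} (face (i<j ∷ []) (i∈ ∷ j∈ ∷ []) _ _) =
        subst (λ e → Span S 1 (Arm S) (rebase (e ∷ []))) (mk-< i<j) (rebase-mk i j i∈ j∈ (ℕP.<⇒≢ i<j))

      rebase-span : ∀ {z} → On S 1 z → Span S 1 (Arm S) (extend rebase z)
      rebase-span [] = zero
      rebase-span {(k , σ) ∷ z} (F ∷ o) = add (smul k (rebase-face F)) (rebase-span o)

    triangle : ∀ {z} → Cycle S 1 z → Span S 1 (Arm S) z
    triangle {z} cz = resp (rebased z cz) (rebase-span (proj₁ cz))

  arms-span : ∀ {S z} → Unique S → length S ≡ 3 → Cycle S 1 z → Span S 1 (Arm S) z
  arms-span {a ∷ b ∷ c ∷ []} u l cz = triangle u cz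

  module _ {third : ℤ} (third-inverse : third *ℤ (+ 3) ≡ₚ 1ℤ) where

    -- The explicit identities concern three times a product of arms; here the factor 3 is removed.
    divide : ∀ {S e Q z} → Span S e Q (scale (+ 3) z) → Span S e Q z
    divide {z = z} s = resp same (smul third s)
      where
      same : z ≋ scale third (scale (+ 3) z)
      same .at φ A = ≡ₚ-trans (≡⇒≡ₚ (sym (ℤP.*-identityʳ (⟦ z ⟧ φ))))
        (≡ₚ-trans (*-congₚ (⟦ z ⟧ φ) (≡ₚ-sym third-inverse))
        (≡⇒≡ₚ (≡.trans (lem (⟦ z ⟧ φ) third) (sym (≡.trans (⟦⟧-scale third (scale (+ 3) z) φ) (cong (third *ℤ_) (⟦⟧-scale (+ 3) z φ)))))))
        where
        lem : ∀ x t → x *ℤ (t *ℤ (+ 3)) ≡ t *ℤ ((+ 3) *ℤ x)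
        lem = solve-∀

    triangles-pointed : ∀ {S T a b} → Unique (S ++ T) → length S ≡ 3 → length T ≡ 3 → Cycle S 1 a → Cycle T 1 b →
      Span (S ++ T) 2 (Pointed 2 Any (S ++ T)) (wedge a b)
    triangles-pointed {S} {T} uniq lS lT ca cb =
      span-wedgeˡ uniq (arms-span (Unique-++ˡ uniq) lS ca) cb λ { {g} cg (u , v , w , q , g≋) →
      span-wedgeʳ uniq cg (arms-span (Unique-++ʳ S uniq) lT cb) λ { {h} ch (u' , v' , w' , q' , h≋) →
        resp (≋-trans (wedge-congˡ h g≋) (wedge-congʳ (arm u v w) h≋))
          (span-map (Pointed-↭ (↭P.++⁺ q q')) (span-↭ (↭P.++⁺ q q')
            (divide (arms-pointed (Unique-↭ (↭-sym (↭P.++⁺ q q')) uniq))))) } }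

    triangles-bound : ∀ {S T c a b} {Q : Chain → Set} → Unique (S ++ T ++ c ∷ []) → length S ≡ 3 → length T ≡ 3 →
      Cycle S 1 a → Cycle T 1 b → Span (S ++ T ++ c ∷ []) 2 Q (wedge a b)
    triangles-bound {S} {T} {c} uniq lS lT ca cb =
      span-wedgeˡ uniq (arms-span (Unique-++ˡ uniq) lS ca) (Cycle-mono ∈-++⁺ˡ cb) λ { {g} cg (u , v , w , q , g≋) →
      span-wedgeʳ uniq cg (span-mono ∈-++⁺ˡ (arms-span (Unique-++ˡ (Unique-++ʳ S uniq)) lT cb)) λ { {h} ch (u' , v' , w' , q' , h≋) →
        resp (≋-trans (wedge-congˡ h g≋) (wedge-congʳ (arm u v w) h≋))
          (span-↭ (↭P.++⁺ q (↭P.++⁺ʳ (c ∷ []) q'))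
            (divide (arms-bound (Unique-↭ (↭-sym (↭P.++⁺ q (↭P.++⁺ʳ (c ∷ []) q'))) uniq)))) } }

-- 5 q and 2 q by recursion, so that they compute on suc q

fives : ℕ → ℕ
fives zero = 0
fives (suc q) = 5 ℕ.+ fives q

twos : ℕ → ℕ
twos zero = 0
twos (suc q) = 2 ℕ.+ twos q

-- Induction on the number of edges

module Induction (p : ℕ) {third : ℤ} (third-inverse : Modular._≡ₚ_ p (third *ℤ (+ 3)) 1ℤ) where
  open Spans p
  open TwoVertices p
  open Local p

  joined-pointed : ∀ {e P S z} → Unique S → Joined 3 1 e (Pointed e P) S z → Pointed (suc e) (Joined 3 1 e P) S z
  joined-pointed {S = S} u (joined {left} {right} {a} {b} q l ca cb (pointed {w} {rest} {c} q' cc m same) s) =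
    pointed perm (Cycle-wedge u-rest ca cc) (joined {left = left} refl l ca cc m ≋-refl) (≋-trans s (wedge-congʳ a same))
    where
    perm : w ∷ left ++ rest ↭ S
    perm = trans (↭-sym (↭P.shift w left rest)) (trans (↭P.++⁺ˡ left q') q)
    u-rest : Unique (left ++ rest)
    u-rest = AllPairs.tail (Unique-↭ (↭-sym perm) u)

  -- Moving two edges past one is an even permutation, so exchanging the factors costs no sign.
  joined-swap : ∀ {e P S z} → Unique S → Joined 5 2 (suc e) (Joined 3 1 e P) S z → Joined 3 1 (suc (suc e)) (Joined 5 2 e P) S z
  joined-swap {e} {S = S} u (joined {A} {_} {a} q l ca _ (joined {B} {C} {b} {c} q' l' cb cc m s') s) =
    joined {left = B} perm l' cb (Cycle-wedge u-AC ca cc) (joined {left = A} refl l ca cc m ≋-refl)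
      (≋-trans s (≋-trans (wedge-congʳ a s') (exact commute)))
    where
    perm : B ++ A ++ C ↭ S
    perm = trans (↭P.shifts B A) (trans (↭P.++⁺ˡ A q') q)
    u-BAC : Unique (B ++ A ++ C)
    u-BAC = Unique-↭ (↭-sym perm) u
    u-AC : Unique (A ++ C)
    u-AC = Unique-++ʳ B u-BAC
    u-AB : Unique (A ++ B)
    u-AB = Unique-++ˡ (subst Unique (sym (++-assoc A B C)) (Unique-↭ (↭P.shifts B A) u-BAC))
    commute : ∀ φ → Alternating φ → ⟦ wedge a (wedge b c) ⟧ φ ≡ ⟦ wedge b (wedge a c) ⟧ φ
    commute φ alt = ≡.trans (sym (⟦wedge-assoc⟧ a b c φ)) (≡.trans (⟦⟧-wedge (wedge a b) c φ)
      (≡.trans (⟦wedge-comm⟧ u-AB (proj₁ ca) (proj₁ cb) (Alternating-⟦⟧ c (Alternating-++ˡ alt)))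
      (≡.trans (⟦⟧-scale 1ℤ (wedge b a) _) (≡.trans (ℤP.*-identityˡ _)
      (≡.trans (sym (⟦⟧-wedge (wedge b a) c φ)) (⟦wedge-assoc⟧ b a c φ))))))

  -- The six-vertex fact applied to the first two factors. The freed vertex `w` is passed to the
  -- continuation, which keeps it as a factor [1,0] in slack 2 and adds it to the remaining factor
  -- in slack 1.
  two-triangles : ∀ {e P S z} {Q : Chain → Set} → Unique S → Joined 3 1 (suc e) (Joined 3 1 e P) S z →
    (∀ {w R T g b} → w ∷ R ++ T ↭ S → length R ≡ 5 → Cycle R 2 g → Cycle T e b → P T b → Span S (suc (suc e)) Q (wedge g b)) →
    Span S (suc (suc e)) Q z
  two-triangles {e} {S = S} {Q = Q} u (joined {A} {_} {a} q l ca _ (joined {B} {C} {b} {c} q' l' cb cc m s') s) k =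
    resp (≋-trans s (≋-trans (wedge-congʳ a s') (exact (λ φ _ → sym (⟦wedge-assoc⟧ a b c φ)))))
      (span-↭ perm (span-wedgeˡ u-ABC (triangles-pointed {third} third-inverse (Unique-++ˡ u-ABC) l l' ca cb) cc regroup))
    where
    perm : (A ++ B) ++ C ↭ S
    perm = trans (↭P.++-assoc A B C) (trans (↭P.++⁺ˡ A q') q)
    u-ABC : Unique ((A ++ B) ++ C)
    u-ABC = Unique-↭ (↭-sym perm) u
    regroup : ∀ {g} → Cycle (A ++ B) 2 g → Pointed 2 Any (A ++ B) g → Span ((A ++ B) ++ C) (2 ℕ.+ e) Q (wedge g c)
    regroup cg (pointed {w} {R} {g'} r cg' _ same) = resp (wedge-congˡ c same) (span-↭ (↭-sym perm)
      (k (trans (↭P.++⁺ʳ C r) perm) (ℕP.suc-injective (≡.trans (↭P.↭-length r) (≡.trans (length-++ A) (cong₂ ℕ._+_ l l')))) cg' cc m))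

  -- The two triangles together with the free vertex `w` form the seven vertices on which their
  -- product bounds. No generator survives, so the span may be over any `Q`.
  three-triangles : ∀ {e P S z} {Q : Chain → Set} → Unique S → Joined 3 1 (suc e) (Pointed (suc e) (Joined 3 1 e P)) S z →
    Span S (suc (suc e)) Q z
  three-triangles {e} {S = S} u (joined {A} {_} {a} q l ca _ (pointed {w} q' _ (joined {B} {C} {b} {c} q'' l' cb cc m s'') s') s) =
    resp (≋-trans s (≋-trans (wedge-congʳ a (≋-trans s' s'')) (exact (λ φ _ → sym (⟦wedge-assoc⟧ a b c φ)))))
      (span-↭ perm (span-wedgeˡ {P = λ _ → ⊥} u-all (triangles-bound {third} third-inverse (Unique-++ˡ u-all) l l' ca cb) cc (λ _ ())))
    where
    perm : (A ++ B ++ w ∷ []) ++ C ↭ S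
    perm = trans (↭-reflexive (≡.trans (++-assoc A (B ++ w ∷ []) C) (cong (A ++_) (++-assoc B (w ∷ []) C))))
      (trans (↭P.++⁺ˡ A (trans (↭P.shift w B C) (trans (prep w q'') q'))) q)
    u-all : Unique ((A ++ B ++ w ∷ []) ++ C)
    u-all = Unique-↭ (↭-sym perm) u

  Pentagons : ℕ → Family
  Pentagons zero S z = S ≡ [] × z ≋ unitChain
  Pentagons (suc q) = Joined 5 2 (twos q) (Pentagons q)

  -- The equation says that the second factor has 2q - 1 edges without truncated subtraction, and it
  -- excludes this type for q = 0.
  PentagonsOrTriangle : ℕ → Family
  PentagonsOrTriangle q S z = Pentagons q S z ⊎ ∃ λ e → twos q ≡ suc e × Joined 3 1 e Any S z

  -- A span over it consists of boundaries, so it expresses that a group is zero. As the family of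
  -- coefficients in `generate` it rules out pentagon generators.
  Never : Family
  Never _ _ = ⊥

  Generated : ℕ → ℕ → Family → Set
  Generated n e P = ∀ {S z} → Unique S → length S ≡ n → Cycle S e z → Span S e (P S) z

  -- The fields have slack 0, slack 2 and slack 4 + 2k.
  record Even (q : ℕ) : Set₁ where
    field
      I    : Generated (fives q) (twos q) (PentagonsOrTriangle q)
      II   : Generated (1 ℕ.+ fives q) (twos q) (Pointed (twos q) (Pentagons q))
      vanishing   : ∀ {P} k → Generated (2 ℕ.+ k ℕ.+ fives q) (twos q) P

  -- The fields have slack 1, slack 3 and slack 5 + 2k.
  record Odd (q : ℕ) : Set₁ where
    field
      III  : Generated (3 ℕ.+ fives q) (suc (twos q)) (Joined 3 1 (twos q) (Pentagons q))
      IV   : Generated (4 ℕ.+ fives q) (suc (twos q)) (Pointed (suc (twos q)) (Joined 3 1 (twos q) (Pentagons q)))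
      vanishing   : ∀ {P} k → Generated (5 ℕ.+ k ℕ.+ fives q) (suc (twos q)) P

  -- One inductive step, with the first two entries of `S` as `x` and `y`. The three hypotheses
  -- rewrite the triangle generators, rewrite the pentagon generators, and describe the group of the
  -- coefficients, which has four vertices and two edges less.
  generate : ∀ {n} e {P Q : Family} →
    (∀ {S z} → Unique S → length S ≡ 2 ℕ.+ n → Cycle S (suc e) z → Joined 3 1 e Any S z → Span S (suc e) (Q S) z) →
    (∀ {e' S z} → e ≡ suc e' → Unique S → length S ≡ 2 ℕ.+ n → Cycle S (suc e) z → Joined 5 2 e' P S z → Span S (suc e) (Q S) z) →
    (∀ {e' m} → e ≡ suc e' → n ≡ 2 ℕ.+ m → Generated m e' (Pointed e' P)) →
    Generated (2 ℕ.+ n) (suc e) Q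
  generate {n} e {P} {Q} triple pent hyp {S@(x ∷ y ∷ S')} {z} u l cz = span-bind
    (Generation.generation p x y S' u e {P} {λ z → Joined 3 1 e Any S z ⊎ ∃ λ e' → e ≡ suc e' × Joined 5 2 e' P S z}
      inj₁ (λ {e'} eq j → inj₂ (e' , eq , j))
      (λ eq uR lR cR → hyp eq (ℕP.suc-injective (ℕP.suc-injective (≡.trans (sym l) (sym lR)))) uR ≡.refl cR) cz)
    λ { cg (inj₁ j) → triple u l cg j ; cg (inj₂ (e' , eq , j)) → pent eq u l cg j }

  -- Without edges every chain is a multiple of the empty simplex, which is a boundary as soon as
  -- two vertices span an edge.
  even-zero : Even 0
  even-zero = record { I = I₀ ; II = II₀ ; vanishing = V₀ }
    where
    constant : ∀ {S c} → On S 0 c → c ≋ scale (⟦ c ⟧ (λ _ → 1ℤ)) unitChain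
    constant {c = c} o = exact λ φ _ → ≡.trans (⟦⟧-cong o (λ { [] F → sym (ℤP.*-identityʳ (φ [])) ; (_ ∷ _) F → contradiction (size F) λ () }))
      (≡.trans (⟦⟧-* (φ []) c (λ _ → 1ℤ)) (lem (φ []) (⟦ c ⟧ (λ _ → 1ℤ))))
      where
      lem : ∀ x k → x *ℤ k ≡ k *ℤ 1ℤ *ℤ x +ℤ 0ℤ
      lem = solve-∀
    unit-cycle : ∀ {S} → Cycle S 0 unitChain
    unit-cycle = (face [] [] [] ≡.refl ∷ []) , closed ≋-refl
    I₀ : Generated 0 0 (PentagonsOrTriangle 0)
    I₀ {[]} {z} u l (o , _) = resp (constant o) (smul (⟦ z ⟧ (λ _ → 1ℤ)) (gen unit-cycle (inj₁ (≡.refl , ≋-refl))))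
    II₀ : Generated 1 0 (Pointed 0 (Pentagons 0))
    II₀ {w ∷ []} {z} u l (o , _) = resp (constant o) (smul (⟦ z ⟧ (λ _ → 1ℤ)) (gen unit-cycle (pointed refl unit-cycle (≡.refl , ≋-refl) ≋-refl)))
    V₀ : ∀ {P} k → Generated (2 ℕ.+ k ℕ.+ 0) 0 P
    V₀ k {x ∷ y ∷ S'} {z} u l (o , cz) = resp z≋∂ (bdry {b = mk x y ∙ z} (On-∙ u (All.map (λ {t} → in-S' {t}) o)))
      where
      in-S' : ∀ {t : Term} → Face (x ∷ y ∷ S') 0 (proj₂ t) → Face S' 0 (proj₂ t)
      in-S' {_ , []} F = face [] [] [] ≡.refl
      in-S' {_ , _ ∷ _} F = contradiction (size F) λ ()
      z≋∂ : z ≋ ∂ (mk x y ∙ z)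
      z≋∂ .at φ A = ≡ₚ-trans (via-zero (cz .boundary .at (φ ∘ (mk x y ∷_)) (Alternating-∷ (mk x y) A)) (lem (⟦ z ⟧ φ) (⟦ ∂ z ⟧ (φ ∘ (mk x y ∷_)))))
        (≡⇒≡ₚ (sym (⟦∂∙⟧ (mk x y) z φ)))
        where
        lem : ∀ a b → a ≡ a -ℤ b +ℤ b
        lem = solve-∀

  -- Of 2q + 2 edges, a triangle uses one and leaves `odd`; the coefficients have two fewer and
  -- belong to `even`.
  even-suc : ∀ {q} → Even q → Odd q → Even (suc q)
  even-suc {q} even odd = record { I = I₁ ; II = II₁ ; vanishing = V₁ }
    where
    module Ev = Even even
    module Od = Odd odd
    I₁ : Generated (fives (suc q)) (twos (suc q)) (PentagonsOrTriangle (suc q))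
    I₁ = generate (suc (twos q)) {Pentagons q} {PentagonsOrTriangle (suc q)}
      (λ u l cg j → gen cg (inj₂ (suc (twos q) , ≡.refl , j)))
      (λ { ≡.refl u l cg j → gen cg (inj₁ j) })
      (λ { ≡.refl ≡.refl → Ev.II })
    II₁ : Generated (1 ℕ.+ fives (suc q)) (twos (suc q)) (Pointed (twos (suc q)) (Pentagons (suc q)))
    II₁ = generate {4 ℕ.+ fives q} (suc (twos q)) {P = Never}
      -- Slack 2: the factor beside the triangle has slack 1, so it splits off a second triangle by
      -- `III`, and the six-vertex fact supplies the free vertex.
      (λ {S} u l _ j → span-bind (joined-bind u l j (λ uR lR cR _ → Od.III uR lR cR)) λ cg j' →
        two-triangles u j' λ {w} {R} {T} q' lR cg' cb m →
          let uRT = AllPairs.tail (Unique-↭ (↭-sym q') u) ; c = Cycle-wedge {S = R} uRT cg' cb in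
          gen (Cycle-mono (λ v∈ → ↭P.∈-resp-↭ q' (there v∈)) c) (pointed q' c (joined {left = R} refl lR cg' cb m ≋-refl) ≋-refl))
      (λ { ≡.refl u l _ (joined _ _ _ _ () _) })
      (λ { ≡.refl ≡.refl → Ev.vanishing {Pointed (twos q) Never} 0 })
    V₁ : ∀ {P} k → Generated (2 ℕ.+ k ℕ.+ fives (suc q)) (twos (suc q)) P
    V₁ {P} k = generate {k ℕ.+ fives (suc q)} (suc (twos q)) {P = Never} {P} (triple k)
      (λ { ≡.refl u l _ (joined _ _ _ _ () _) })
      (λ { ≡.refl eq uR lR → Ev.vanishing {Pointed (twos q) Never} (suc k) uR (≡.trans lR (ℕP.suc-injective (ℕP.suc-injective (≡.trans (sym eq) (arith k (fives q)))))) })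
      where
      arith : ∀ k n → k ℕ.+ (5 ℕ.+ n) ≡ 2 ℕ.+ (2 ℕ.+ suc k ℕ.+ n)
      arith = ℕSolver.solve-∀
      arith' : ∀ k n → 2 ℕ.+ k ℕ.+ (5 ℕ.+ n) ≡ 3 ℕ.+ (4 ℕ.+ k ℕ.+ n)
      arith' = ℕSolver.solve-∀
      triple : ∀ k {S z} → Unique S → length S ≡ 2 ℕ.+ (k ℕ.+ fives (suc q)) → Cycle S (twos (suc q)) z →
        Joined 3 1 (suc (twos q)) Any S z → Span S (twos (suc q)) (P S) z
      -- Slack 4 is the critical case: the other factor has slack 3 and need not vanish, but by `IV`
      -- it contributes a free vertex and a second triangle. For larger slack the other factor
      -- vanishes already.
      triple zero u l _ j = span-bind (joined-bind u l j (λ uR lR cR _ → Od.IV uR lR cR)) (λ _ → three-triangles u)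
      triple (suc k) u l _ j = span-bind (joined-bind {Q = Never} u (≡.trans l (arith' (suc k) (fives q))) j
        (λ uR lR cR _ → Od.vanishing {Never} k uR lR cR)) λ _ → λ { (joined _ _ _ _ () _) }

  -- A triangle leaves 2q edges, covered by `even`. The coefficients have 2q - 1 edges, so the
  -- previous odd case is requested only when q is positive; for q = 0 there is a single edge and no
  -- coefficient to treat.
  odd : ∀ {q} → Even q → (∀ {q'} → q ≡ suc q' → Odd q') → Odd q
  odd {q} even prev = record { III = III₁ ; IV = IV₁ ; vanishing = V₁ }
    where
    module Ev = Even even
    V₁ : ∀ {P} k → Generated (5 ℕ.+ k ℕ.+ fives q) (suc (twos q)) P
    V₁ {P} k = generate {3 ℕ.+ k ℕ.+ fives q} (twos q) {P = Never} {P}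
      (λ u l _ j → span-bind (joined-bind {Q = Never} u l j (λ uR lR cR _ → Ev.vanishing {Never} k uR lR cR)) λ _ → λ { (joined _ _ _ _ () _) })
      (λ { _ u l _ (joined _ _ _ _ () _) })
      (λ e≡ eq → hyp q e≡ eq prev)
      where
      arith : ∀ k n → 1 ℕ.+ k ℕ.+ (5 ℕ.+ n) ≡ 5 ℕ.+ suc k ℕ.+ n
      arith = ℕSolver.solve-∀
      hyp : ∀ q {e' m} → twos q ≡ suc e' → 3 ℕ.+ k ℕ.+ fives q ≡ 2 ℕ.+ m → (∀ {q'} → q ≡ suc q' → Odd q') → Generated m e' (Pointed e' Never)
      hyp (suc q') ≡.refl eq prev uR lR = Odd.vanishing (prev ≡.refl) {Pointed (suc (twos q')) Never} (suc k) uR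
        (≡.trans lR (≡.trans (ℕP.suc-injective (ℕP.suc-injective (sym eq))) (arith k (fives q'))))
    IV₁ : Generated (4 ℕ.+ fives q) (suc (twos q)) (Pointed (suc (twos q)) (Joined 3 1 (twos q) (Pentagons q)))
    IV₁ = generate {2 ℕ.+ fives q} (twos q) {P = Never}
      (λ u l _ j → span-map (joined-pointed u) (joined-bind u l j (λ uR lR cR _ → Ev.II uR lR cR)))
      (λ { _ u l _ (joined _ _ _ _ () _) })
      (λ e≡ eq → hyp q e≡ eq prev)
      where
      hyp : ∀ q {e' m} → twos q ≡ suc e' → 2 ℕ.+ fives q ≡ 2 ℕ.+ m → (∀ {q'} → q ≡ suc q' → Odd q') → Generated m e' (Pointed e' Never)
      hyp (suc q') ≡.refl ≡.refl prev = Odd.vanishing (prev ≡.refl) {Pointed (suc (twos q')) Never} 0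
    -- What `IV` for q - 1 leaves beside the free vertex: [3,1] ∧ [5,2]^(q-1). Joined with a
    -- pentagon and reordered, it gives [3,1] ∧ [5,2]^q.
    Lower : ℕ → Family
    Lower zero _ _ = ⊥
    Lower (suc q') = Joined 3 1 (twos q') (Pentagons q')
    III₁ : Generated (3 ℕ.+ fives q) (suc (twos q)) (Joined 3 1 (twos q) (Pentagons q))
    III₁ = generate {1 ℕ.+ fives q} (twos q) {P = Lower q}
      (λ u l _ j → span-bind (joined-bind u l j (λ uR lR cR _ → Ev.I uR lR cR)) (triple q prev u l))
      (λ e≡ u l cg j → gen cg (pent q e≡ u j))
      (λ e≡ eq → hyp q e≡ eq prev)
      where
      hyp : ∀ q {e' m} → twos q ≡ suc e' → 1 ℕ.+ fives q ≡ 2 ℕ.+ m → (∀ {q'} → q ≡ suc q' → Odd q') → Generated m e' (Pointed e' (Lower q))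
      hyp (suc q') ≡.refl ≡.refl prev = Odd.IV (prev ≡.refl)
      pent : ∀ q {e' S z} → twos q ≡ suc e' → Unique S → Joined 5 2 e' (Lower q) S z → Joined 3 1 (twos q) (Pentagons q) S z
      pent (suc q') ≡.refl u j = joined-swap u j
      triple : ∀ q → (∀ {q'} → q ≡ suc q' → Odd q') → ∀ {S g} → Unique S → length S ≡ 3 ℕ.+ fives q → Cycle S (suc (twos q)) g →
        Joined 3 1 (twos q) (PentagonsOrTriangle q) S g →
        Span S (suc (twos q)) (Joined 3 1 (twos q) (Pentagons q) S) g
      triple q prev u l cg (joined {left} r lA ca cb (inj₁ m) s) = gen cg (joined {left = left} r lA ca cb m s)
      -- The third factor is an arbitrary cycle with 2q' + 1 edges on 5q' + 2 vertices. With the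
      -- vertex `w` freed from the two triangles it lies on 5q' + 3 vertices, where `III` for q'
      -- applies.
      triple (suc q') prev {S} u l cg (joined {left} r lA ca cb (inj₂ (_ , ≡.refl , m)) s) =
        two-triangles u (joined {left = left} r lA ca cb m s) λ {w} {R} {T} {g'} {b} r' lR cg' cb' _ →
          let perm = trans (↭P.shift w R T) r'
              uRT = Unique-↭ (↭-sym perm) u
              lT = ℕP.suc-injective (ℕP.+-cancelˡ-≡ 5 _ _ (≡.trans (sym (≡.trans (≡.trans (↭P.↭-length (↭-sym perm)) (length-++ R)) (cong (ℕ._+ suc (length T)) lR))) l))
          in span-bind (span-↭ perm (span-wedgeʳ {Q = Joined 5 2 (suc (twos q')) (Joined 3 1 (twos q') (Pentagons q')) S} uRT cg'
            (Odd.III (prev ≡.refl) (Unique-++ʳ R uRT) (cong suc lT) (Cycle-mono there cb'))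
            (λ ch j → gen (Cycle-wedge {S = R} uRT cg' ch) (Joined-↭ perm (joined {left = R} refl lR cg' ch j ≋-refl)))))
            (λ c j → gen c (joined-swap u j))

  all-degrees : ∀ q → Even q × Odd q
  all-degrees zero = even-zero , odd even-zero λ ()
  all-degrees (suc q) with all-degrees q
  ... | e , o = even-suc e o , odd (even-suc e o) λ { ≡.refl → o }

-- Inverting 3 modulo p, and arithmetic of degrees

residue₃ : ∀ n → ∃ λ k → n ≡ k * 3 ⊎ n ≡ 1 + k * 3 ⊎ n ≡ 2 + k * 3
residue₃ zero = 0 , inj₁ ≡.refl
residue₃ (suc n) with residue₃ n
... | k , inj₁ eq = k , inj₂ (inj₁ (cong suc eq))
... | k , inj₂ (inj₁ eq) = k , inj₂ (inj₂ (cong suc eq))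
... | k , inj₂ (inj₂ eq) = suc k , inj₁ (cong suc eq)

invert-3 : ∀ {p} → Prime p → p ≢ 3 → ∃ λ t → Modular._≡ₚ_ p (t *ℤ (+ 3)) 1ℤ
invert-3 {p} pr p≢3 with residue₃ p
... | k , inj₁ eq with prime⇒irreducible pr (divides k eq)
...   | inj₁ ()
...   | inj₂ 3≡p = contradiction (sym 3≡p) p≢3
-- If p = 3k + 1 then 3(-k) = 1 - p; in the next case p = 3k + 2 and 3(k + 1) = 1 + p.
invert-3 {p} pr p≢3 | k , inj₂ (inj₁ ≡.refl) = - (+ k) , Modular.mod -1ℤ
  (≡.trans (lem (+ k)) (cong (λ m → 1ℤ +ℤ -1ℤ *ℤ (1ℤ +ℤ m)) (sym (ℤP.pos-* k 3))))
  where
  lem : ∀ k → (- k) *ℤ (+ 3) ≡ 1ℤ +ℤ -1ℤ *ℤ (1ℤ +ℤ k *ℤ (+ 3))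
  lem = solve-∀
invert-3 {p} pr p≢3 | k , inj₂ (inj₂ ≡.refl) = 1ℤ +ℤ + k , Modular.mod 1ℤ
  (≡.trans (lem (+ k)) (cong (λ m → 1ℤ +ℤ 1ℤ *ℤ ((+ 2) +ℤ m)) (sym (ℤP.pos-* k 3))))
  where
  lem : ∀ k → (1ℤ +ℤ k) *ℤ (+ 3) ≡ 1ℤ +ℤ 1ℤ *ℤ ((+ 2) +ℤ k *ℤ (+ 3))
  lem = solve-∀

fives-* : ∀ q → fives q ≡ 5 * q
fives-* zero = ≡.refl
fives-* (suc q) = ≡.trans (cong (λ m → 5 + m) (fives-* q)) (sym (ℕP.*-suc 5 q))

twos-* : ∀ q → twos q ≡ 2 * q
twos-* zero = ≡.refl
twos-* (suc q) = ≡.trans (cong (λ m → 2 + m) (twos-* q)) (sym (ℕP.*-suc 2 q))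

parity : ∀ e → ∃ λ q → e ≡ twos q ⊎ e ≡ suc (twos q)
parity zero = 0 , inj₁ ≡.refl
parity (suc e) with parity e
... | q , inj₁ eq = q , inj₂ (cong suc eq)
... | q , inj₂ eq = suc q , inj₁ (cong suc eq)

halve-< : ∀ a n → 1 + 2 * a < 2 * n → suc a ≤ n
halve-< a n h = ℕP.*-cancelˡ-≤ 2 (ℕP.≤-trans (ℕP.≤-reflexive (lem a)) h)
  where
  lem : ∀ a → 2 * suc a ≡ suc (1 + 2 * a)
  lem = ℕSolver.solve-∀

5*twos : ∀ q → 5 * twos q ≡ 2 * fives q
5*twos q rewrite fives-* q | twos-* q = lem q
  where
  lem : ∀ q → 5 * (2 * q) ≡ 2 * (5 * q)
  lem = ℕSolver.solve-∀

-- From spans to explicit combinations and types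

module Presentation (p : ℕ) where
  open Spans p
  open TwoVertices p

  toCycle : ∀ {S d z} → IsCycleOn p S d z → Cycle S d z
  toCycle (o , h) = toOn o , closed (≈⇒≋ h)

  fromCycle : ∀ {S d z} → Cycle S d z → IsCycleOn p S d z
  fromCycle (o , h) = fromOn o , ≋⇒≈ (boundary h)

  ⟦lincomb-++⟧ : ∀ gs hs φ → ⟦ lincomb (gs ++ hs) ⟧ φ ≡ ⟦ lincomb gs ⟧ φ +ℤ ⟦ lincomb hs ⟧ φ
  ⟦lincomb-++⟧ gs hs φ = ≡.trans (cong (λ c → ⟦ c ⟧ φ) (concatMap-++ (λ g → scale (proj₁ g) (proj₂ g)) gs hs)) (⟦⟧-++ (lincomb gs) (lincomb hs) φ)

  rescale : ℤ → List (ℤ × Chain) → List (ℤ × Chain)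
  rescale k = map (λ g → k *ℤ proj₁ g , proj₂ g)

  ⟦lincomb-rescale⟧ : ∀ k gs φ → ⟦ lincomb (rescale k gs) ⟧ φ ≡ k *ℤ ⟦ lincomb gs ⟧ φ
  ⟦lincomb-rescale⟧ k [] φ = sym (ℤP.*-zeroʳ k)
  ⟦lincomb-rescale⟧ k ((l , c) ∷ gs) φ = ≡.trans (⟦⟧-++ (scale (k *ℤ l) c) _ φ)
    (≡.trans (cong₂ _+ℤ_ (⟦⟧-scale (k *ℤ l) c φ) (⟦lincomb-rescale⟧ k gs φ))
    (≡.trans (lem k l (⟦ c ⟧ φ) (⟦ lincomb gs ⟧ φ))
    (cong (k *ℤ_) (sym (≡.trans (⟦⟧-++ (scale l c) (lincomb gs) φ) (cong (_+ℤ ⟦ lincomb gs ⟧ φ) (⟦⟧-scale l c φ)))))))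
    where
    lem : ∀ k l a b → k *ℤ l *ℤ a +ℤ k *ℤ b ≡ k *ℤ (l *ℤ a +ℤ b)
    lem = solve-∀

  record Presented (S : List ℕ) (e : ℕ) (P : Chain → Set) (z : Chain) : Set where
    constructor presented
    field
      gens    : List (ℤ × Chain)
      bound   : Chain
      gens-P  : All (λ g → Cycle S e (proj₂ g) × P (proj₂ g)) gens
      on      : On S (suc e) bound
      bounds  : ∂ bound ≋ z ⊖ lincomb gens

  -- Each constructor of `Span` has an evident combination and filling: a boundary contributes only
  -- a filling, a generator only itself.
  present : ∀ {S e P z} → Span S e P z → Presented S e P z
  present (gen {z} c m) = presented ((1ℤ , z) ∷ []) [] ((c , m) ∷ []) []
    (exact λ φ _ → sym (≡.trans (⟦⟧-⊖ z (lincomb ((1ℤ , z) ∷ [])) φ)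
      (≡.trans (cong (⟦ z ⟧ φ -ℤ_) (≡.trans (⟦⟧-++ (scale 1ℤ z) [] φ) (cong (_+ℤ 0ℤ) (⟦⟧-scale 1ℤ z φ)))) (lem (⟦ z ⟧ φ)))))
    where
    lem : ∀ x → x -ℤ (1ℤ *ℤ x +ℤ 0ℤ) ≡ 0ℤ
    lem = solve-∀
  present (bdry {b} o) = presented [] b [] o (exact λ φ _ → sym (≡.trans (⟦⟧-⊖ (∂ b) [] φ) (ℤP.+-identityʳ _)))
  present zero = presented [] [] [] [] ≋-refl
  present (add {z} {w} s t) with present s | present t
  ... | presented gs b mg ob hb | presented hs c mh oc hc = presented (gs ++ hs) (b ++ c) (AllP.++⁺ mg mh) (On-++ ob oc)
    λ where .at φ A → ≡ₚ-trans (≡⇒≡ₚ (⟦∂++⟧ b c φ)) (≡ₚ-trans (+-congₚ (hb .at φ A) (hc .at φ A))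
              (≡⇒≡ₚ (≡.trans (cong₂ _+ℤ_ (⟦⟧-⊖ z (lincomb gs) φ) (⟦⟧-⊖ w (lincomb hs) φ))
                (≡.trans (lem (⟦ z ⟧ φ) (⟦ lincomb gs ⟧ φ) (⟦ w ⟧ φ) (⟦ lincomb hs ⟧ φ))
                (sym (≡.trans (⟦⟧-⊖ (z ++ w) (lincomb (gs ++ hs)) φ) (cong₂ _-ℤ_ (⟦⟧-++ z w φ) (⟦lincomb-++⟧ gs hs φ))))))))
    where
    lem : ∀ a b c d → a -ℤ b +ℤ (c -ℤ d) ≡ a +ℤ c -ℤ (b +ℤ d)
    lem = solve-∀
  present (smul k {z} s) with present s
  ... | presented gs b mg ob hb = presented (rescale k gs) (scale k b) (AllP.map⁺ mg) (On-scale k ob)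
    λ where .at φ A → ≡ₚ-trans (≡⇒≡ₚ (⟦∂scale⟧ k b φ)) (≡ₚ-trans (*-congₚ k (hb .at φ A))
              (≡⇒≡ₚ (≡.trans (cong (k *ℤ_) (⟦⟧-⊖ z (lincomb gs) φ)) (≡.trans (lem k (⟦ z ⟧ φ) (⟦ lincomb gs ⟧ φ))
                (sym (≡.trans (⟦⟧-⊖ (scale k z) (lincomb (rescale k gs)) φ) (cong₂ _-ℤ_ (⟦⟧-scale k z φ) (⟦lincomb-rescale⟧ k gs φ))))))))
    where
    lem : ∀ k a b → k *ℤ (a -ℤ b) ≡ k *ℤ a -ℤ k *ℤ b
    lem = solve-∀
  present (resp {z} {w} r s) with present s
  ... | presented gs b mg ob hb = presented gs b mg ob (≋-trans hb (++-cong (≋-sym r) ≋-refl))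

  TypeOn : List (ℕ × ℕ) → Family
  TypeOn T S z = ∃ λ Ss → ∃ λ w → Realizes p T Ss w × (concat Ss ↭ S) × (z ≋ w)

  joined-type : ∀ {m d e T P S z} → (∀ {R b} → P R b → TypeOn T R b) → Joined m d e P S z → TypeOn ((m , d) ∷ T) S z
  joined-type h (joined {left} {_} {a} q l ca _ m s) with h m
  ... | Ss , w , r , q' , same = left ∷ Ss , wedge a w , step l (fromCycle ca) r , trans (↭P.++⁺ˡ left q') q , ≋-trans s (wedge-congʳ a same)

  pointed-type : ∀ {e T P S z} → (∀ {R b} → P R b → TypeOn T R b) → Pointed e P S z → TypeOn ((1 , 0) ∷ T) S z
  pointed-type h (pointed {v} q _ m same) with h m
  ... | Ss , w , r , q' , same' = (v ∷ []) ∷ Ss , wedge unitChain w ,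
    -- On a one-vertex set the empty simplex serves as the cycle of type [1,0].
    step {z = unitChain} ≡.refl (fromCycle ((face [] [] [] ≡.refl ∷ []) , closed ≋-refl)) r , trans (prep v q') q ,
    ≋-trans same (≋-trans same' (exact λ φ _ → sym (⟦wedge-unitˡ⟧ w φ)))

  triangle-type : ∀ {e S z} → Joined 3 1 e Any S z → TypeOn ((3 , 1) ∷ (length S ∸ 3 , e) ∷ []) S z
  triangle-type {S = S} (joined {left} {right} {a} {b} q l ca cb _ s) = left ∷ right ∷ [] , wedge a (wedge b unitChain) ,
    step l (fromCycle ca) (step size-R (fromCycle cb) done) ,
    trans (↭P.++⁺ˡ left (↭P.++-identityʳ right)) q ,
    ≋-trans s (wedge-congʳ a (exact λ φ _ → sym (⟦wedge-unitʳ⟧ b φ)))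
    where
    size-R : length right ≡ length S ∸ 3
    size-R = sym (≡.trans (cong (_∸ 3) (≡.trans (sym (↭P.↭-length q)) (≡.trans (length-++ left) (cong (_+ length right) l)))) ≡.refl)

  HasType-from : ∀ {n T z} → TypeOn T (upTo n) z → HasType p n T z
  HasType-from (Ss , w , r , q , same) = Ss , w , r , q , ≋⇒≈ same

-- The parts of the theorem

module Main (p : ℕ) {third : ℤ} (third-inverse : Modular._≡ₚ_ p (third *ℤ (+ 3)) 1ℤ) where
  open Spans p
  open TwoVertices p
  open Induction p {third} third-inverse
  open Presentation p

  pentagons-type : ∀ q {S z} → Pentagons q S z → TypeOn (replicate q (5 , 2)) S z
  pentagons-type zero (≡.refl , same) = [] , unitChain , done , refl , same
  pentagons-type (suc q) j = joined-type (pentagons-type q) j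

  generatedBy : ∀ {n e F} {P : Chain → Set} → Generated n e F → (∀ {z} → F (upTo n) z → P z) → GeneratedBy p n e P
  generatedBy {n} G h z cz with present (G (UniqueP.upTo⁺ n) (length-upTo n) (toCycle cz))
  ... | presented gs b mg ob hb = gs , All.map (λ (c , m) → fromCycle c , h m) mg , b , fromOn ob , ≋⇒≈ hb

  vanishes : ∀ {n e} → Generated n e Never → ∀ z → IsCycleOn p (upTo n) e z → Homologous p n e z []
  vanishes {n} {e} G z cz with generatedBy {P = λ _ → ⊥} G (λ ()) z cz
  ... | [] , [] , hom = hom
  ... | _ ∷ _ , (_ , ()) ∷ _ , _

  -- With d = e - 1 the hypothesis negates 2n - 8 ≤ 5d, that is, the slack is at least 4. The slack
  -- has the parity of e, so for odd e it is at least 5.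
  vanishing : ∀ n e → 5 * e + 3 < 2 * n → Generated n e Never
  vanishing n e h with parity e
  ... | q , inj₁ ≡.refl = subst (λ n → Generated n (twos q) Never) total (Even.vanishing (proj₁ (all-degrees q)) k)
    where
    bound : 2 + fives q ≤ n
    bound = halve-< (1 + fives q) n (subst (_< 2 * n) (≡.trans (cong (_+ 3) (5*twos q)) (lem (fives q))) h)
      where
      lem : ∀ f → 2 * f + 3 ≡ 1 + 2 * (1 + f)
      lem = ℕSolver.solve-∀
    k : ℕ
    k = n ∸ (2 + fives q)
    total : 2 + k + fives q ≡ n
    total = ≡.trans (lem k (fives q)) (ℕP.m∸n+n≡m bound)
      where
      lem : ∀ k f → 2 + k + f ≡ k + (2 + f)
      lem = ℕSolver.solve-∀
  ... | q , inj₂ ≡.refl = subst (λ n → Generated n (suc (twos q)) Never) total (Odd.vanishing (proj₂ (all-degrees q)) k)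
    where
    bound : 5 + fives q ≤ n
    bound = ℕP.*-cancelˡ-< 2 (4 + fives q) n (subst (_< 2 * n)
      (≡.trans (cong (_+ 3) (≡.trans (ℕP.*-suc 5 (twos q)) (cong (λ m → 5 + m) (5*twos q)))) (lem (fives q))) h)
      where
      lem : ∀ f → 5 + 2 * f + 3 ≡ 2 * (4 + f)
      lem = ℕSolver.solve-∀
    k : ℕ
    k = n ∸ (5 + fives q)
    total : 5 + k + fives q ≡ n
    total = ≡.trans (lem k (fives q)) (ℕP.m∸n+n≡m bound)
      where
      lem : ∀ k f → 5 + k + f ≡ k + (5 + f)
      lem = ℕSolver.solve-∀

  vanish : (n e : ℕ) → 5 * e + 3 < 2 * n → (z : Chain) → IsCycleOn p (upTo n) e z → Homologous p n e z []
  vanish n e h = vanishes (vanishing n e h)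

  part-i : (q : ℕ) → GeneratedBy p (fives q) (twos q)
    (λ g → HasType p (fives q) (replicate q (5 , 2)) g ⊎ HasType p (fives q) ((3 , 1) ∷ (fives q ∸ 3 , twos q ∸ 1) ∷ []) g)
  part-i q = generatedBy (Even.I (proj₁ (all-degrees q))) λ
    { (inj₁ m) → inj₁ (HasType-from (pentagons-type q m))
    ; {z} (inj₂ (e , twos≡ , j)) → inj₂ (HasType-from (subst (λ t → TypeOn t (upTo (fives q)) z)
        (cong₂ (λ n d → (3 , 1) ∷ (n ∸ 3 , d) ∷ []) (length-upTo (fives q)) (cong (_∸ 1) (sym twos≡))) (triangle-type j))) }

  part-ii : (q : ℕ) → GeneratedBy p (1 + fives q) (twos q) (HasType p (1 + fives q) ((1 , 0) ∷ replicate q (5 , 2)))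
  part-ii q = generatedBy (Even.II (proj₁ (all-degrees q))) λ m → HasType-from (pointed-type (pentagons-type q) m)

  part-iii : (q : ℕ) → GeneratedBy p (3 + fives q) (1 + twos q) (HasType p (3 + fives q) ((3 , 1) ∷ replicate q (5 , 2)))
  part-iii q = generatedBy (Odd.III (proj₂ (all-degrees q))) λ m → HasType-from (joined-type (pentagons-type q) m)

  part-iv : (q : ℕ) → GeneratedBy p (4 + fives q) (1 + twos q) (HasType p (4 + fives q) ((1 , 0) ∷ (3 , 1) ∷ replicate q (5 , 2)))
  part-iv q = generatedBy (Odd.IV (proj₂ (all-degrees q))) λ m →
    HasType-from (pointed-type (joined-type (pentagons-type q)) m)

shifted : ∀ {a b} c → a ≡ b → c + a ≡ b + c
shifted {b = b} c eq = ≡.trans (cong (λ a → c + a) eq) (ℕP.+-comm c b)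

theorem5p8 : (p : ℕ) → Prime p → p ≢ 3 →
    ((n e : ℕ) → 5 * e + 3 < 2 * n → (z : Chain) → IsCycleOn p (upTo n) e z →
    Homologous p n e z [])
    × ((q : ℕ) → GeneratedBy p (5 * q) (2 * q)
    (λ g → HasType p (5 * q) (replicate q (5 , 2)) g
    ⊎ HasType p (5 * q) ((3 , 1) ∷ (5 * q ∸ 3 , 2 * q ∸ 1) ∷ []) g))
    × ((q : ℕ) → GeneratedBy p (5 * q + 1) (2 * q)
    (HasType p (5 * q + 1) ((1 , 0) ∷ replicate q (5 , 2))))
    × ((q : ℕ) → GeneratedBy p (5 * q + 3) (2 * q + 1)
    (HasType p (5 * q + 3) ((3 , 1) ∷ replicate q (5 , 2))))
    × ((q : ℕ) → GeneratedBy p (5 * q + 4) (2 * q + 1)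
    (HasType p (5 * q + 4) ((1 , 0) ∷ (3 , 1) ∷ replicate q (5 , 2))))
theorem5p8 p pr p≢3 with invert-3 pr p≢3
... | t , t-inverse =
    vanish
  , (λ q → subst₂ (λ n e → GeneratedBy p n e (λ g → HasType p n (replicate q (5 , 2)) g ⊎ HasType p n ((3 , 1) ∷ (n ∸ 3 , e ∸ 1) ∷ []) g))
      (fives-* q) (twos-* q) (part-i q))
  , (λ q → subst₂ (λ n e → GeneratedBy p n e (HasType p n ((1 , 0) ∷ replicate q (5 , 2))))
      (shifted 1 (fives-* q)) (twos-* q) (part-ii q))
  , (λ q → subst₂ (λ n e → GeneratedBy p n e (HasType p n ((3 , 1) ∷ replicate q (5 , 2))))
      (shifted 3 (fives-* q)) (shifted 1 (twos-* q)) (part-iii q))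
  , (λ q → subst₂ (λ n e → GeneratedBy p n e (HasType p n ((1 , 0) ∷ (3 , 1) ∷ replicate q (5 , 2))))
      (shifted 4 (fives-* q)) (shifted 1 (twos-* q)) (part-iv q))
  where open Main p {t} t-inverse
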